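{- Let $s,n\in\mathbb N$ with $s\le n$ and let $p,q,R,\alpha,\eta>0$ satisfy $$p\le\frac1{2^{11}s^2},\qquad 2p\le q\le\alpha<1,\qquad R\ge2^{ -6}pn,\qquad\eta\le\frac{(1-\alpha)^{2s}}4.$$ Let $\mathcal H$ be an $s$-uniform hypergraph with $n$ vertices and let $$\mathcal J=\{L\subset V(\mathcal H):\mathcal H[L]\text{ is }(p/(q-p),\eta R)\text{ -Janson}\}.$$ Then there exist a family $\mathcal Y\subset2^{V(\mathcal H)}\times2^{V(\mathcal H)}$ and functions $g:\mathcal I(\mathcal J)\to\mathcal Y$, $f:\mathcal Y\to2^{V(\mathcal H)}$ such that: (1) for every $I\in\mathcal I(\mathcal J)$, if $g(I)=(S,T)$ then $S\cup T\subset I\subset f(S,T)$; (2) every $(S,T)\in\mathcal Y$ satisfies $|S|\le2^{11}ps^2n$ and $|T|\le qn/\alpha$; (3) for every $Y\in\mathcal Y$, the hypergraph $\mathcal H[f(Y)]$ is not $(p,R)$-Janson.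
   Context: A hypergraph is identified with its edge set; $\mathcal H[L]=\{E\in\mathcal H:E\subset L\}$. $\mathcal I(\mathcal J)$ denotes the family of independent sets of $\mathcal J$ (subsets of the vertex set $V(\mathcal H)$ containing no edge of $\mathcal J$). For $\nu:\mathcal G\to\mathbb R_{\ge0}$: $e(\nu)=\sum_E\nu(E)$, $d_\nu(L)=\sum_{E\in\mathcal G,L\subset E}\nu(E)$, $\Lambda_p(\nu)=\sum_{L\subset V(\mathcal G),|L|\ge2}d_\nu(L)^2p^{ -|L|}$. For $p,R>0$, $\mathcal G$ is $(p,R)$-Janson if some $\nu:\mathcal G\to\mathbb R_{\ge0}$ has $\Lambda_p(\nu)<e(\nu)^2/R$. -}

module Defs where

open import Algebra.Bundles using (CommutativeRing; Semiring)
import Algebra.Definitions.RawSemiring as RawSemiringDefs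
open import Data.Bool.Base using (Bool; T; _∧_)
open import Data.Bool.Properties using (T?)
open import Data.Fin.Subset using (Subset; inside; outside; _⊆_; ∣_∣)
open import Data.Fin.Subset.Properties using (_⊆?_)
open import Data.List.Base using (List; []; _∷_; _++_; map; filter; foldr)
open import Data.Nat.Base as ℕ using (ℕ; zero; suc)
import Data.Nat.Properties as ℕₚ
open import Data.Product.Base using (∃; _×_)
import Data.Vec.Base as Vec
open import Level using (_⊔_) renaming (suc to lsuc)
open import Relation.Binary.Core using (Rel)
open import Relation.Binary.PropositionalEquality.Core using (_≡_)
open import Relation.Binary.Structures using (IsTotalOrder)
import Relation.Binary.Construct.NonStrictToStrict as ToStrict
open import Relation.Nullary.Decidable.Core using (⌊_⌋)
open import Relation.Nullary.Negation.Core using (¬_)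
open import Relation.Unary using (Pred)

-- The real numbers, axiomatised as a Dedekind-complete ordered field (with
-- setoid equality).  Classically such a field is unique up to isomorphism.
record Reals c ℓ₁ ℓ₂ : Set (lsuc (c ⊔ ℓ₁ ⊔ ℓ₂)) where
  infix  4 _≤_
  infix  8 _⁻¹
  infixl 7 _/_
  field
    commutativeRing : CommutativeRing c ℓ₁

  open CommutativeRing commutativeRing public
  open RawSemiringDefs (Semiring.rawSemiring semiring) public using (_^_) renaming (_×_ to _·_)

  field
    0≉1 : ¬ (0# ≈ 1#)

    -- The inverse is total; its value at 0# is unspecified.
    _⁻¹        : Carrier → Carrier
    ⁻¹-cong    : ∀ {x y} → x ≈ y → x ⁻¹ ≈ y ⁻¹
    *-inverseʳ : ∀ {x} → ¬ (x ≈ 0#) → x * x ⁻¹ ≈ 1#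

    _≤_          : Rel Carrier ℓ₂
    isTotalOrder : IsTotalOrder _≈_ _≤_
    +-monoˡ-≤    : ∀ z {x y} → x ≤ y → x + z ≤ y + z
    *-nonNeg     : ∀ {x y} → 0# ≤ x → 0# ≤ y → 0# ≤ x * y

  UpperBound : Pred Carrier (c ⊔ ℓ₁ ⊔ ℓ₂) → Pred Carrier (c ⊔ ℓ₁ ⊔ ℓ₂)
  UpperBound P b = ∀ x → P x → x ≤ b

  field
    complete : (P : Pred Carrier (c ⊔ ℓ₁ ⊔ ℓ₂)) → ∃ P → ∃ (UpperBound P) →
               ∃ λ b → UpperBound P b × (∀ b′ → UpperBound P b′ → b ≤ b′)

  open ToStrict _≈_ _≤_ public using (_<_)

  _/_ : Carrier → Carrier → Carrier
  x / y = x * y ⁻¹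

  fromℕ : ℕ → Carrier
  fromℕ n = n · 1#

  ∑ : ∀ {a} {A : Set a} → List A → (A → Carrier) → Carrier
  ∑ xs f = foldr (λ x acc → f x + acc) 0# xs

-- A hypergraph on the vertex set Fin n, identified with (the characteristic
-- function of) its edge set.
Hypergraph : ℕ → Set
Hypergraph n = Subset n → Bool

module _ {n : ℕ} where

  infix 4 _∈ₑ_
  _∈ₑ_ : Subset n → Hypergraph n → Set
  E ∈ₑ 𝓖 = T (𝓖 E)

  infix 20 _[_]
  _[_] : Hypergraph n → Subset n → Hypergraph n
  (𝓗 [ L ]) E = 𝓗 E ∧ ⌊ E ⊆? L ⌋

  Uniform : ℕ → Hypergraph n → Set
  Uniform s 𝓗 = ∀ E → E ∈ₑ 𝓗 → ∣ E ∣ ≡ s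

  -- Stated for an arbitrary family of edges, not only a Boolean-valued one,
  -- since being Janson is not decidable a priori.
  Independent : ∀ {ℓ} → Pred (Subset n) ℓ → Pred (Subset n) ℓ
  Independent 𝓙 I = ∀ E → 𝓙 E → ¬ (E ⊆ I)

-- Every subset of Fin n, listed exactly once.
subsets : ∀ n → List (Subset n)
subsets zero    = Vec.[] ∷ []
subsets (suc n) = map (outside Vec.∷_) (subsets n) ++ map (inside Vec.∷_) (subsets n)

edges : ∀ {n} → Hypergraph n → List (Subset n)
edges 𝓖 = filter (λ E → T? (𝓖 E)) (subsets _)

module Janson {c ℓ₁ ℓ₂} (ℝ : Reals c ℓ₁ ℓ₂) {n : ℕ} where
  open Reals ℝ

  -- A weight ν : 𝓖 → ℝ≥0 is represented by a function on all subsets whose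
  -- values outside 𝓖 are unconstrained and never read.
  NonNegativeOn : Hypergraph n → (Subset n → Carrier) → Set ℓ₂
  NonNegativeOn 𝓖 ν = ∀ E → E ∈ₑ 𝓖 → 0# ≤ ν E

  e : Hypergraph n → (Subset n → Carrier) → Carrier
  e 𝓖 ν = ∑ (edges 𝓖) ν

  d : Hypergraph n → (Subset n → Carrier) → Subset n → Carrier
  d 𝓖 ν L = ∑ (filter (L ⊆?_) (edges 𝓖)) ν

  -- L ranges over all subsets of Fin n; those not contained in an edge of 𝓖
  -- contribute 0, so the choice of ambient vertex set does not matter.
  Λ : Carrier → Hypergraph n → (Subset n → Carrier) → Carrier
  Λ p 𝓖 ν = ∑ (filter (λ L → 2 ℕₚ.≤? ∣ L ∣) (subsets n))
              λ L → d 𝓖 ν L ^ 2 * (p ^ ∣ L ∣) ⁻¹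

  IsJanson : Carrier → Carrier → Hypergraph n → Set (c ⊔ ℓ₁ ⊔ ℓ₂)
  IsJanson p R 𝓖 = ∃ λ ν → NonNegativeOn 𝓖 ν × Λ p 𝓖 ν < e 𝓖 ν ^ 2 / R

{-# OPTIONS --safe #-}

-- The proof runs one algorithm twice.  Given a decreasing event B and a random
-- set X of density p, let Φ(S) be the probability that X ∪ S satisfies B.  Ask
-- whether L ⊆ I for any set L with Φ(S ∪ L) ≤ (1 - δ)^|L ─ S| Φ(S); on "yes" add
-- L to S, on "no" strengthen B to exclude supersets of L.  Since
-- (1 - p)^n ≤ Φ(S) ≤ (1 - δ)^|S|, the fingerprint S has at most pn/δ elements,
-- and it answers all the queries, so it determines the outcome.
--
-- The first run has density q, slack α, starts from B = I(𝓙) and queries sets;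
-- it produces T.  For the edges that it leaves accepted, averaging
-- e(ν)² ≤ ηR Λ(ν) over the random set conditioned on B bounds their weight.
-- The second run has density p, slack δ = 1/(2¹¹s²), starts from the final B of
-- the first and queries vertices; it produces S, and the container consists of
-- the vertices that were not rejected.  Each of them can be added to the random
-- set conditioned on B with probability at least 1 - δ, whereas adding the
-- vertices of a rejected edge one by one must fail at some point; a weighted
-- second moment computation turns this into a bound on the weight of the
-- rejected edges.
module Submission where

open import Defs
import Algebra.Properties.Semiring.Exp as Exp
import Algebra.Properties.Semiring.Mult as Mult
import Algebra.Solver.Ring.NaturalCoefficients.Default as SemiringSolver
open import Axiom.ExcludedMiddle using (ExcludedMiddle)
open import Data.Bool.Base using (true; false; Bool; T; _∧_; not)
import Data.Bool.Properties as Boolₚ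
open import Data.Empty using (⊥; ⊥-elim)
open import Data.Fin.Base as Fin using (Fin)
open import Data.Fin.Subset using (Subset; inside; outside; _∈_; _⊆_; _∪_; _∩_; _─_; ∣_∣; ⁅_⁆) renaming (⊥ to ∅)
open import Data.Fin.Subset.Properties as Subsetₚ using (_⊆?_)
open import Data.List.Base using (List; []; _∷_; _++_; map; filter; allFin; length)
open import Data.List.Membership.Propositional using () renaming (_∈_ to _∈ₗ_)
open import Data.List.Membership.Propositional.Properties using (∈-map⁺; ∈-++⁺ˡ; ∈-++⁺ʳ; ∈-allFin)
import Data.List.Properties as Listₚ
open import Data.List.Relation.Unary.All as All using (All; []; _∷_)
open import Data.List.Relation.Unary.Any using (here; there)
open import Data.Nat.Base as ℕ using (ℕ; zero; suc; z≤n; s≤s)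
import Data.Nat.Properties as ℕₚ
open import Data.Product.Base using (Σ-syntax; ∃; _×_; _,_; proj₁; proj₂)
open import Data.Sum.Base as Sum using (_⊎_; inj₁; inj₂; [_,_]′)
open import Data.Unit.Base using (tt)
open import Data.Vec.Base as Vec using ([]; _∷_)
import Data.Vec.Properties as Vecₚ
open import Function.Base using (_∘_; id; case_of_)
open import Function.Bundles using (module Equivalence)
open import Level using (Lift; lift; lower; 0ℓ; _⊔_)
open import Relation.Binary.Bundles using (TotalOrder)
open import Relation.Binary.PropositionalEquality as ≡ using (_≡_)
import Relation.Binary.Reasoning.PartialOrder as PosetReasoning
open import Relation.Nullary.Decidable using (Dec; does; yes; no; ⌊_⌋; dec-true; dec-false; isYes≗does; toWitness)
open import Relation.Nullary.Negation.Core using (¬_; contradiction)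
open import Relation.Unary using (Pred; Decidable)

-- A weight making the container `(p, R)`-Janson is split into the edges accepted and rejected by
-- the final event of the first run. Each part is shown to carry less than half of the total, a
-- contradiction; the 4 in the bound on `η` is this half, squared. Every edge is divided by the
-- probability that the random set contains it. First moments then return total weights, and in
-- second moments a pair costs the inverse density to the power `k = |E ∩ F|`. In the first run the
-- sum over `L ⊆ E ∩ F` in `Λ` at density `p/(q-p)` is at most `(1 + (q-p)/p)^k = (q/p)^k`, and
-- `q^-k (q/p)^k = p^-k`: this density is the one that leads back to `Λ` at `p`. The obstacle in the
-- second run is that `Λ` says nothing about pairs of edges sharing a single vertex. A loss is
-- therefore charged to the vertex `v` that is being added, and only the vertices before `v` are
-- required in the random set, so that the shared `v` is not paid for. AM-GM with a parameter of
-- order `t` times the degree makes the blocked probability cost about `δ t s` and the degrees about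
-- `s / t`; hence `t` of order `s` and `δ` of order `1/s²`.

-- Inequalities in ordered fields, ending with the bound behind the fingerprint sizes.

module OrderedField {c ℓ₁ ℓ₂} (ℝ : Reals c ℓ₁ ℓ₂) where
  open Reals ℝ public hiding (zero)
  open Exp semiring public using (^-congˡ; ^-congʳ; ^-homo-*)
  open Mult semiring public using (×-homo-+)

  totalOrder : TotalOrder c ℓ₁ ℓ₂
  totalOrder = record { isTotalOrder = isTotalOrder }

  open TotalOrder totalOrder public
    using (poset; total; antisym; ≤-respʳ-≈)
    renaming (refl to ≤-refl; reflexive to ≤-reflexive; trans to ≤-trans)
  module ≤-Reasoning = PosetReasoning poset
  module Solver = SemiringSolver commutativeSemiring
  open Solver using (solve; _:=_; _:+_; _:*_; con)
  open ≤-Reasoning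

  +-monoʳ-≤ : ∀ z {x y} → x ≤ y → z + x ≤ z + y
  +-monoʳ-≤ z {x} {y} x≤y = begin
    z + x  ≈⟨ +-comm z x ⟩
    x + z  ≤⟨ +-monoˡ-≤ z x≤y ⟩
    y + z  ≈⟨ +-comm y z ⟩
    z + y  ∎

  +-mono-≤ : ∀ {x y u v} → x ≤ y → u ≤ v → x + u ≤ y + v
  +-mono-≤ {y = y} {u} x≤y u≤v = ≤-trans (+-monoˡ-≤ u x≤y) (+-monoʳ-≤ y u≤v)

  x+[y-x]≈y : ∀ x y → x + (y - x) ≈ y
  x+[y-x]≈y x y = begin-equality
    x + (y - x)    ≈⟨ +-congˡ (+-comm y (- x)) ⟩
    x + (- x + y)  ≈⟨ +-assoc x (- x) y ⟨
    (x - x) + y    ≈⟨ +-congʳ (-‿inverseʳ x) ⟩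
    0# + y         ≈⟨ +-identityˡ y ⟩
    y              ∎

  x≤y⇒0≤y-x : ∀ {x y} → x ≤ y → 0# ≤ y - x
  x≤y⇒0≤y-x {x} {y} x≤y = begin
    0#     ≈⟨ -‿inverseʳ x ⟨
    x - x  ≤⟨ +-monoˡ-≤ (- x) x≤y ⟩
    y - x  ∎

  -- Writing the larger side of an inequality as a sum keeps all algebra
  -- subtraction-free, so that the semiring solver applies.
  ≤⇒∃+ : ∀ {x y} → x ≤ y → ∃ λ z → 0# ≤ z × y ≈ x + z
  ≤⇒∃+ {x} {y} x≤y = y - x , x≤y⇒0≤y-x x≤y , sym (x+[y-x]≈y x y)

  x≤x+y : ∀ {x y} → 0# ≤ y → x ≤ x + y
  x≤x+y {x} {y} 0≤y = begin
    x       ≈⟨ +-identityʳ x ⟨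
    x + 0#  ≤⟨ +-monoʳ-≤ x 0≤y ⟩
    x + y   ∎

  x≤y+x : ∀ {x y} → 0# ≤ y → x ≤ y + x
  x≤y+x 0≤y = ≤-trans (x≤x+y 0≤y) (≤-reflexive (+-comm _ _))

  +-cancelʳ-≤ : ∀ z {x y} → x + z ≤ y + z → x ≤ y
  +-cancelʳ-≤ z {x} {y} x+z≤y+z = begin
    x              ≈⟨ +-identityʳ x ⟨
    x + 0#         ≈⟨ +-congˡ (-‿inverseʳ z) ⟨
    x + (z - z)    ≈⟨ +-assoc x z (- z) ⟨
    (x + z) - z    ≤⟨ +-monoˡ-≤ (- z) x+z≤y+z ⟩
    (y + z) - z    ≈⟨ +-assoc y z (- z) ⟩
    y + (z - z)    ≈⟨ +-congˡ (-‿inverseʳ z) ⟩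
    y + 0#         ≈⟨ +-identityʳ y ⟩
    y              ∎

  +-cancelˡ-≤ : ∀ z {x y} → z + x ≤ z + y → x ≤ y
  +-cancelˡ-≤ z {x} {y} h = +-cancelʳ-≤ z (begin
    x + z  ≈⟨ +-comm x z ⟩
    z + x  ≤⟨ h ⟩
    z + y  ≈⟨ +-comm z y ⟩
    y + z  ∎)

  *-monoʳ-≤ : ∀ {z x y} → 0# ≤ z → x ≤ y → z * x ≤ z * y
  *-monoʳ-≤ {z} {x} {y} 0≤z x≤y with w , 0≤w , y≈x+w ← ≤⇒∃+ x≤y = begin
    z * x          ≤⟨ x≤x+y (*-nonNeg 0≤z 0≤w) ⟩
    z * x + z * w  ≈⟨ distribˡ z x w ⟨
    z * (x + w)    ≈⟨ *-congˡ y≈x+w ⟨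
    z * y          ∎

  *-monoˡ-≤ : ∀ {z x y} → 0# ≤ z → x ≤ y → x * z ≤ y * z
  *-monoˡ-≤ {z} {x} {y} 0≤z x≤y = begin
    x * z  ≈⟨ *-comm x z ⟩
    z * x  ≤⟨ *-monoʳ-≤ 0≤z x≤y ⟩
    z * y  ≈⟨ *-comm z y ⟩
    y * z  ∎

  *-mono-≤ : ∀ {x y u v} → 0# ≤ u → 0# ≤ y → x ≤ y → u ≤ v → x * u ≤ y * v
  *-mono-≤ 0≤u 0≤y x≤y u≤v = ≤-trans (*-monoˡ-≤ 0≤u x≤y) (*-monoʳ-≤ 0≤y u≤v)

  0≤x+y : ∀ {x y} → 0# ≤ x → 0# ≤ y → 0# ≤ x + y
  0≤x+y 0≤x 0≤y = ≤-trans 0≤x (x≤x+y 0≤y)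

  0≤x*x : ∀ x → 0# ≤ x * x
  0≤x*x x with total 0# x
  ... | inj₁ 0≤x = *-nonNeg 0≤x 0≤x
  ... | inj₂ x≤0 with w , 0≤w , 0≈x+w ← ≤⇒∃+ x≤0 = begin
    0#                 ≤⟨ *-nonNeg 0≤w 0≤w ⟩
    w * w              ≈⟨ +-identityʳ _ ⟨
    w * w + 0#         ≈⟨ +-congˡ (zeroʳ x) ⟨
    w * w + x * 0#     ≈⟨ +-congˡ (*-congˡ 0≈x+w) ⟩
    w * w + x * (x + w) ≈⟨ solve 2 (λ x w → w :* w :+ x :* (x :+ w) := x :* x :+ w :* (x :+ w)) refl x w ⟩
    x * x + w * (x + w) ≈⟨ +-congˡ (*-congˡ 0≈x+w) ⟨
    x * x + w * 0#     ≈⟨ +-congˡ (zeroʳ w) ⟩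
    x * x + 0#         ≈⟨ +-identityʳ _ ⟩
    x * x              ∎

  0≤1 : 0# ≤ 1#
  0≤1 = ≤-respʳ-≈ (*-identityˡ 1#) (0≤x*x 1#)

  0≤fromℕ : ∀ n → 0# ≤ fromℕ n
  0≤fromℕ zero    = ≤-refl
  0≤fromℕ (suc n) = 0≤x+y 0≤1 (0≤fromℕ n)

  fromℕ-mono-≤ : ∀ {m n} → m ℕ.≤ n → fromℕ m ≤ fromℕ n
  fromℕ-mono-≤ {n = n} z≤n = 0≤fromℕ n
  fromℕ-mono-≤ (s≤s m≤n)   = +-monoʳ-≤ 1# (fromℕ-mono-≤ m≤n)

  0≤^ : ∀ {x} → 0# ≤ x → ∀ n → 0# ≤ x ^ n
  0≤^ 0≤x zero    = 0≤1
  0≤^ 0≤x (suc n) = *-nonNeg 0≤x (0≤^ 0≤x n)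

  1^n≈1 : ∀ n → 1# ^ n ≈ 1#
  1^n≈1 zero    = refl
  1^n≈1 (suc n) = trans (*-identityˡ _) (1^n≈1 n)

  *-distrib-^ : ∀ x y n → (x * y) ^ n ≈ x ^ n * y ^ n
  *-distrib-^ x y zero    = sym (*-identityˡ 1#)
  *-distrib-^ x y (suc n) = begin-equality
    x * y * (x * y) ^ n      ≈⟨ *-congˡ (*-distrib-^ x y n) ⟩
    x * y * (x ^ n * y ^ n)  ≈⟨ solve 4 (λ x y a b → x :* y :* (a :* b) := x :* a :* (y :* b)) refl x y (x ^ n) (y ^ n) ⟩
    x * x ^ n * (y * y ^ n)  ∎

  x*y≈1⇒x^n*y^n≈1 : ∀ {x y} n → x * y ≈ 1# → x ^ n * y ^ n ≈ 1#
  x*y≈1⇒x^n*y^n≈1 {x} {y} n xy≈1 = begin-equality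
    x ^ n * y ^ n  ≈⟨ *-distrib-^ x y n ⟨
    (x * y) ^ n    ≈⟨ ^-congˡ n xy≈1 ⟩
    1# ^ n         ≈⟨ 1^n≈1 n ⟩
    1#             ∎

  1≤^ : ∀ {x} → 1# ≤ x → ∀ n → 1# ≤ x ^ n
  1≤^ 1≤x zero    = ≤-refl
  1≤^ {x} 1≤x (suc n) = begin
    1#         ≈⟨ *-identityˡ 1# ⟨
    1# * 1#    ≤⟨ *-mono-≤ 0≤1 (≤-trans 0≤1 1≤x) 1≤x (1≤^ 1≤x n) ⟩
    x * x ^ n  ∎

  ^-monoʳ-≤ : ∀ {x} → 1# ≤ x → ∀ {m n} → m ℕ.≤ n → x ^ m ≤ x ^ n
  ^-monoʳ-≤ 1≤x {n = n} z≤n = 1≤^ 1≤x n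
  ^-monoʳ-≤ 1≤x (s≤s m≤n)   = *-monoʳ-≤ (≤-trans 0≤1 1≤x) (^-monoʳ-≤ 1≤x m≤n)

  ^≤1 : ∀ {x} → 0# ≤ x → x ≤ 1# → ∀ n → x ^ n ≤ 1#
  ^≤1 0≤x x≤1 zero    = ≤-refl
  ^≤1 {x} 0≤x x≤1 (suc n) = begin
    x * x ^ n  ≤⟨ *-mono-≤ (0≤^ 0≤x n) 0≤1 x≤1 (^≤1 0≤x x≤1 n) ⟩
    1# * 1#    ≈⟨ *-identityˡ 1# ⟩
    1#         ∎

  ^-antimonoʳ-≤ : ∀ {x} → 0# ≤ x → x ≤ 1# → ∀ {m n} → m ℕ.≤ n → x ^ n ≤ x ^ m
  ^-antimonoʳ-≤ 0≤x x≤1 {n = n} z≤n = ^≤1 0≤x x≤1 n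
  ^-antimonoʳ-≤ 0≤x x≤1 (s≤s m≤n)   = *-monoʳ-≤ 0≤x (^-antimonoʳ-≤ 0≤x x≤1 m≤n)

  x^2≈x*x : ∀ x → x ^ 2 ≈ x * x
  x^2≈x*x x = *-congˡ (*-identityʳ x)

  <⇒≱ : ∀ {x y} → x < y → ¬ (y ≤ x)
  <⇒≱ (x≤y , x≉y) y≤x = x≉y (antisym x≤y y≤x)

  ≰⇒> : ∀ {x y} → ¬ (x ≤ y) → y < x
  ≰⇒> {x} {y} x≰y with total x y
  ... | inj₁ x≤y = contradiction x≤y x≰y
  ... | inj₂ y≤x = y≤x , λ y≈x → x≰y (≤-reflexive (sym y≈x))

  >⇒≉ : ∀ {x} → 0# < x → ¬ (x ≈ 0#)
  >⇒≉ (_ , 0≉x) x≈0 = 0≉x (sym x≈0)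

  <-≤-trans : ∀ {x y z} → x < y → y ≤ z → x < z
  <-≤-trans x<y y≤z = ≰⇒> λ z≤x → <⇒≱ x<y (≤-trans y≤z z≤x)

  ≤-<-trans : ∀ {x y z} → x ≤ y → y < z → x < z
  ≤-<-trans x≤y y<z = ≰⇒> λ z≤x → <⇒≱ y<z (≤-trans z≤x x≤y)

  0<1 : 0# < 1#
  0<1 = 0≤1 , 0≉1

  x*x⁻¹≈1 : ∀ {x} → 0# < x → x * x ⁻¹ ≈ 1#
  x*x⁻¹≈1 0<x = *-inverseʳ (>⇒≉ 0<x)

  0<⁻¹ : ∀ {x} → 0# < x → 0# < x ⁻¹
  0<⁻¹ {x} 0<x@(0≤x , _) = ≰⇒> λ x⁻¹≤0 → <⇒≱ 0<1 (begin
    1#        ≈⟨ x*x⁻¹≈1 0<x ⟨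
    x * x ⁻¹  ≤⟨ *-monoʳ-≤ 0≤x x⁻¹≤0 ⟩
    x * 0#    ≈⟨ zeroʳ x ⟩
    0#        ∎)

  *-cancelˡ-≤ : ∀ {z x y} → 0# < z → z * x ≤ z * y → x ≤ y
  *-cancelˡ-≤ {z} {x} {y} 0<z zx≤zy = begin
    x                ≈⟨ lemma x ⟨
    z ⁻¹ * (z * x)   ≤⟨ *-monoʳ-≤ (proj₁ (0<⁻¹ 0<z)) zx≤zy ⟩
    z ⁻¹ * (z * y)   ≈⟨ lemma y ⟩
    y                ∎
    where
    lemma : ∀ x → z ⁻¹ * (z * x) ≈ x
    lemma x = begin-equality
      z ⁻¹ * (z * x)  ≈⟨ *-assoc _ _ _ ⟨
      z ⁻¹ * z * x    ≈⟨ *-congʳ (*-comm _ _) ⟩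
      z * z ⁻¹ * x    ≈⟨ *-congʳ (x*x⁻¹≈1 0<z) ⟩
      1# * x          ≈⟨ *-identityˡ x ⟩
      x               ∎

  *-pos : ∀ {x y} → 0# < x → 0# < y → 0# < x * y
  *-pos {x} {y} 0<x 0<y = ≰⇒> λ xy≤0 → <⇒≱ 0<y
    (*-cancelˡ-≤ 0<x (≤-trans xy≤0 (≤-reflexive (sym (zeroʳ x)))))

  ^-pos : ∀ {x} → 0# < x → ∀ n → 0# < x ^ n
  ^-pos 0<x zero    = 0<1
  ^-pos 0<x (suc n) = *-pos 0<x (^-pos 0<x n)

  fromℕ-pos : ∀ {n} → 1 ℕ.≤ n → 0# < fromℕ n
  fromℕ-pos {n} 1≤n = <-≤-trans 0<1
    (≤-trans (≤-reflexive (sym (+-identityʳ 1#))) (fromℕ-mono-≤ 1≤n))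

  x*y≈1⇒x⁻¹≈y : ∀ {x y} → x * y ≈ 1# → x ⁻¹ ≈ y
  x*y≈1⇒x⁻¹≈y {x} {y} xy≈1 = begin-equality
    x ⁻¹            ≈⟨ *-identityʳ _ ⟨
    x ⁻¹ * 1#       ≈⟨ *-congˡ xy≈1 ⟨
    x ⁻¹ * (x * y)  ≈⟨ solve 3 (λ i x y → i :* (x :* y) := x :* i :* y) refl (x ⁻¹) x y ⟩
    x * x ⁻¹ * y    ≈⟨ *-congʳ (*-inverseʳ x≉0) ⟩
    1# * y          ≈⟨ *-identityˡ y ⟩
    y               ∎
    where
    x≉0 : ¬ (x ≈ 0#)
    x≉0 x≈0 = 0≉1 (begin-equality
      0#      ≈⟨ zeroˡ y ⟨
      0# * y  ≈⟨ *-congʳ x≈0 ⟨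
      x * y   ≈⟨ xy≈1 ⟩
      1#      ∎)

  ≤/⇒*≤ : ∀ {x y z} → 0# < z → x ≤ y / z → z * x ≤ y
  ≤/⇒*≤ {x} {y} {z} 0<z x≤y/z = begin
    z * x           ≤⟨ *-monoʳ-≤ (proj₁ 0<z) x≤y/z ⟩
    z * (y * z ⁻¹)  ≈⟨ solve 3 (λ z y i → z :* (y :* i) := z :* i :* y) refl z y (z ⁻¹) ⟩
    z * z ⁻¹ * y    ≈⟨ *-congʳ (x*x⁻¹≈1 0<z) ⟩
    1# * y          ≈⟨ *-identityˡ y ⟩
    y               ∎

  *≤⇒≤/ : ∀ {x y z} → 0# < z → z * x ≤ y → x ≤ y / z
  *≤⇒≤/ {x} {y} {z} 0<z zx≤y = *-cancelˡ-≤ 0<z (begin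
    z * x           ≤⟨ zx≤y ⟩
    y               ≈⟨ *-identityˡ y ⟨
    1# * y          ≈⟨ *-congʳ (x*x⁻¹≈1 0<z) ⟨
    z * z ⁻¹ * y    ≈⟨ solve 3 (λ z y i → z :* i :* y := z :* (y :* i)) refl z y (z ⁻¹) ⟩
    z * (y * z ⁻¹)  ∎)

  </⇒*< : ∀ {x y z} → 0# < z → x < y / z → z * x < y
  </⇒*< 0<z x<y/z = ≰⇒> λ y≤zx → <⇒≱ x<y/z
    (*-cancelˡ-≤ 0<z (≤-trans (≤/⇒*≤ 0<z ≤-refl) y≤zx))

  2xy≤x²+y² : ∀ x y → x * y + x * y ≤ x * x + y * y
  2xy≤x²+y² x y with total x y
  ... | inj₁ x≤y with w , 0≤w , y≈x+w ← ≤⇒∃+ x≤y = begin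
    x * y + x * y                        ≈⟨ +-cong (*-congˡ y≈x+w) (*-congˡ y≈x+w) ⟩
    x * (x + w) + x * (x + w)            ≤⟨ x≤x+y (*-nonNeg 0≤w 0≤w) ⟩
    x * (x + w) + x * (x + w) + w * w    ≈⟨ solve 2 (λ x w → x :* (x :+ w) :+ x :* (x :+ w) :+ w :* w := x :* x :+ (x :+ w) :* (x :+ w)) refl x w ⟩
    x * x + (x + w) * (x + w)            ≈⟨ +-congˡ (*-cong y≈x+w y≈x+w) ⟨
    x * x + y * y                        ∎
  ... | inj₂ y≤x with w , 0≤w , x≈y+w ← ≤⇒∃+ y≤x = begin
    x * y + x * y                        ≈⟨ +-cong (*-congʳ x≈y+w) (*-congʳ x≈y+w) ⟩
    (y + w) * y + (y + w) * y            ≤⟨ x≤x+y (*-nonNeg 0≤w 0≤w) ⟩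
    (y + w) * y + (y + w) * y + w * w    ≈⟨ solve 2 (λ y w → (y :+ w) :* y :+ (y :+ w) :* y :+ w :* w := (y :+ w) :* (y :+ w) :+ y :* y) refl y w ⟩
    (y + w) * (y + w) + y * y            ≈⟨ +-congʳ (*-cong x≈y+w x≈y+w) ⟨
    x * x + y * y                        ∎

  x²<y²⇒x<y : ∀ {x y} → 0# ≤ y → x * x < y * y → x < y
  x²<y²⇒x<y 0≤y x²<y² = ≰⇒> λ y≤x → <⇒≱ x²<y² (*-mono-≤ 0≤y (≤-trans 0≤y y≤x) y≤x y≤x)

  -- The complement is stored rather than computed as `1# - value`, which keeps later identities
  -- free of subtraction and within reach of the semiring solver.
  record Probability : Set (c ⊔ ℓ₁ ⊔ ℓ₂) where
    field
      value complement : Carrier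
      sum≈1            : value + complement ≈ 1#
      0≤value          : 0# ≤ value
      0≤complement     : 0# ≤ complement

  -- AM-GM for t factors x and u factors y, proved by absorbing one factor at
  -- a time into w: a factor on the other side of 1 satisfies w y ≤ w + y - 1.
  private
    absorb : ∀ {a b} → a ≤ 1# → 1# ≤ b → a * b + 1# ≤ a + b
    absorb {a} {b} a≤1 1≤b
      with x , 0≤x , 1≈a+x ← ≤⇒∃+ a≤1 | y , 0≤y , b≈1+y ← ≤⇒∃+ 1≤b = begin
      a * b + 1#               ≈⟨ +-cong (*-congˡ b≈1+y) 1≈a+x ⟩
      a * (1# + y) + (a + x)   ≈⟨ +-congʳ (*-congˡ (+-congʳ 1≈a+x)) ⟩
      a * (a + x + y) + (a + x) ≤⟨ x≤x+y (*-nonNeg 0≤x 0≤y) ⟩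
      a * (a + x + y) + (a + x) + x * y ≈⟨ solve 3 (λ a x y → a :* (a :+ x :+ y) :+ (a :+ x) :+ x :* y := a :* (a :+ x) :+ (a :+ x) :* y :+ (a :+ x)) refl a x y ⟩
      a * (a + x) + (a + x) * y + (a + x) ≈⟨ +-cong (+-cong (*-congˡ 1≈a+x) (*-congʳ 1≈a+x)) 1≈a+x ⟨
      a * 1# + 1# * y + 1#     ≈⟨ solve 2 (λ a y → a :* con 1 :+ con 1 :* y :+ con 1 := a :+ (con 1 :+ y)) refl a y ⟩
      a + (1# + y)             ≈⟨ +-congˡ b≈1+y ⟨
      a + b                    ∎

    mutual
      weighted : ∀ {a b} → 0# ≤ a → a ≤ 1# → 1# ≤ b → ∀ t u w → 0# ≤ w →
                 w + (fromℕ t * a + fromℕ u * b) ≤ 1# + (fromℕ t + fromℕ u) →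
                 w * (a ^ t * b ^ u) ≤ 1#
      weighted {a} {b} 0≤a a≤1 1≤b t u w 0≤w h with total w 1#
      ... | inj₁ w≤1 = weighted-≤1 0≤a a≤1 1≤b t u w 0≤w w≤1 h
      -- No factor below 1 is left to absorb; as `b ≥ 1`, the bound on the sum now forces `w ≤ 1`,
      -- and the other case applies.
      weighted {a} {b} 0≤a a≤1 1≤b zero u w 0≤w h | inj₂ _ =
        weighted-≤1 0≤a a≤1 1≤b zero u w 0≤w (+-cancelʳ-≤ (fromℕ u) w+u≤1+u) h
        where
        w+u≤1+u : w + fromℕ u ≤ 1# + fromℕ u
        w+u≤1+u = begin
          w + fromℕ u                  ≈⟨ solve 3 (λ w u a → w :+ u := w :+ (con 0 :* a :+ u :* con 1)) refl w (fromℕ u) a ⟩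
          w + (0# * a + fromℕ u * 1#)  ≤⟨ +-monoʳ-≤ w (+-monoʳ-≤ _ (*-monoʳ-≤ (0≤fromℕ u) 1≤b)) ⟩
          w + (0# * a + fromℕ u * b)   ≤⟨ h ⟩
          1# + (0# + fromℕ u)          ≈⟨ +-congˡ (+-identityˡ _) ⟩
          1# + fromℕ u                 ∎
      weighted {a} {b} 0≤a a≤1 1≤b (suc t) u w 0≤w h | inj₂ 1≤w
        with z , 0≤z , w≈1+z ← ≤⇒∃+ 1≤w = begin
        w * (a * a ^ t * b ^ u)    ≈⟨ solve 4 (λ w a x y → w :* (a :* x :* y) := a :* w :* (x :* y)) refl w a (a ^ t) (b ^ u) ⟩
        a * w * (a ^ t * b ^ u)    ≤⟨ *-monoˡ-≤ (*-nonNeg (0≤^ 0≤a t) (0≤^ (≤-trans 0≤1 1≤b) u)) aw≤z+a ⟩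
        (z + a) * (a ^ t * b ^ u)  ≤⟨ weighted 0≤a a≤1 1≤b t u (z + a) (0≤x+y 0≤z 0≤a) h′ ⟩
        1#                         ∎
        where
        aw≤z+a : a * w ≤ z + a
        aw≤z+a = +-cancelʳ-≤ 1# (begin
          a * w + 1#     ≤⟨ absorb a≤1 1≤w ⟩
          a + w          ≈⟨ +-congˡ w≈1+z ⟩
          a + (1# + z)   ≈⟨ solve 2 (λ a z → a :+ (con 1 :+ z) := z :+ a :+ con 1) refl a z ⟩
          z + a + 1#     ∎)
        h′ : z + a + (fromℕ t * a + fromℕ u * b) ≤ 1# + (fromℕ t + fromℕ u)
        h′ = +-cancelʳ-≤ 1# (begin
          z + a + (fromℕ t * a + fromℕ u * b) + 1#          ≈⟨ solve 5 (λ z a t u b → z :+ a :+ (t :* a :+ u :* b) :+ con 1 := con 1 :+ z :+ ((con 1 :+ t) :* a :+ u :* b)) refl z a (fromℕ t) (fromℕ u) b ⟩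
          (1# + z) + ((1# + fromℕ t) * a + fromℕ u * b)     ≈⟨ +-congʳ w≈1+z ⟨
          w + ((1# + fromℕ t) * a + fromℕ u * b)            ≤⟨ h ⟩
          1# + ((1# + fromℕ t) + fromℕ u)                   ≈⟨ solve 2 (λ t u → con 1 :+ ((con 1 :+ t) :+ u) := con 1 :+ (t :+ u) :+ con 1) refl (fromℕ t) (fromℕ u) ⟩
          1# + (fromℕ t + fromℕ u) + 1#                     ∎)

      weighted-≤1 : ∀ {a b} → 0# ≤ a → a ≤ 1# → 1# ≤ b → ∀ t u w → 0# ≤ w → w ≤ 1# →
                    w + (fromℕ t * a + fromℕ u * b) ≤ 1# + (fromℕ t + fromℕ u) →
                    w * (a ^ t * b ^ u) ≤ 1#
      weighted-≤1 {a} {b} 0≤a a≤1 1≤b t zero w 0≤w w≤1 h = begin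
        w * (a ^ t * 1#)   ≈⟨ *-congˡ (*-identityʳ _) ⟩
        w * a ^ t          ≤⟨ *-mono-≤ (0≤^ 0≤a t) 0≤1 w≤1 (^≤1 0≤a a≤1 t) ⟩
        1# * 1#            ≈⟨ *-identityˡ 1# ⟩
        1#                 ∎
      weighted-≤1 {a} {b} 0≤a a≤1 1≤b t (suc u) w 0≤w w≤1 h
        with y , 0≤y , b≈1+y ← ≤⇒∃+ 1≤b = begin
        w * (a ^ t * (b * b ^ u))  ≈⟨ solve 4 (λ w b x y → w :* (x :* (b :* y)) := w :* b :* (x :* y)) refl w b (a ^ t) (b ^ u) ⟩
        w * b * (a ^ t * b ^ u)    ≤⟨ *-monoˡ-≤ (*-nonNeg (0≤^ 0≤a t) (0≤^ (≤-trans 0≤1 1≤b) u)) wb≤w+y ⟩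
        (w + y) * (a ^ t * b ^ u)  ≤⟨ weighted 0≤a a≤1 1≤b t u (w + y) (0≤x+y 0≤w 0≤y) h′ ⟩
        1#                         ∎
        where
        wb≤w+y : w * b ≤ w + y
        wb≤w+y = +-cancelʳ-≤ 1# (begin
          w * b + 1#     ≤⟨ absorb w≤1 1≤b ⟩
          w + b          ≈⟨ +-congˡ b≈1+y ⟩
          w + (1# + y)   ≈⟨ solve 2 (λ w y → w :+ (con 1 :+ y) := w :+ y :+ con 1) refl w y ⟩
          w + y + 1#     ∎)
        h′ : w + y + (fromℕ t * a + fromℕ u * b) ≤ 1# + (fromℕ t + fromℕ u)
        h′ = +-cancelʳ-≤ 1# (begin
          w + y + (fromℕ t * a + fromℕ u * b) + 1#          ≈⟨ solve 5 (λ w y t x b → w :+ y :+ (t :+ x) :+ con 1 := w :+ (t :+ ((con 1 :+ y) :+ x))) refl w y (fromℕ t * a) (fromℕ u * b) b ⟩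
          w + (fromℕ t * a + ((1# + y) + fromℕ u * b))      ≈⟨ +-congˡ (+-congˡ (+-congʳ b≈1+y)) ⟨
          w + (fromℕ t * a + (b + fromℕ u * b))             ≈⟨ +-congˡ (+-congˡ (solve 2 (λ b u → b :+ u :* b := (con 1 :+ u) :* b) refl b (fromℕ u))) ⟩
          w + (fromℕ t * a + (1# + fromℕ u) * b)            ≤⟨ h ⟩
          1# + (fromℕ t + (1# + fromℕ u))                   ≈⟨ solve 2 (λ t u → con 1 :+ (t :+ (con 1 :+ u)) := con 1 :+ (t :+ u) :+ con 1) refl (fromℕ t) (fromℕ u) ⟩
          1# + (fromℕ t + fromℕ u) + 1#                     ∎)

  -- A logarithm-free form of the fact that `-log(1-y)/y` increases with `y`. Suppose `y t` exceeds
  -- `x n` by `k`, and apply AM-GM to `t` factors `ȳ / x̄`, `n - t` factors `1 / x̄` and one factor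
  -- `1 + k / x̄`. Their sum is exactly `1 + n`, so their product is at most 1; by hypothesis the
  -- first `n` of them already have product at least 1, hence `k ≤ 0`.
  complement-^-≤⇒ : ∀ {x x̄ y ȳ} → x + x̄ ≈ 1# → y + ȳ ≈ 1# → 0# ≤ x → x ≤ y → 0# < ȳ →
                    ∀ {t n} → t ℕ.≤ n → x̄ ^ n ≤ ȳ ^ t → y * fromℕ t ≤ x * fromℕ n
  complement-^-≤⇒ {x} {x̄} {y} {ȳ} x+x̄≈1 y+ȳ≈1 0≤x x≤y 0<ȳ {t} {n} t≤n x̄ⁿ≤ȳᵗ
    with total (y * fromℕ t) (x * fromℕ n)
  ... | inj₁ yt≤xn = yt≤xn
  ... | inj₂ xn≤yt with k , 0≤k , yt≈xn+k ← ≤⇒∃+ xn≤yt = begin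
    y * fromℕ t        ≈⟨ yt≈xn+k ⟩
    x * fromℕ n + k    ≤⟨ +-monoʳ-≤ _ k≤0 ⟩
    x * fromℕ n + 0#   ≈⟨ +-identityʳ _ ⟩
    x * fromℕ n        ∎
    where
    ȳ≤x̄ : ȳ ≤ x̄
    ȳ≤x̄ = +-cancelˡ-≤ y (begin
      y + ȳ   ≈⟨ y+ȳ≈1 ⟩
      1#      ≈⟨ x+x̄≈1 ⟨
      x + x̄   ≤⟨ +-monoˡ-≤ x̄ x≤y ⟩
      y + x̄   ∎)
    0<x̄ : 0# < x̄
    0<x̄ = <-≤-trans 0<ȳ ȳ≤x̄
    b : Carrier
    b = x̄ ⁻¹
    0<b : 0# < b
    0<b = 0<⁻¹ 0<x̄
    0≤b : 0# ≤ b
    0≤b = proj₁ 0<b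
    x̄b≈1 : x̄ * b ≈ 1#
    x̄b≈1 = x*x⁻¹≈1 0<x̄
    1≤b : 1# ≤ b
    1≤b = begin
      1#               ≈⟨ x̄b≈1 ⟨
      x̄ * b            ≤⟨ x≤y+x (*-nonNeg 0≤x 0≤b) ⟩
      x * b + x̄ * b    ≈⟨ distribʳ b x x̄ ⟨
      (x + x̄) * b      ≈⟨ *-congʳ x+x̄≈1 ⟩
      1# * b           ≈⟨ *-identityˡ b ⟩
      b                ∎
    u : ℕ
    u = n ℕ.∸ t
    n≡t+u : n ≡ t ℕ.+ u
    n≡t+u = ≡.sym (ℕₚ.m+[n∸m]≡n t≤n)
    n≈t+u : fromℕ n ≈ fromℕ t + fromℕ u
    n≈t+u = trans (reflexive (≡.cong fromℕ n≡t+u)) (×-homo-+ 1# t u)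
    w : Carrier
    w = 1# + k * b
    sum≤ : w + (fromℕ t * (ȳ * b) + fromℕ u * b) ≤ 1# + (fromℕ t + fromℕ u)
    sum≤ = ≤-reflexive (begin-equality
      1# + k * b + (t′ * (ȳ * b) + u′ * b)
        ≈⟨ solve 5 (λ k b t u y → con 1 :+ k :* b :+ (t :* (y :* b) :+ u :* b) := con 1 :+ b :* (k :+ t :* y :+ u)) refl k b t′ u′ ȳ ⟩
      1# + b * (k + t′ * ȳ + u′)
        ≈⟨ +-congˡ (*-congˡ balance) ⟩
      1# + b * (x̄ * fromℕ n)
        ≈⟨ solve 3 (λ b x n → con 1 :+ b :* (x :* n) := con 1 :+ x :* b :* n) refl b x̄ (fromℕ n) ⟩
      1# + x̄ * b * fromℕ n
        ≈⟨ +-congˡ (trans (*-congʳ x̄b≈1) (*-identityˡ _)) ⟩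
      1# + fromℕ n
        ≈⟨ +-congˡ n≈t+u ⟩
      1# + (t′ + u′) ∎)
      where
      t′ = fromℕ t
      u′ = fromℕ u
      balance : k + t′ * ȳ + u′ ≈ x̄ * fromℕ n
      balance = antisym (+-cancelˡ-≤ (x * fromℕ n) (≤-reflexive both)) (+-cancelˡ-≤ (x * fromℕ n) (≤-reflexive (sym both)))
        where
        both : x * fromℕ n + (k + t′ * ȳ + u′) ≈ x * fromℕ n + x̄ * fromℕ n
        both = begin-equality
          x * fromℕ n + (k + t′ * ȳ + u′)  ≈⟨ solve 5 (λ a k t y u → a :+ (k :+ t :* y :+ u) := (a :+ k) :+ t :* y :+ u) refl (x * fromℕ n) k t′ ȳ u′ ⟩
          x * fromℕ n + k + t′ * ȳ + u′    ≈⟨ +-congʳ (+-congʳ yt≈xn+k) ⟨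
          y * t′ + t′ * ȳ + u′             ≈⟨ solve 4 (λ y t ȳ u → y :* t :+ t :* ȳ :+ u := (y :+ ȳ) :* t :+ u) refl y t′ ȳ u′ ⟩
          (y + ȳ) * t′ + u′                ≈⟨ +-congʳ (trans (*-congʳ y+ȳ≈1) (*-identityˡ _)) ⟩
          t′ + u′                          ≈⟨ n≈t+u ⟨
          fromℕ n                          ≈⟨ *-identityˡ _ ⟨
          1# * fromℕ n                     ≈⟨ *-congʳ x+x̄≈1 ⟨
          (x + x̄) * fromℕ n                ≈⟨ distribʳ _ _ _ ⟩
          x * fromℕ n + x̄ * fromℕ n        ∎
    ȳb≤1 : ȳ * b ≤ 1#
    ȳb≤1 = ≤-trans (*-monoˡ-≤ 0≤b ȳ≤x̄) (≤-reflexive x̄b≈1)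
    1≤product : 1# ≤ (ȳ * b) ^ t * b ^ u
    1≤product = begin
      1#                       ≈⟨ x*y≈1⇒x^n*y^n≈1 n x̄b≈1 ⟨
      x̄ ^ n * b ^ n            ≤⟨ *-monoˡ-≤ (0≤^ 0≤b n) x̄ⁿ≤ȳᵗ ⟩
      ȳ ^ t * b ^ n            ≈⟨ *-congˡ (trans (^-congʳ b n≡t+u) (^-homo-* b t u)) ⟩
      ȳ ^ t * (b ^ t * b ^ u)  ≈⟨ *-assoc _ _ _ ⟨
      ȳ ^ t * b ^ t * b ^ u    ≈⟨ *-congʳ (*-distrib-^ ȳ b t) ⟨
      (ȳ * b) ^ t * b ^ u      ∎
    0≤w : 0# ≤ w
    0≤w = 0≤x+y 0≤1 (*-nonNeg 0≤k 0≤b)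
    1+kb≤1 : 1# + k * b ≤ 1#
    1+kb≤1 = begin
      w                            ≈⟨ *-identityʳ w ⟨
      w * 1#                       ≤⟨ *-monoʳ-≤ 0≤w 1≤product ⟩
      w * ((ȳ * b) ^ t * b ^ u)    ≤⟨ weighted (*-nonNeg (proj₁ 0<ȳ) 0≤b) ȳb≤1 1≤b t u w 0≤w sum≤ ⟩
      1#                           ∎
    k≤0 : k ≤ 0#
    k≤0 = *-cancelˡ-≤ 0<b (+-cancelˡ-≤ 1# (begin
      1# + b * k     ≈⟨ +-congˡ (*-comm b k) ⟩
      1# + k * b     ≤⟨ 1+kb≤1 ⟩
      1#             ≈⟨ +-identityʳ 1# ⟨
      1# + 0#        ≈⟨ +-congˡ (zeroʳ b) ⟨
      1# + b * 0#    ∎))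

-- Cardinalities and initial parts of subsets.

∣∪∣≡∣∣+∣─∣ : ∀ {n} (S L : Subset n) → ∣ S ∪ L ∣ ≡ ∣ S ∣ ℕ.+ ∣ L ─ S ∣
∣∪∣≡∣∣+∣─∣ []            []            = ≡.refl
∣∪∣≡∣∣+∣─∣ (outside ∷ S) (outside ∷ L) = ∣∪∣≡∣∣+∣─∣ S L
∣∪∣≡∣∣+∣─∣ (outside ∷ S) (inside  ∷ L) =
  ≡.trans (≡.cong suc (∣∪∣≡∣∣+∣─∣ S L)) (≡.sym (ℕₚ.+-suc ∣ S ∣ ∣ L ─ S ∣))
∣∪∣≡∣∣+∣─∣ (inside  ∷ S) (outside ∷ L) = ≡.cong suc (∣∪∣≡∣∣+∣─∣ S L)
∣∪∣≡∣∣+∣─∣ (inside  ∷ S) (inside  ∷ L) = ≡.cong suc (∣∪∣≡∣∣+∣─∣ S L)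

∣─∣+∣─∣ : ∀ {n} (E F S : Subset n) →
          ∣ E ─ S ∣ ℕ.+ ∣ F ─ S ∣ ≡ ∣ (E ∪ F) ─ S ∣ ℕ.+ ∣ (E ∩ F) ─ S ∣
∣─∣+∣─∣ [] [] [] = ≡.refl
∣─∣+∣─∣ (_ ∷ E) (_ ∷ F) (inside ∷ S) = ∣─∣+∣─∣ E F S
∣─∣+∣─∣ (outside ∷ E) (outside ∷ F) (outside ∷ S) = ∣─∣+∣─∣ E F S
∣─∣+∣─∣ (outside ∷ E) (inside  ∷ F) (outside ∷ S) =
  ≡.trans (ℕₚ.+-suc ∣ E ─ S ∣ ∣ F ─ S ∣) (≡.cong suc (∣─∣+∣─∣ E F S))
∣─∣+∣─∣ (inside  ∷ E) (outside ∷ F) (outside ∷ S) = ≡.cong suc (∣─∣+∣─∣ E F S)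
∣─∣+∣─∣ (inside  ∷ E) (inside  ∷ F) (outside ∷ S) = ≡.cong suc (begin
  ∣ E ─ S ∣ ℕ.+ suc ∣ F ─ S ∣              ≡⟨ ℕₚ.+-suc ∣ E ─ S ∣ ∣ F ─ S ∣ ⟩
  suc (∣ E ─ S ∣ ℕ.+ ∣ F ─ S ∣)            ≡⟨ ≡.cong suc (∣─∣+∣─∣ E F S) ⟩
  suc (∣ (E ∪ F) ─ S ∣ ℕ.+ ∣ (E ∩ F) ─ S ∣)  ≡⟨ ℕₚ.+-suc ∣ (E ∪ F) ─ S ∣ ∣ (E ∩ F) ─ S ∣ ⟨
  ∣ (E ∪ F) ─ S ∣ ℕ.+ suc ∣ (E ∩ F) ─ S ∣  ∎)
  where open ≡.≡-Reasoning

∪-monoʳ-⊆ : ∀ {n} (X : Subset n) {S S′ : Subset n} → S ⊆ S′ → X ∪ S ⊆ X ∪ S′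
∪-monoʳ-⊆ X {S} {S′} S⊆S′ x∈X∪S =
  [ Subsetₚ.p⊆p∪q S′ , Subsetₚ.q⊆p∪q X S′ ∘ S⊆S′ ]′ (Subsetₚ.x∈p∪q⁻ X S x∈X∪S)

∪-lub : ∀ {n} {S S′ U : Subset n} → S ⊆ U → S′ ⊆ U → S ∪ S′ ⊆ U
∪-lub {S = S} {S′} S⊆U S′⊆U x∈ = [ S⊆U , S′⊆U ]′ (Subsetₚ.x∈p∪q⁻ S S′ x∈)

∩-glb : ∀ {n} {S S′ U : Subset n} → U ⊆ S → U ⊆ S′ → U ⊆ S ∩ S′
∩-glb U⊆S U⊆S′ x∈ = Subsetₚ.x∈p∩q⁺ (U⊆S x∈ , U⊆S′ x∈)

-- The part of `E` that is already in place when `telescope` comes to add `v`.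
before : ∀ {n} → Fin n → Subset n → Subset n
before Fin.zero    (_ ∷ _) = outside ∷ ∅
before (Fin.suc v) (b ∷ E) = b ∷ before v E

before⊆ : ∀ {n} (v : Fin n) (E : Subset n) → before v E ⊆ E
before⊆ Fin.zero    (outside ∷ E) (Vec.there x∈) = Vec.there (⊥-elim (Subsetₚ.∉⊥ x∈))
before⊆ Fin.zero    (inside  ∷ E) (Vec.there x∈) = Vec.there (⊥-elim (Subsetₚ.∉⊥ x∈))
before⊆ (Fin.suc v) (_ ∷ E)       Vec.here       = Vec.here
before⊆ (Fin.suc v) (_ ∷ E)       (Vec.there x∈) = Vec.there (before⊆ v E x∈)

-- The vertex `v` is common to `E` and `F` but lies in neither initial part. This gain of one
-- element is what makes pairs of edges meeting only in `v` free of charge.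
before-∩-< : ∀ {n} {v : Fin n} {E F : Subset n} → v ∈ E → v ∈ F →
             ∣ before v E ∩ before v F ∣ ℕ.< ∣ E ∩ F ∣
before-∩-< {suc n} {E = _ ∷ E} {_ ∷ F} Vec.here Vec.here =
  s≤s (≡.subst (ℕ._≤ ∣ E ∩ F ∣) (≡.sym (≡.trans (≡.cong ∣_∣ (Subsetₚ.∩-idem (∅ {n}))) (Subsetₚ.∣⊥∣≡0 n))) z≤n)
before-∩-< {E = outside ∷ E} {_ ∷ F}       (Vec.there v∈E) (Vec.there v∈F) = before-∩-< v∈E v∈F
before-∩-< {E = inside  ∷ E} {outside ∷ F} (Vec.there v∈E) (Vec.there v∈F) = before-∩-< v∈E v∈F
before-∩-< {E = inside  ∷ E} {inside  ∷ F} (Vec.there v∈E) (Vec.there v∈F) = s≤s (before-∩-< v∈E v∈F)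

-- Finite sums, with filters turned into indicator functions.

module FiniteSums {c ℓ₁ ℓ₂} (ℝ : Reals c ℓ₁ ℓ₂) where
  open OrderedField ℝ
  open ≤-Reasoning
  open Solver using (solve; _:=_; _:+_; _:*_; con)

  module _ {a} {A : Set a} where

    ∑-cong : ∀ (xs : List A) {f g : A → Carrier} → (∀ x → f x ≈ g x) → ∑ xs f ≈ ∑ xs g
    ∑-cong []       f≈g = refl
    ∑-cong (x ∷ xs) f≈g = +-cong (f≈g x) (∑-cong xs f≈g)

    ∑-mono : ∀ (xs : List A) {f g : A → Carrier} → (∀ x → f x ≤ g x) → ∑ xs f ≤ ∑ xs g
    ∑-mono []       f≤g = ≤-refl
    ∑-mono (x ∷ xs) f≤g = +-mono-≤ (f≤g x) (∑-mono xs f≤g)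

    ∑-nonNeg : ∀ (xs : List A) {f : A → Carrier} → (∀ x → 0# ≤ f x) → 0# ≤ ∑ xs f
    ∑-nonNeg []       0≤f = ≤-refl
    ∑-nonNeg (x ∷ xs) 0≤f = 0≤x+y (0≤f x) (∑-nonNeg xs 0≤f)

    ∑-zero : ∀ (xs : List A) → ∑ xs (λ _ → 0#) ≈ 0#
    ∑-zero []       = refl
    ∑-zero (x ∷ xs) = trans (+-identityˡ _) (∑-zero xs)

    ∑-distrib-+ : ∀ (xs : List A) (f g : A → Carrier) → ∑ xs (λ x → f x + g x) ≈ ∑ xs f + ∑ xs g
    ∑-distrib-+ []       f g = sym (+-identityˡ 0#)
    ∑-distrib-+ (x ∷ xs) f g = trans (+-congˡ (∑-distrib-+ xs f g))
      (solve 4 (λ a b c d → a :+ b :+ (c :+ d) := (a :+ c) :+ (b :+ d)) refl (f x) (g x) (∑ xs f) (∑ xs g))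

    *-distribˡ-∑ : ∀ y (xs : List A) (f : A → Carrier) → y * ∑ xs f ≈ ∑ xs (λ x → y * f x)
    *-distribˡ-∑ y []       f = zeroʳ y
    *-distribˡ-∑ y (x ∷ xs) f = trans (distribˡ y _ _) (+-congˡ (*-distribˡ-∑ y xs f))

    *-distribʳ-∑ : ∀ y (xs : List A) (f : A → Carrier) → ∑ xs f * y ≈ ∑ xs (λ x → f x * y)
    *-distribʳ-∑ y []       f = zeroˡ y
    *-distribʳ-∑ y (x ∷ xs) f = trans (distribʳ y _ _) (+-congˡ (*-distribʳ-∑ y xs f))

    ∑-++ : ∀ (xs ys : List A) (f : A → Carrier) → ∑ (xs ++ ys) f ≈ ∑ xs f + ∑ ys f
    ∑-++ []       ys f = sym (+-identityˡ _)
    ∑-++ (x ∷ xs) ys f = trans (+-congˡ (∑-++ xs ys f)) (sym (+-assoc _ _ _))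

  module _ {a b} {A : Set a} {B : Set b} where

    ∑-map : ∀ (h : A → B) (xs : List A) (f : B → Carrier) → ∑ (map h xs) f ≈ ∑ xs (f ∘ h)
    ∑-map h []       f = refl
    ∑-map h (x ∷ xs) f = +-congˡ (∑-map h xs f)

    ∑-comm : ∀ (xs : List A) (ys : List B) (f : A → B → Carrier) →
             ∑ xs (λ x → ∑ ys (λ y → f x y)) ≈ ∑ ys (λ y → ∑ xs (λ x → f x y))
    ∑-comm []       ys f = sym (∑-zero ys)
    ∑-comm (x ∷ xs) ys f = trans (+-congˡ (∑-comm xs ys f)) (sym (∑-distrib-+ ys (f x) _))

    ∑*∑ : ∀ (xs : List A) (ys : List B) (f : A → Carrier) (g : B → Carrier) →
          ∑ xs f * ∑ ys g ≈ ∑ xs (λ x → ∑ ys (λ y → f x * g y))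
    ∑*∑ xs ys f g = trans (*-distribʳ-∑ _ xs f) (∑-cong xs λ x → *-distribˡ-∑ (f x) ys g)

  𝟙 : Bool → Carrier
  𝟙 true  = 1#
  𝟙 false = 0#

  0≤𝟙 : ∀ b → 0# ≤ 𝟙 b
  0≤𝟙 true  = 0≤1
  0≤𝟙 false = ≤-refl

  𝟙≤1 : ∀ b → 𝟙 b ≤ 1#
  𝟙≤1 true  = ≤-refl
  𝟙≤1 false = 0≤1

  𝟙-∧ : ∀ a b → 𝟙 (a ∧ b) ≈ 𝟙 a * 𝟙 b
  𝟙-∧ true  b = sym (*-identityˡ _)
  𝟙-∧ false b = sym (zeroˡ _)

  𝟙-idem : ∀ b → 𝟙 b * 𝟙 b ≈ 𝟙 b
  𝟙-idem true  = *-identityˡ 1#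
  𝟙-idem false = zeroˡ 0#

  𝟙-mono : ∀ {a b} → (T a → T b) → 𝟙 a ≤ 𝟙 b
  𝟙-mono {false} {b}     a⇒b = 0≤𝟙 b
  𝟙-mono {true}  {true}  a⇒b = ≤-refl
  𝟙-mono {true}  {false} a⇒b = ⊥-elim (a⇒b tt)

  𝟙-T : ∀ {b} → T b → 𝟙 b ≈ 1#
  𝟙-T {true} _ = refl

  0≤𝟙* : ∀ b {y} → (T b → 0# ≤ y) → 0# ≤ 𝟙 b * y
  0≤𝟙* true  0≤y = *-nonNeg 0≤1 (0≤y tt)
  0≤𝟙* false _   = ≤-reflexive (sym (zeroˡ _))

  𝟙*-support : ∀ b y → 𝟙 b * y ≈ 0# ⊎ T b
  𝟙*-support true  y = inj₂ tt
  𝟙*-support false y = inj₁ (zeroˡ y)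

  𝟙? : ∀ {ℓ} {P : Set ℓ} → Dec P → Carrier
  𝟙? P? = 𝟙 (does P?)

  𝟙?-true : ∀ {ℓ} {P : Set ℓ} (P? : Dec P) → P → 𝟙? P? ≈ 1#
  𝟙?-true P? p = reflexive (≡.cong 𝟙 (dec-true P? p))

  𝟙?-false : ∀ {ℓ} {P : Set ℓ} (P? : Dec P) → ¬ P → 𝟙? P? ≈ 0#
  𝟙?-false P? ¬p = reflexive (≡.cong 𝟙 (dec-false P? ¬p))

  𝟙?-cong : ∀ {ℓ ℓ′} {P : Set ℓ} {Q : Set ℓ′} (P? : Dec P) (Q? : Dec Q) →
            (P → Q) → (Q → P) → 𝟙? P? ≈ 𝟙? Q?
  𝟙?-cong P? (yes q) to from = 𝟙?-true P? (from q)
  𝟙?-cong P? (no ¬q) to from = 𝟙?-false P? (¬q ∘ to)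

  𝟙?-× : ∀ {ℓ ℓ′ ℓ″} {P : Set ℓ} {Q : Set ℓ′} {R : Set ℓ″} (P? : Dec P) (Q? : Dec Q) (R? : Dec R) →
         (R → P × Q) → (P → Q → R) → 𝟙? P? * 𝟙? Q? ≈ 𝟙? R?
  𝟙?-× (yes p) (yes q) R? to from = trans (*-identityˡ 1#) (sym (𝟙?-true R? (from p q)))
  𝟙?-× (yes p) (no ¬q) R? to from = trans (zeroʳ 1#) (sym (𝟙?-false R? (¬q ∘ proj₂ ∘ to)))
  𝟙?-× (no ¬p) Q?      R? to from = trans (zeroˡ _) (sym (𝟙?-false R? (¬p ∘ proj₁ ∘ to)))

  ∑-filter : ∀ {a ℓ} {A : Set a} {P : Pred A ℓ} (P? : Decidable P) (xs : List A) (f : A → Carrier) →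
             ∑ (filter P? xs) f ≈ ∑ xs (λ x → 𝟙? (P? x) * f x)
  ∑-filter P? []       f = refl
  ∑-filter P? (x ∷ xs) f with does (P? x)
  ... | true  = +-cong (sym (*-identityˡ _)) (∑-filter P? xs f)
  ... | false = trans (∑-filter P? xs f) (sym (trans (+-congʳ (zeroˡ _)) (+-identityˡ _)))

  ∑-allFin-suc : ∀ n (f : Fin (suc n) → Carrier) →
                 ∑ (allFin (suc n)) f ≈ f Fin.zero + ∑ (allFin n) (f ∘ Fin.suc)
  ∑-allFin-suc n f = +-congˡ (trans
    (reflexive (≡.cong (λ xs → ∑ xs f) (≡.sym (Listₚ.map-tabulate id Fin.suc))))
    (∑-map Fin.suc (allFin n) f))

  ∑-subsets-suc : ∀ n (f : Subset (suc n) → Carrier) →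
    ∑ (subsets (suc n)) f ≈ ∑ (subsets n) (f ∘ (outside ∷_)) + ∑ (subsets n) (f ∘ (inside ∷_))
  ∑-subsets-suc n f = trans (∑-++ (map (outside ∷_) (subsets n)) _ f)
    (+-cong (∑-map (outside ∷_) (subsets n) f) (∑-map (inside ∷_) (subsets n) f))

  term≤∑ : ∀ {n} {f : Subset n → Carrier} → (∀ L → 0# ≤ f L) → ∀ L → f L ≤ ∑ (subsets n) f
  term≤∑ 0≤f []                     = x≤x+y ≤-refl
  term≤∑ {suc n} {f} 0≤f (outside ∷ L) = begin
    f (outside ∷ L)                                                    ≤⟨ term≤∑ (0≤f ∘ (outside ∷_)) L ⟩
    ∑ (subsets n) (f ∘ (outside ∷_))                                   ≤⟨ x≤x+y (∑-nonNeg (subsets n) (0≤f ∘ (inside ∷_))) ⟩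
    ∑ (subsets n) (f ∘ (outside ∷_)) + ∑ (subsets n) (f ∘ (inside ∷_)) ≈⟨ ∑-subsets-suc n f ⟨
    ∑ (subsets (suc n)) f                                              ∎
  term≤∑ {suc n} {f} 0≤f (inside ∷ L) = begin
    f (inside ∷ L)                                                     ≤⟨ term≤∑ (0≤f ∘ (inside ∷_)) L ⟩
    ∑ (subsets n) (f ∘ (inside ∷_))                                    ≤⟨ x≤y+x (∑-nonNeg (subsets n) (0≤f ∘ (outside ∷_))) ⟩
    ∑ (subsets n) (f ∘ (outside ∷_)) + ∑ (subsets n) (f ∘ (inside ∷_)) ≈⟨ ∑-subsets-suc n f ⟨
    ∑ (subsets (suc n)) f                                              ∎

  -- The binomial theorem, sorted by subsets: each element of `K` contributes 1 if left out and `u`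
  -- if taken.
  ∑-⊆-^ : ∀ {n} u (K : Subset n) → ∑ (subsets n) (λ L → 𝟙? (L ⊆? K) * u ^ ∣ L ∣) ≈ (1# + u) ^ ∣ K ∣
  ∑-⊆-^ u [] = trans (+-identityʳ _) (*-identityˡ 1#)
  ∑-⊆-^ {suc n} u (outside ∷ K) = begin-equality
    ∑ (subsets (suc n)) (λ L → 𝟙? (L ⊆? outside ∷ K) * u ^ ∣ L ∣)
      ≈⟨ ∑-subsets-suc n _ ⟩
    ∑ (subsets n) (λ L → 𝟙? (L ⊆? K) * u ^ ∣ L ∣) + ∑ (subsets n) (λ L → 0# * (u * u ^ ∣ L ∣))
      ≈⟨ +-cong (∑-⊆-^ u K) (trans (∑-cong (subsets n) λ L → zeroˡ _) (∑-zero (subsets n))) ⟩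
    (1# + u) ^ ∣ K ∣ + 0#
      ≈⟨ +-identityʳ _ ⟩
    (1# + u) ^ ∣ K ∣ ∎
  ∑-⊆-^ {suc n} u (inside ∷ K) = begin-equality
    ∑ (subsets (suc n)) (λ L → 𝟙? (L ⊆? inside ∷ K) * u ^ ∣ L ∣)
      ≈⟨ ∑-subsets-suc n _ ⟩
    Z + ∑ (subsets n) (λ L → 𝟙? (L ⊆? K) * (u * u ^ ∣ L ∣))
      ≈⟨ +-congˡ (∑-cong (subsets n) λ L → solve 3 (λ a u b → a :* (u :* b) := u :* (a :* b)) refl (𝟙? (L ⊆? K)) u (u ^ ∣ L ∣)) ⟩
    Z + ∑ (subsets n) (λ L → u * (𝟙? (L ⊆? K) * u ^ ∣ L ∣))
      ≈⟨ +-congˡ (*-distribˡ-∑ u (subsets n) _) ⟨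
    Z + u * Z
      ≈⟨ solve 2 (λ z u → z :+ u :* z := (con 1 :+ u) :* z) refl Z u ⟩
    (1# + u) * Z
      ≈⟨ *-congˡ (∑-⊆-^ u K) ⟩
    (1# + u) * (1# + u) ^ ∣ K ∣ ∎
    where
    Z : Carrier
    Z = ∑ (subsets n) (λ L → 𝟙? (L ⊆? K) * u ^ ∣ L ∣)

  ∑-∈ : ∀ {n} (K : Subset n) → ∑ (allFin n) (λ v → 𝟙? (v Subsetₚ.∈? K)) ≈ fromℕ ∣ K ∣
  ∑-∈ [] = refl
  ∑-∈ {suc n} (outside ∷ K) = trans (∑-allFin-suc n _) (trans (+-identityˡ _) (∑-∈ K))
  ∑-∈ {suc n} (inside ∷ K) = trans (∑-allFin-suc n _) (+-congˡ (∑-∈ K))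

  -- β bounds the loss of ψ when v is added; the elements of E are added in increasing order.
  telescope : ∀ {n} (ψ : Subset n → Carrier) (β : Fin n → Subset n → Carrier) →
              (∀ v L → ψ L ≤ ψ (L ∪ ⁅ v ⁆) + β v L) → ∀ E →
              ψ ∅ ≤ ψ E + ∑ (allFin n) (λ v → 𝟙? (v Subsetₚ.∈? E) * β v (before v E))
  telescope ψ β step [] = x≤x+y ≤-refl
  telescope {suc n} ψ β step (b ∷ E) = begin
    ψ ∅                                       ≤⟨ head b ⟩
    ψ (b ∷ ∅) + h                             ≤⟨ +-monoˡ-≤ h (telescope (ψ ∘ (b ∷_)) (λ v → β (Fin.suc v) ∘ (b ∷_)) step′ E) ⟩
    ψ (b ∷ E) + t + h                         ≈⟨ trans (+-assoc _ _ _) (+-congˡ (+-comm t h)) ⟩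
    ψ (b ∷ E) + (h + t)                       ≈⟨ +-congˡ (∑-allFin-suc n _) ⟨
    ψ (b ∷ E) + ∑ (allFin (suc n)) (λ v → 𝟙? (v Subsetₚ.∈? b ∷ E) * β v (before v (b ∷ E))) ∎
    where
    h t : Carrier
    h  = 𝟙? (Fin.zero Subsetₚ.∈? b ∷ E) * β Fin.zero ∅
    t  = ∑ (allFin n) (λ v → 𝟙? (v Subsetₚ.∈? E) * β (Fin.suc v) (b ∷ before v E))
    step′ : ∀ v L → ψ (b ∷ L) ≤ ψ (b ∷ (L ∪ ⁅ v ⁆)) + β (Fin.suc v) (b ∷ L)
    step′ v L = ≡.subst (λ x → ψ (b ∷ L) ≤ ψ (x ∷ (L ∪ ⁅ v ⁆)) + β (Fin.suc v) (b ∷ L)) (Boolₚ.∨-identityʳ b) (step (Fin.suc v) (b ∷ L))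
    head : ∀ b → ψ ∅ ≤ ψ (b ∷ ∅) + 𝟙? (Fin.zero Subsetₚ.∈? b ∷ E) * β Fin.zero ∅
    head outside = ≤-reflexive (sym (trans (+-congˡ (zeroˡ _)) (+-identityʳ _)))
    head inside  = ≤-trans (step Fin.zero ∅) (+-mono-≤
      (≤-reflexive (reflexive (≡.cong (λ X → ψ (inside ∷ X)) (Subsetₚ.∪-idem ∅))))
      (≤-reflexive (sym (*-identityˡ _))))

-- Expectations over the random subset of Fin n that contains each vertex
-- independently with probability p.
module Expectation {c ℓ₁ ℓ₂} (ℝ : Reals c ℓ₁ ℓ₂) (P : OrderedField.Probability ℝ) where
  open OrderedField ℝ
  open FiniteSums ℝ
  open Probability P renaming (value to p; complement to p̄; sum≈1 to p+p̄≈1; 0≤value to 0≤p; 0≤complement to 0≤p̄)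
  open ≤-Reasoning
  open Solver using (solve; _:=_; _:+_; _:*_; con)

  -- Integrating out one coordinate at a time builds the independence of the vertices into the
  -- definition.
  𝔼 : ∀ {n} → (Subset n → Carrier) → Carrier
  𝔼 {zero}  f = f []
  𝔼 {suc n} f = p̄ * 𝔼 (f ∘ (outside ∷_)) + p * 𝔼 (f ∘ (inside ∷_))

  𝔼-cong : ∀ {n} {f g : Subset n → Carrier} → (∀ X → f X ≈ g X) → 𝔼 f ≈ 𝔼 g
  𝔼-cong {zero}  f≈g = f≈g []
  𝔼-cong {suc n} f≈g = +-cong (*-congˡ (𝔼-cong (f≈g ∘ (outside ∷_)))) (*-congˡ (𝔼-cong (f≈g ∘ (inside ∷_))))

  𝔼-mono : ∀ {n} {f g : Subset n → Carrier} → (∀ X → f X ≤ g X) → 𝔼 f ≤ 𝔼 g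
  𝔼-mono {zero}  f≤g = f≤g []
  𝔼-mono {suc n} f≤g = +-mono-≤ (*-monoʳ-≤ 0≤p̄ (𝔼-mono (f≤g ∘ (outside ∷_)))) (*-monoʳ-≤ 0≤p (𝔼-mono (f≤g ∘ (inside ∷_))))

  average-idem : ∀ x → p̄ * x + p * x ≈ x
  average-idem x = begin-equality
    p̄ * x + p * x  ≈⟨ solve 3 (λ p̄ p x → p̄ :* x :+ p :* x := (p :+ p̄) :* x) refl p̄ p x ⟩
    (p + p̄) * x    ≈⟨ *-congʳ p+p̄≈1 ⟩
    1# * x         ≈⟨ *-identityˡ x ⟩
    x              ∎

  𝔼-const : ∀ {n} x → 𝔼 {n} (λ _ → x) ≈ x
  𝔼-const {zero}  x = refl
  𝔼-const {suc n} x = trans (+-cong (*-congˡ (𝔼-const {n} x)) (*-congˡ (𝔼-const {n} x))) (average-idem x)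

  𝔼-nonNeg : ∀ {n} {f : Subset n → Carrier} → (∀ X → 0# ≤ f X) → 0# ≤ 𝔼 f
  𝔼-nonNeg {n} 0≤f = ≤-trans (≤-reflexive (sym (𝔼-const {n} 0#))) (𝔼-mono 0≤f)

  𝔼-distrib-+ : ∀ {n} (f g : Subset n → Carrier) → 𝔼 (λ X → f X + g X) ≈ 𝔼 f + 𝔼 g
  𝔼-distrib-+ {zero}  f g = refl
  𝔼-distrib-+ {suc n} f g = trans
    (+-cong (*-congˡ (𝔼-distrib-+ (f ∘ (outside ∷_)) (g ∘ (outside ∷_)))) (*-congˡ (𝔼-distrib-+ (f ∘ (inside ∷_)) (g ∘ (inside ∷_)))))
    (solve 6 (λ p̄ p a b c d → p̄ :* (a :+ b) :+ p :* (c :+ d) := (p̄ :* a :+ p :* c) :+ (p̄ :* b :+ p :* d)) refl p̄ p _ _ _ _)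

  𝔼-distribˡ-* : ∀ {n} y (f : Subset n → Carrier) → 𝔼 (λ X → y * f X) ≈ y * 𝔼 f
  𝔼-distribˡ-* {zero}  y f = refl
  𝔼-distribˡ-* {suc n} y f = trans
    (+-cong (*-congˡ (𝔼-distribˡ-* y (f ∘ (outside ∷_)))) (*-congˡ (𝔼-distribˡ-* y (f ∘ (inside ∷_)))))
    (solve 5 (λ p̄ p y a b → p̄ :* (y :* a) :+ p :* (y :* b) := y :* (p̄ :* a :+ p :* b)) refl p̄ p y _ _)

  𝔼-∑ : ∀ {n a} {A : Set a} (xs : List A) (f : A → Subset n → Carrier) →
        𝔼 (λ X → ∑ xs (λ x → f x X)) ≈ ∑ xs (λ x → 𝔼 (f x))
  𝔼-∑ {n} []   f = 𝔼-const {n} 0#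
  𝔼-∑ (x ∷ xs) f = trans (𝔼-distrib-+ (f x) _) (+-congˡ (𝔼-∑ xs f))

  p̄^n*f∅≤𝔼f : ∀ {n} {f : Subset n → Carrier} → (∀ X → 0# ≤ f X) → p̄ ^ n * f ∅ ≤ 𝔼 f
  p̄^n*f∅≤𝔼f {zero}  0≤f = ≤-reflexive (*-identityˡ _)
  p̄^n*f∅≤𝔼f {suc n} {f} 0≤f = begin
    p̄ * p̄ ^ n * f ∅          ≈⟨ *-assoc _ _ _ ⟩
    p̄ * (p̄ ^ n * f ∅)        ≤⟨ *-monoʳ-≤ 0≤p̄ (p̄^n*f∅≤𝔼f (0≤f ∘ (outside ∷_))) ⟩
    p̄ * 𝔼 (f ∘ (outside ∷_)) ≤⟨ x≤x+y (*-nonNeg 0≤p (𝔼-nonNeg (0≤f ∘ (inside ∷_)))) ⟩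
    𝔼 f                      ∎

  -- The vertices of `F ─ S` must all be drawn, each with probability `p`. By independence the other
  -- coordinates keep their law, and since `F` is then adjoined by hand, its own coordinates may be
  -- redrawn freely.
  𝔼-⊆ : ∀ {n} (S F : Subset n) (g : Subset n → Carrier) →
        𝔼 (λ X → 𝟙? (F ⊆? X ∪ S) * g (X ∪ S)) ≈ p ^ ∣ F ─ S ∣ * 𝔼 (λ X → g (X ∪ (S ∪ F)))
  𝔼-⊆ [] [] g = refl
  𝔼-⊆ (outside ∷ S) (outside ∷ F) g = trans
    (+-cong (*-congˡ (𝔼-⊆ S F (g ∘ (outside ∷_)))) (*-congˡ (𝔼-⊆ S F (g ∘ (inside ∷_)))))
    (solve 5 (λ p̄ p y a b → p̄ :* (y :* a) :+ p :* (y :* b) := y :* (p̄ :* a :+ p :* b)) refl p̄ p _ _ _)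
  𝔼-⊆ {suc n} (outside ∷ S) (inside ∷ F) g = begin-equality
    p̄ * 𝔼 (λ X → 0# * g (outside ∷ X ∪ S)) + p * 𝔼 (λ X → 𝟙? (F ⊆? X ∪ S) * g (inside ∷ X ∪ S))
      ≈⟨ +-cong (*-congˡ (trans (𝔼-cong {n} λ X → zeroˡ _) (𝔼-const {n} 0#))) (*-congˡ (𝔼-⊆ S F (g ∘ (inside ∷_)))) ⟩
    p̄ * 0# + p * (p ^ ∣ F ─ S ∣ * A)
      ≈⟨ solve 4 (λ p̄ p y a → p̄ :* con 0 :+ p :* (y :* a) := p :* y :* a) refl p̄ p (p ^ ∣ F ─ S ∣) A ⟩
    p * p ^ ∣ F ─ S ∣ * A
      ≈⟨ *-congˡ (average-idem A) ⟨
    p * p ^ ∣ F ─ S ∣ * (p̄ * A + p * A) ∎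
    where
    A : Carrier
    A = 𝔼 (λ X → g (inside ∷ (X ∪ (S ∪ F))))
  𝔼-⊆ {suc n} (inside ∷ S) (f ∷ F) g = begin-equality
    p̄ * 𝔼 (λ X → 𝟙? (f ∷ F ⊆? inside ∷ (X ∪ S)) * g (inside ∷ X ∪ S)) + p * 𝔼 (λ X → 𝟙? (f ∷ F ⊆? inside ∷ (X ∪ S)) * g (inside ∷ X ∪ S))
      ≈⟨ +-cong (*-congˡ (𝔼-cong λ X → *-congʳ (drop X))) (*-congˡ (𝔼-cong λ X → *-congʳ (drop X))) ⟩
    p̄ * 𝔼 (λ X → 𝟙? (F ⊆? X ∪ S) * g (inside ∷ X ∪ S)) + p * 𝔼 (λ X → 𝟙? (F ⊆? X ∪ S) * g (inside ∷ X ∪ S))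
      ≈⟨ +-cong (*-congˡ (𝔼-⊆ S F (g ∘ (inside ∷_)))) (*-congˡ (𝔼-⊆ S F (g ∘ (inside ∷_)))) ⟩
    p̄ * (p ^ ∣ F ─ S ∣ * A) + p * (p ^ ∣ F ─ S ∣ * A)
      ≈⟨ solve 4 (λ p̄ p y a → p̄ :* (y :* a) :+ p :* (y :* a) := y :* (p̄ :* a :+ p :* a)) refl p̄ p (p ^ ∣ F ─ S ∣) A ⟩
    p ^ ∣ F ─ S ∣ * (p̄ * A + p * A) ∎
    where
    A : Carrier
    A = 𝔼 (λ X → g (inside ∷ (X ∪ (S ∪ F))))
    drop : ∀ X → 𝟙? (f ∷ F ⊆? inside ∷ (X ∪ S)) ≈ 𝟙? (F ⊆? X ∪ S)
    drop X = 𝟙?-cong (f ∷ F ⊆? inside ∷ (X ∪ S)) (F ⊆? X ∪ S) Subsetₚ.drop-∷-⊆ λ { F⊆ Vec.here → Vec.here ; F⊆ (Vec.there x∈) → Vec.there (F⊆ x∈) }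

-- Decreasing events and expectations conditioned on them.

Event : ℕ → Set
Event n = Subset n → Bool

Decreasing : ∀ {n} → Event n → Set
Decreasing B = ∀ {X Y} → X ⊆ Y → T (B Y) → T (B X)

avoid : ∀ {n} → Subset n → Event n → Event n
avoid L B X = B X ∧ not (does (L ⊆? X))

module _ {n} {L : Subset n} {B : Event n} where

  avoid⇒ : ∀ {X} → T (avoid L B X) → T (B X)
  avoid⇒ = proj₁ ∘ Boolₚ.T-∧ .Equivalence.to

  avoid⇒⊈ : ∀ {X} → T (avoid L B X) → ¬ (L ⊆ X)
  avoid⇒⊈ {X} h L⊆X with B X | does (L ⊆? X) | dec-true (L ⊆? X) L⊆X
  avoid⇒⊈ {X} () L⊆X | true  | true | _
  avoid⇒⊈ {X} () L⊆X | false | true | _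

  avoid⁺ : ∀ {X} → T (B X) → ¬ (L ⊆ X) → T (avoid L B X)
  avoid⁺ {X} h L⊈X rewrite dec-false (L ⊆? X) L⊈X = Boolₚ.T-∧ .Equivalence.from (h , tt)

  avoid-decreasing : Decreasing B → Decreasing (avoid L B)
  avoid-decreasing dec X⊆Y h =
    avoid⁺ (dec X⊆Y (avoid⇒ h)) λ L⊆X → avoid⇒⊈ h (X⊆Y ∘ L⊆X)

module Survival {c ℓ₁ ℓ₂} (ℝ : Reals c ℓ₁ ℓ₂) (P : OrderedField.Probability ℝ) where
  open OrderedField ℝ
  open FiniteSums ℝ
  open Expectation ℝ P
  open Probability P renaming (value to p; complement to p̄; sum≈1 to p+p̄≈1; 0≤value to 0≤p; 0≤complement to 0≤p̄)
  open ≤-Reasoning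
  open Solver using (solve; _:=_; _:+_; _:*_; con)

  module _ {n : ℕ} where

    Φ : Event n → Subset n → Carrier
    Φ B S = 𝔼 (λ X → 𝟙 (B (X ∪ S)))

    0≤Φ : ∀ B S → 0# ≤ Φ B S
    0≤Φ B S = 𝔼-nonNeg λ X → 0≤𝟙 (B (X ∪ S))

    Φ≤1 : ∀ B S → Φ B S ≤ 1#
    Φ≤1 B S = ≤-trans (𝔼-mono λ X → 𝟙≤1 (B (X ∪ S))) (≤-reflexive (𝔼-const {n} 1#))

    Φ-antimono : ∀ {B} → Decreasing B → ∀ {S S′} → S ⊆ S′ → Φ B S′ ≤ Φ B S
    Φ-antimono dec S⊆S′ = 𝔼-mono λ X → 𝟙-mono (dec (∪-monoʳ-⊆ X S⊆S′))

    Φ-mono : ∀ {B B′} → (∀ {X} → T (B X) → T (B′ X)) → ∀ S → Φ B S ≤ Φ B′ S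
    Φ-mono B⇒B′ S = 𝔼-mono {n} λ X → 𝟙-mono (B⇒B′ {X ∪ S})

    -- The empty draw alone has probability `p̄ ^ n`, and it leaves just `S`.
    p̄^n≤Φ : ∀ {B} → Decreasing B → ∀ {S} → T (B S) → p̄ ^ n ≤ Φ B S
    p̄^n≤Φ {B} dec {S} BS = begin
      p̄ ^ n                   ≈⟨ *-identityʳ _ ⟨
      p̄ ^ n * 1#              ≤⟨ *-monoʳ-≤ (0≤^ 0≤p̄ n) (𝟙-mono {true} λ _ → dec (∪-lub (⊥-elim ∘ Subsetₚ.∉⊥) id) BS) ⟩
      p̄ ^ n * 𝟙 (B (∅ ∪ S))   ≤⟨ p̄^n*f∅≤𝔼f (λ X → 0≤𝟙 (B (X ∪ S))) ⟩
      Φ B S                   ∎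

  module _ {n : ℕ} (B : Event n) (S : Subset n) where

    private
      weigh : (Subset n → Carrier) → Subset n → Carrier
      weigh h X = 𝟙 (B (X ∪ S)) * h (X ∪ S)

    abstract

      -- The expectation of h given B, without the normalising factor (Φ B S)⁻¹.
      𝕄 : (Subset n → Carrier) → Carrier
      𝕄 h = 𝔼 (weigh h)

      𝕄-cong : ∀ {f g} → (∀ Y → f Y ≈ g Y) → 𝕄 f ≈ 𝕄 g
      𝕄-cong {f} {g} f≈g = 𝔼-cong {n} {weigh f} {weigh g} λ X → *-congˡ (f≈g (X ∪ S))

      𝕄-mono : ∀ {f g} → (∀ Y → T (B Y) → f Y ≤ g Y) → 𝕄 f ≤ 𝕄 g
      𝕄-mono {f} {g} f≤g = 𝔼-mono {n} {weigh f} {weigh g} λ X → pointwise (X ∪ S)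
        where
        pointwise : ∀ Y → 𝟙 (B Y) * f Y ≤ 𝟙 (B Y) * g Y
        pointwise Y with B Y | f≤g Y
        ... | true  | fY≤gY = *-monoʳ-≤ 0≤1 (fY≤gY tt)
        ... | false | _     = ≤-reflexive (trans (zeroˡ _) (sym (zeroˡ _)))

      𝕄-1 : 𝕄 (λ _ → 1#) ≈ Φ B S
      𝕄-1 = 𝔼-cong {n} {weigh (λ _ → 1#)} λ X → *-identityʳ (𝟙 (B (X ∪ S)))

      𝕄-distrib-+ : ∀ f g → 𝕄 (λ Y → f Y + g Y) ≈ 𝕄 f + 𝕄 g
      𝕄-distrib-+ f g = trans (𝔼-cong {n} λ X → distribˡ (𝟙 (B (X ∪ S))) (f (X ∪ S)) (g (X ∪ S)))
        (𝔼-distrib-+ (weigh f) (weigh g))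

      𝕄-distribˡ-* : ∀ y f → 𝕄 (λ Y → y * f Y) ≈ y * 𝕄 f
      𝕄-distribˡ-* y f = trans
        (𝔼-cong {n} λ X → solve 3 (λ b y f → b :* (y :* f) := y :* (b :* f)) refl (𝟙 (B (X ∪ S))) y (f (X ∪ S)))
        (𝔼-distribˡ-* y (weigh f))

      𝕄-∑ : ∀ {a} {A : Set a} (xs : List A) (f : A → Subset n → Carrier) →
            𝕄 (λ Y → ∑ xs (λ x → f x Y)) ≈ ∑ xs (λ x → 𝕄 (f x))
      𝕄-∑ xs f = trans (𝔼-cong {n} λ X → *-distribˡ-∑ (𝟙 (B (X ∪ S))) xs (λ x → f x (X ∪ S)))
        (𝔼-∑ xs (λ x → weigh (f x)))

      𝕄-⊆ : ∀ F (h : Subset n → Carrier) → 𝕄 (λ Y → 𝟙? (F ⊆? Y) * h Y) ≈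
                    p ^ ∣ F ─ S ∣ * 𝔼 (λ X → 𝟙 (B (X ∪ (S ∪ F))) * h (X ∪ (S ∪ F)))
      𝕄-⊆ F h = trans
        (𝔼-cong {n} λ X → solve 3 (λ b i h → b :* (i :* h) := i :* (b :* h)) refl (𝟙 (B (X ∪ S))) (𝟙? (F ⊆? X ∪ S)) (h (X ∪ S)))
        (𝔼-⊆ S F (λ Y → 𝟙 (B Y) * h Y))

      -- For a decreasing `B`, survival of `(X ∪ S) ∪ F` already entails survival of `X ∪ S`, so
      -- imposing the latter as a condition loses nothing.
      Φ≤𝕄 : Decreasing B → ∀ F → Φ B (S ∪ F) ≤ 𝕄 (λ Y → 𝟙 (B (Y ∪ F)))
      Φ≤𝕄 dec F = 𝔼-mono {n} λ X → begin
        𝟙 (B (X ∪ (S ∪ F)))                   ≡⟨ ≡.cong (𝟙 ∘ B) (Subsetₚ.∪-assoc X S F) ⟨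
        𝟙 (B ((X ∪ S) ∪ F))                   ≈⟨ 𝟙-idem (B ((X ∪ S) ∪ F)) ⟨
        𝟙 (B ((X ∪ S) ∪ F)) * 𝟙 (B ((X ∪ S) ∪ F)) ≤⟨ *-monoˡ-≤ (0≤𝟙 (B ((X ∪ S) ∪ F))) (𝟙-mono (dec (Subsetₚ.p⊆p∪q F))) ⟩
        𝟙 (B (X ∪ S)) * 𝟙 (B ((X ∪ S) ∪ F))   ∎

    𝕄-const : ∀ y → 𝕄 (λ _ → y) ≈ y * Φ B S
    𝕄-const y = trans (𝕄-cong λ _ → sym (*-identityʳ y)) (trans (𝕄-distribˡ-* y _) (*-congˡ 𝕄-1))

    𝕄-𝟙⊆ : ∀ F → 𝕄 (λ Y → 𝟙? (F ⊆? Y)) ≈ p ^ ∣ F ─ S ∣ * Φ B (S ∪ F)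
    𝕄-𝟙⊆ F = begin-equality
      𝕄 (λ Y → 𝟙? (F ⊆? Y))        ≈⟨ 𝕄-cong (λ Y → *-identityʳ _) ⟨
      𝕄 (λ Y → 𝟙? (F ⊆? Y) * 1#)   ≈⟨ 𝕄-⊆ F (λ _ → 1#) ⟩
      p ^ ∣ F ─ S ∣ * 𝔼 (λ X → 𝟙 (B (X ∪ (S ∪ F))) * 1#) ≈⟨ *-congˡ (𝔼-cong λ X → *-identityʳ (𝟙 (B (X ∪ (S ∪ F))))) ⟩
      p ^ ∣ F ─ S ∣ * Φ B (S ∪ F)  ∎

    -- An inequality of Harris type: conditioning on a decreasing event does not make it more likely
    -- that `F` is contained. It follows from the exact formula because `Φ` can only drop when `S`
    -- grows. Both second moment bounds rest on it.
    𝕄-𝟙⊆-≤ : Decreasing B → ∀ F → 𝕄 (λ Y → 𝟙? (F ⊆? Y)) ≤ p ^ ∣ F ─ S ∣ * Φ B S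
    𝕄-𝟙⊆-≤ dec F = ≤-trans (≤-reflexive (𝕄-𝟙⊆ F))
      (*-monoʳ-≤ (0≤^ 0≤p ∣ F ─ S ∣) (Φ-antimono dec (Subsetₚ.p⊆p∪q F)))

-- The query algorithm, its invariants and the replay of a run.

module Algorithm {c ℓ₁ ℓ₂} (ℝ : Reals c ℓ₁ ℓ₂) (P Δ : OrderedField.Probability ℝ) where
  open OrderedField ℝ
  open FiniteSums ℝ
  open Survival ℝ P
  open Probability P renaming (value to p; complement to p̄; sum≈1 to p+p̄≈1; 0≤value to 0≤p; 0≤complement to 0≤p̄)
  open Probability Δ renaming (value to δ; complement to δ̄; sum≈1 to δ+δ̄≈1; 0≤value to 0≤δ; 0≤complement to 0≤δ̄)
  open ≤-Reasoning

  δ̄≤1 : δ̄ ≤ 1#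
  δ̄≤1 = ≤-trans (x≤y+x 0≤δ) (≤-reflexive δ+δ̄≈1)

  module _ {n : ℕ} where

    -- Both are non-strict, so `total` chooses between them without deciding equality; a set on the
    -- boundary is light and heavy at once.
    Light Heavy : Event n → Subset n → Subset n → Set ℓ₂
    Light B S L = Φ B (S ∪ L) ≤ δ̄ ^ ∣ L ─ S ∣ * Φ B S
    Heavy B S L = δ̄ ^ ∣ L ─ S ∣ * Φ B S ≤ Φ B (S ∪ L)

    ⊆⇒Heavy : ∀ {B} → Decreasing B → ∀ {S L} → L ⊆ S → Heavy B S L
    ⊆⇒Heavy {B} dec {S} {L} L⊆S = begin
      δ̄ ^ ∣ L ─ S ∣ * Φ B S   ≤⟨ *-monoˡ-≤ (0≤Φ B S) (^≤1 0≤δ̄ δ̄≤1 ∣ L ─ S ∣) ⟩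
      1# * Φ B S              ≈⟨ *-identityˡ _ ⟩
      Φ B S                   ≤⟨ Φ-antimono dec (∪-lub id L⊆S) ⟩
      Φ B (S ∪ L)             ∎

    record LightIn (B : Event n) (S : Subset n) (xs : List (Subset n)) : Set ℓ₂ where
      field
        set    : Subset n
        others : List (Subset n)
        light  : Light B S set
        size   : suc (length others) ≡ length xs
        split  : ∀ {K} → K ∈ₗ xs → K ≡ set ⊎ K ∈ₗ others

    -- All open queries are scanned in every round, since a set that is heavy now need not remain
    -- heavy once `S` or `B` has changed.
    search : ∀ B S xs → All (Heavy B S) xs ⊎ LightIn B S xs
    search B S [] = inj₁ []
    search B S (L ∷ xs) with total (δ̄ ^ ∣ L ─ S ∣ * Φ B S) (Φ B (S ∪ L))
    ... | inj₂ light = inj₂ record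
      { set = L ; others = xs ; light = light ; size = ≡.refl
      ; split = λ { (here K≡L) → inj₁ K≡L ; (there K∈xs) → inj₂ K∈xs } }
    ... | inj₁ heavy with search B S xs
    ...   | inj₁ heavies = inj₁ (heavy ∷ heavies)
    ...   | inj₂ found   = inj₂ record
      { set = set ; others = L ∷ others ; light = light ; size = ≡.cong suc size
      ; split = λ { (here K≡L) → inj₂ (here K≡L)
                  ; (there K∈xs) → [ inj₁ , inj₂ ∘ there ]′ (split K∈xs) } }
      where open LightIn found

    State : Set
    State = Subset n × Event n

    -- The first argument is fuel; length xs always suffices.
    run : ℕ → List (Subset n) → State → Subset n → State
    run zero    xs st      I = st
    run (suc k) xs (S , B) I with search B S xs
    ... | inj₁ _     = S , B
    ... | inj₂ found with LightIn.set found ⊆? I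
    ...   | yes _ = run k (LightIn.others found) (S ∪ LightIn.set found , B) I
    ...   | no  _ = run k (LightIn.others found) (S , avoid (LightIn.set found) B) I

    run-⊇ : ∀ k xs S B I → S ⊆ proj₁ (run k xs (S , B) I)
    run-⊇ zero    xs S B I = id
    run-⊇ (suc k) xs S B I with search B S xs
    ... | inj₁ _     = id
    ... | inj₂ found with LightIn.set found ⊆? I
    ...   | yes _ = run-⊇ k _ _ B I ∘ Subsetₚ.p⊆p∪q _
    ...   | no  _ = run-⊇ k _ S _ I

    -- A set answered "yes" enters the fingerprint and so lies in `F`; a set answered "no" is not
    -- contained in `I`, hence not in the smaller `F`. Thus `F` answers every query as `I` does.
    run-replay : ∀ k xs S B {I F} → proj₁ (run k xs (S , B) I) ⊆ F → F ⊆ I →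
                 run k xs (S , B) F ≡ run k xs (S , B) I
    run-replay zero    xs S B out⊆F F⊆I = ≡.refl
    run-replay (suc k) xs S B {I} {F} out⊆F F⊆I with search B S xs
    ... | inj₁ _     = ≡.refl
    ... | inj₂ found with LightIn.set found ⊆? I | LightIn.set found ⊆? F
    ...   | yes _   | yes _   = run-replay k _ _ B out⊆F F⊆I
    ...   | no  _   | no  _   = run-replay k _ S _ out⊆F F⊆I
    ...   | no  L⊈I | yes L⊆F = ⊥-elim (L⊈I (F⊆I ∘ L⊆F))
    ...   | yes _   | no  L⊈F = ⊥-elim (L⊈F (out⊆F ∘ run-⊇ k _ _ B I ∘ Subsetₚ.q⊆p∪q S _))

    -- The invariants at the end of a branch of the decision tree. `resolved` merges three fates of
    -- a query: answered "yes", it lies in the fingerprint and is trivially heavy; answered "no", it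
    -- violates the final event; never asked, it was heavy when the search stopped.
    record Leaf (xs : List (Subset n)) (B : Event n) (I : Subset n) (st : State) : Set ℓ₂ where
      S′ = proj₁ st
      B′ = proj₂ st
      field
        fingerprint⊆ : S′ ⊆ I
        event        : T (B′ I)
        decreasing   : Decreasing B′
        stronger     : ∀ {X} → T (B′ X) → T (B X)
        Φ≤           : Φ B′ S′ ≤ δ̄ ^ ∣ S′ ∣
        resolved     : ∀ {L} → L ∈ₗ xs → T (B′ L) → Heavy B′ S′ L

    run-leaf : ∀ k xs {S B I} → length xs ℕ.≤ k → S ⊆ I → T (B I) → Decreasing B →
               Φ B S ≤ δ̄ ^ ∣ S ∣ → Leaf xs B I (run k xs (S , B) I)
    run-leaf zero [] _ S⊆I BI dec Φ≤ = record
      { fingerprint⊆ = S⊆I ; event = BI ; decreasing = dec ; stronger = id ; Φ≤ = Φ≤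
      ; resolved = λ () }
    run-leaf (suc k) xs {S} {B} {I} ∣xs∣≤k S⊆I BI dec Φ≤ with search B S xs
    ... | inj₁ heavies = record
      { fingerprint⊆ = S⊆I ; event = BI ; decreasing = dec ; stronger = id ; Φ≤ = Φ≤
      ; resolved = λ L∈xs _ → All.lookup heavies L∈xs }
    ... | inj₂ found with LightIn.set found ⊆? I
    ...   | yes L⊆I = record
      { fingerprint⊆ = fingerprint⊆ ; event = event ; decreasing = decreasing ; stronger = stronger ; Φ≤ = Leaf.Φ≤ leaf
      ; resolved = λ K∈xs → case split K∈xs of λ
          { (inj₁ ≡.refl) _ → ⊆⇒Heavy decreasing (run-⊇ k others (S ∪ set) B I ∘ Subsetₚ.q⊆p∪q S set)
          ; (inj₂ K∈others) → resolved K∈others } }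
      where
      open LightIn found
      Φ≤′ : Φ B (S ∪ set) ≤ δ̄ ^ ∣ S ∪ set ∣
      Φ≤′ = begin
        Φ B (S ∪ set)                       ≤⟨ light ⟩
        δ̄ ^ ∣ set ─ S ∣ * Φ B S             ≤⟨ *-monoʳ-≤ (0≤^ 0≤δ̄ ∣ set ─ S ∣) Φ≤ ⟩
        δ̄ ^ ∣ set ─ S ∣ * δ̄ ^ ∣ S ∣         ≈⟨ *-comm _ _ ⟩
        δ̄ ^ ∣ S ∣ * δ̄ ^ ∣ set ─ S ∣         ≈⟨ ^-homo-* δ̄ ∣ S ∣ ∣ set ─ S ∣ ⟨
        δ̄ ^ (∣ S ∣ ℕ.+ ∣ set ─ S ∣)         ≡⟨ ≡.cong (δ̄ ^_) (∣∪∣≡∣∣+∣─∣ S set) ⟨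
        δ̄ ^ ∣ S ∪ set ∣                     ∎
      leaf : Leaf others B I (run k others (S ∪ set , B) I)
      leaf = run-leaf k others (ℕₚ.≤-pred (≡.subst (ℕ._≤ suc k) (≡.sym size) ∣xs∣≤k)) (∪-lub S⊆I L⊆I) BI dec Φ≤′
      open Leaf leaf using (fingerprint⊆; event; decreasing; stronger; resolved)
    ...   | no L⊈I = record
      { fingerprint⊆ = fingerprint⊆ ; event = event ; decreasing = decreasing ; stronger = avoid⇒ {L = set} {B} ∘ stronger ; Φ≤ = Leaf.Φ≤ leaf
      ; resolved = λ K∈xs → case split K∈xs of λ
          { (inj₁ ≡.refl) B′L → ⊥-elim (avoid⇒⊈ {L = set} {B} (stronger B′L) id)
          ; (inj₂ K∈others) → resolved K∈others } }
      where
      open LightIn found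
      leaf : Leaf others (avoid set B) I (run k others (S , avoid set B) I)
      leaf = run-leaf k others (ℕₚ.≤-pred (≡.subst (ℕ._≤ suc k) (≡.sym size) ∣xs∣≤k)) S⊆I (avoid⁺ {L = set} {B} BI L⊈I) (avoid-decreasing {L = set} {B} dec)
        (≤-trans (Φ-mono {B = avoid set B} {B′ = B} (λ {X} → avoid⇒ {L = set} {B} {X}) S) Φ≤)
      open Leaf leaf using (fingerprint⊆; event; decreasing; stronger; resolved)

    result : List (Subset n) → Event n → Subset n → State
    result xs B I = run (length xs) xs (∅ , B) I

    result-replay : ∀ xs B I → proj₁ (result xs B I) ⊆ I → result xs B (proj₁ (result xs B I)) ≡ result xs B I
    result-replay xs B I out⊆I = run-replay (length xs) xs ∅ B id out⊆I

    result-leaf : ∀ xs {B I} → T (B I) → Decreasing B → Leaf xs B I (result xs B I)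
    result-leaf xs {B} BI dec = run-leaf (length xs) xs ℕₚ.≤-refl (⊥-elim ∘ Subsetₚ.∉⊥) BI dec
      (≤-trans (Φ≤1 B ∅) (≤-reflexive (reflexive (≡.cong (δ̄ ^_) (≡.sym (Subsetₚ.∣⊥∣≡0 n))))))

    fingerprint-size : p ≤ δ → 0# < δ̄ → ∀ {xs B I st} → Leaf xs B I st → δ * fromℕ ∣ proj₁ st ∣ ≤ p * fromℕ n
    fingerprint-size p≤δ 0<δ̄ {st = S , _} leaf = complement-^-≤⇒ p+p̄≈1 δ+δ̄≈1 0≤p p≤δ 0<δ̄ (Subsetₚ.∣p∣≤n S)
      (≤-trans (p̄^n≤Φ decreasing (decreasing fingerprint⊆ event)) Φ≤)
      where open Leaf leaf

-- Weights extended by zero to all subsets, and their energies.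

module WeightedHypergraph {c ℓ₁ ℓ₂} (ℝ : Reals c ℓ₁ ℓ₂) {n : ℕ} where
  open OrderedField ℝ
  open FiniteSums ℝ
  open Janson ℝ {n}
  open ≤-Reasoning
  open Solver using (solve; _:=_; _:+_; _:*_; con)

  Weight : Set c
  Weight = Subset n → Carrier

  ∥_∥ : Weight → Carrier
  ∥ w ∥ = ∑ (subsets n) w

  ∑₂ : (Subset n → Subset n → Carrier) → Carrier
  ∑₂ f = ∑ (subsets n) λ E → ∑ (subsets n) λ F → f E F

  ∑₂-cong : ∀ {f g} → (∀ E F → f E F ≈ g E F) → ∑₂ f ≈ ∑₂ g
  ∑₂-cong f≈g = ∑-cong (subsets n) λ E → ∑-cong (subsets n) (f≈g E)

  ∑₂-mono : ∀ {f g} → (∀ E F → f E F ≤ g E F) → ∑₂ f ≤ ∑₂ g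
  ∑₂-mono f≤g = ∑-mono (subsets n) λ E → ∑-mono (subsets n) (f≤g E)

  *-distribˡ-∑₂ : ∀ y f → y * ∑₂ f ≈ ∑₂ (λ E F → y * f E F)
  *-distribˡ-∑₂ y f = trans (*-distribˡ-∑ y (subsets n) _) (∑-cong (subsets n) λ E → *-distribˡ-∑ y (subsets n) (f E))

  ∑-∑₂-comm : ∀ {a} {A : Set a} (xs : List A) (f : A → Subset n → Subset n → Carrier) →
              ∑ xs (λ x → ∑₂ (f x)) ≈ ∑₂ (λ E F → ∑ xs (λ x → f x E F))
  ∑-∑₂-comm xs f = trans (∑-comm xs (subsets n) _) (∑-cong (subsets n) λ E → ∑-comm xs (subsets n) _)

  -- The powers of `r` undo the probabilities of containing `E` and `F` separately, while the power
  -- of `q` is the probability of containing both. What remains is the overlap outside `S`, counted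
  -- once too often.
  ^-─-pair : ∀ {q r} → q * r ≈ 1# → 1# ≤ r → ∀ S (E F : Subset n) →
             r ^ ∣ E ─ S ∣ * r ^ ∣ F ─ S ∣ * q ^ ∣ (E ∪ F) ─ S ∣ ≤ r ^ ∣ E ∩ F ∣
  ^-─-pair {q} {r} q*r≈1 1≤r S E F = begin
    r ^ ∣ E ─ S ∣ * r ^ ∣ F ─ S ∣ * q ^ u     ≈⟨ *-congʳ (^-homo-* r ∣ E ─ S ∣ ∣ F ─ S ∣) ⟨
    r ^ (∣ E ─ S ∣ ℕ.+ ∣ F ─ S ∣) * q ^ u     ≡⟨ ≡.cong (λ k → r ^ k * q ^ u) (∣─∣+∣─∣ E F S) ⟩
    r ^ (u ℕ.+ i) * q ^ u                     ≈⟨ *-congʳ (^-homo-* r u i) ⟩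
    r ^ u * r ^ i * q ^ u                     ≈⟨ solve 3 (λ a b c → a :* b :* c := c :* a :* b) refl (r ^ u) (r ^ i) (q ^ u) ⟩
    q ^ u * r ^ u * r ^ i                     ≈⟨ trans (*-congʳ (x*y≈1⇒x^n*y^n≈1 u q*r≈1)) (*-identityˡ _) ⟩
    r ^ i                                     ≤⟨ ^-monoʳ-≤ 1≤r (Subsetₚ.p⊆q⇒∣p∣≤∣q∣ (Subsetₚ.p─q⊆p (E ∩ F) S)) ⟩
    r ^ ∣ E ∩ F ∣                             ∎
    where
    u i : ℕ
    u = ∣ (E ∪ F) ─ S ∣
    i = ∣ (E ∩ F) ─ S ∣

  degree : Weight → Subset n → Carrier
  degree w L = ∑ (subsets n) λ E → 𝟙? (L ⊆? E) * w E

  -- This is `Λ` written with the inverse density `r`, for weights on all subsets.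
  energy : Carrier → Weight → Carrier
  energy r w = ∑ (subsets n) λ L → 𝟙? (2 ℕₚ.≤? ∣ L ∣) * (degree w L * degree w L * r ^ ∣ L ∣)

  -- The part of energy coming from L = E ∩ F.
  pairEnergy : Carrier → Weight → Carrier
  pairEnergy r w = ∑₂ λ E F → w E * w F * (𝟙? (2 ℕₚ.≤? ∣ E ∩ F ∣) * r ^ ∣ E ∩ F ∣)

  -- The coefficient with which a pair of edges meeting in `K` enters the energy once the squared
  -- degrees are expanded.
  kernel : Carrier → Subset n → Carrier
  kernel r K = ∑ (subsets n) λ L → 𝟙? (2 ℕₚ.≤? ∣ L ∣) * (𝟙? (L ⊆? K) * r ^ ∣ L ∣)

  energy≈ : ∀ r w → energy r w ≈ ∑₂ λ E F → w E * w F * kernel r (E ∩ F)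
  energy≈ r w = begin-equality
    energy r w
      ≈⟨ ∑-cong (subsets n) term ⟩
    ∑ (subsets n) (λ L → ∑₂ λ E F → w E * w F * (𝟙? (2 ℕₚ.≤? ∣ L ∣) * (𝟙? (L ⊆? E ∩ F) * r ^ ∣ L ∣)))
      ≈⟨ ∑-∑₂-comm (subsets n) _ ⟩
    ∑₂ (λ E F → ∑ (subsets n) λ L → w E * w F * (𝟙? (2 ℕₚ.≤? ∣ L ∣) * (𝟙? (L ⊆? E ∩ F) * r ^ ∣ L ∣)))
      ≈⟨ ∑₂-cong (λ E F → *-distribˡ-∑ (w E * w F) (subsets n) _) ⟨
    ∑₂ (λ E F → w E * w F * kernel r (E ∩ F)) ∎
    where
    term : ∀ L → 𝟙? (2 ℕₚ.≤? ∣ L ∣) * (degree w L * degree w L * r ^ ∣ L ∣) ≈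
                 ∑₂ λ E F → w E * w F * (𝟙? (2 ℕₚ.≤? ∣ L ∣) * (𝟙? (L ⊆? E ∩ F) * r ^ ∣ L ∣))
    term L = begin-equality
      i * (degree w L * degree w L * x)
        ≈⟨ solve 3 (λ i d x → i :* (d :* x) := i :* x :* d) refl i (degree w L * degree w L) x ⟩
      i * x * (degree w L * degree w L)
        ≈⟨ *-congˡ (∑*∑ (subsets n) (subsets n) _ _) ⟩
      i * x * ∑₂ (λ E F → 𝟙? (L ⊆? E) * w E * (𝟙? (L ⊆? F) * w F))
        ≈⟨ *-distribˡ-∑₂ (i * x) _ ⟩
      ∑₂ (λ E F → i * x * (𝟙? (L ⊆? E) * w E * (𝟙? (L ⊆? F) * w F)))
        ≈⟨ ∑₂-cong (λ E F → trans
             (solve 6 (λ i x a b e f → i :* x :* (a :* e :* (b :* f)) := e :* f :* (i :* (a :* b :* x))) refl i x (𝟙? (L ⊆? E)) (𝟙? (L ⊆? F)) (w E) (w F))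
             (*-congˡ (*-congˡ (*-congʳ (𝟙?-× (L ⊆? E) (L ⊆? F) (L ⊆? E ∩ F)
               (λ L⊆ → (λ {v} v∈ → Subsetₚ.p∩q⊆p E F (L⊆ v∈)) , (λ {v} v∈ → Subsetₚ.p∩q⊆q E F (L⊆ v∈)))
               (λ L⊆E L⊆F → ∩-glb L⊆E L⊆F)))))) ⟩
      ∑₂ (λ E F → w E * w F * (i * (𝟙? (L ⊆? E ∩ F) * x))) ∎
      where
      i x : Carrier
      i = 𝟙? (2 ℕₚ.≤? ∣ L ∣)
      x = r ^ ∣ L ∣

  0≤kernel-term : ∀ {r} → 0# ≤ r → ∀ (K L : Subset n) → 0# ≤ 𝟙? (2 ℕₚ.≤? ∣ L ∣) * (𝟙? (L ⊆? K) * r ^ ∣ L ∣)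
  0≤kernel-term 0≤r K L = *-nonNeg (0≤𝟙 (does (2 ℕₚ.≤? ∣ L ∣))) (*-nonNeg (0≤𝟙 (does (L ⊆? K))) (0≤^ 0≤r ∣ L ∣))

  ≤kernel : ∀ {r} → 0# ≤ r → ∀ (K : Subset n) → 𝟙? (2 ℕₚ.≤? ∣ K ∣) * r ^ ∣ K ∣ ≤ kernel r K
  ≤kernel {r} 0≤r K = begin
    𝟙? (2 ℕₚ.≤? ∣ K ∣) * r ^ ∣ K ∣                    ≈⟨ *-congˡ (trans (*-congʳ (𝟙?-true (K ⊆? K) id)) (*-identityˡ _)) ⟨
    𝟙? (2 ℕₚ.≤? ∣ K ∣) * (𝟙? (K ⊆? K) * r ^ ∣ K ∣)    ≤⟨ term≤∑ (0≤kernel-term 0≤r K) K ⟩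
    kernel r K                                        ∎

  -- A counted `L` lies in `K`, so `2 ≤ ∣ L ∣` passes to `K`; dropping it for `L` leaves the full
  -- binomial sum. Together with `≤kernel`, the energy at `r` lies between the pair energies at `r`
  -- and at `1 + r`.
  kernel≤ : ∀ {r} → 0# ≤ r → ∀ (K : Subset n) → kernel r K ≤ 𝟙? (2 ℕₚ.≤? ∣ K ∣) * (1# + r) ^ ∣ K ∣
  kernel≤ {r} 0≤r K = begin
    kernel r K
      ≤⟨ ∑-mono (subsets n) term ⟩
    ∑ (subsets n) (λ L → 𝟙? (2 ℕₚ.≤? ∣ K ∣) * (𝟙? (L ⊆? K) * r ^ ∣ L ∣))
      ≈⟨ *-distribˡ-∑ _ (subsets n) _ ⟨
    𝟙? (2 ℕₚ.≤? ∣ K ∣) * ∑ (subsets n) (λ L → 𝟙? (L ⊆? K) * r ^ ∣ L ∣)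
      ≈⟨ *-congˡ (∑-⊆-^ r K) ⟩
    𝟙? (2 ℕₚ.≤? ∣ K ∣) * (1# + r) ^ ∣ K ∣ ∎
    where
    term : ∀ L → 𝟙? (2 ℕₚ.≤? ∣ L ∣) * (𝟙? (L ⊆? K) * r ^ ∣ L ∣) ≤ 𝟙? (2 ℕₚ.≤? ∣ K ∣) * (𝟙? (L ⊆? K) * r ^ ∣ L ∣)
    term L with L ⊆? K
    ... | no _    = ≤-reflexive (trans (trans (*-congˡ (zeroˡ _)) (zeroʳ _)) (sym (trans (*-congˡ (zeroˡ _)) (zeroʳ _))))
    ... | yes L⊆K with 2 ℕₚ.≤? ∣ L ∣
    ...   | yes 2≤L = ≤-reflexive (*-congʳ (trans (𝟙?-true (2 ℕₚ.≤? ∣ L ∣) 2≤L) (sym (𝟙?-true (2 ℕₚ.≤? ∣ K ∣) (ℕₚ.≤-trans 2≤L (Subsetₚ.p⊆q⇒∣p∣≤∣q∣ L⊆K))))))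
    ...   | no 2≰L  = ≤-trans (≤-reflexive (trans (*-congʳ (𝟙?-false (2 ℕₚ.≤? ∣ L ∣) 2≰L)) (zeroˡ _))) (*-nonNeg (0≤𝟙 (does (2 ℕₚ.≤? ∣ K ∣))) (*-nonNeg 0≤1 (0≤^ 0≤r ∣ L ∣)))

  pairEnergy≤energy : ∀ {r w} → 0# ≤ r → (∀ E → 0# ≤ w E) → pairEnergy r w ≤ energy r w
  pairEnergy≤energy {r} {w} 0≤r 0≤w = ≤-trans
    (∑₂-mono λ E F → *-monoʳ-≤ (*-nonNeg (0≤w E) (0≤w F)) (≤kernel 0≤r (E ∩ F)))
    (≤-reflexive (sym (energy≈ r w)))

  0≤pairEnergy-term : ∀ {r} → 0# ≤ r → ∀ (K : Subset n) → 0# ≤ 𝟙? (2 ℕₚ.≤? ∣ K ∣) * r ^ ∣ K ∣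
  0≤pairEnergy-term 0≤r K = *-nonNeg (0≤𝟙 (does (2 ℕₚ.≤? ∣ K ∣))) (0≤^ 0≤r ∣ K ∣)

  pairEnergy-mono : ∀ {r w w′} → 0# ≤ r → (∀ E → 0# ≤ w E) → (∀ E → w E ≤ w′ E) → pairEnergy r w ≤ pairEnergy r w′
  pairEnergy-mono 0≤r 0≤w w≤w′ = ∑₂-mono λ E F →
    *-monoˡ-≤ (0≤pairEnergy-term 0≤r (E ∩ F)) (*-mono-≤ (0≤w F) (≤-trans (0≤w E) (w≤w′ E)) (w≤w′ E) (w≤w′ F))

  on : Hypergraph n → Weight → Weight
  on 𝓖 ν E = 𝟙 (𝓖 E) * ν E

  e≈∥∥ : ∀ 𝓖 ν → e 𝓖 ν ≈ ∥ on 𝓖 ν ∥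
  e≈∥∥ 𝓖 ν = ∑-filter (λ E → Boolₚ.T? (𝓖 E)) (subsets n) ν

  d≈degree : ∀ 𝓖 ν L → d 𝓖 ν L ≈ degree (on 𝓖 ν) L
  d≈degree 𝓖 ν L = begin-equality
    d 𝓖 ν L
      ≈⟨ ∑-filter (L ⊆?_) (edges 𝓖) ν ⟩
    ∑ (edges 𝓖) (λ E → 𝟙? (L ⊆? E) * ν E)
      ≈⟨ ∑-filter (λ E → Boolₚ.T? (𝓖 E)) (subsets n) _ ⟩
    ∑ (subsets n) (λ E → 𝟙 (𝓖 E) * (𝟙? (L ⊆? E) * ν E))
      ≈⟨ ∑-cong (subsets n) (λ E → solve 3 (λ a b c → a :* (b :* c) := b :* (a :* c)) refl (𝟙 (𝓖 E)) (𝟙? (L ⊆? E)) (ν E)) ⟩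
    degree (on 𝓖 ν) L ∎

  Λ≈energy : ∀ {p r} → p * r ≈ 1# → ∀ 𝓖 ν → Λ p 𝓖 ν ≈ energy r (on 𝓖 ν)
  Λ≈energy {p} {r} pr≈1 𝓖 ν = trans (∑-filter (λ L → 2 ℕₚ.≤? ∣ L ∣) (subsets n) _)
    (∑-cong (subsets n) λ L → *-congˡ (*-cong
      (trans (x^2≈x*x _) (*-cong (d≈degree 𝓖 ν L) (d≈degree 𝓖 ν L)))
      (x*y≈1⇒x⁻¹≈y (x*y≈1⇒x^n*y^n≈1 ∣ L ∣ pr≈1))))

  energy-cong : ∀ r {w w′} → (∀ E → w E ≈ w′ E) → energy r w ≈ energy r w′
  energy-cong r w≈w′ = ∑-cong (subsets n) λ L → *-congˡ (*-congʳ (*-cong (deg L) (deg L)))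
    where
    deg = λ L → ∑-cong (subsets n) λ E → *-congˡ {𝟙? (L ⊆? E)} (w≈w′ E)

  restrict : Subset n → Weight → Weight
  restrict X w E = 𝟙? (E ⊆? X) * w E

  on-restrict : ∀ {𝓗 : Hypergraph n} {w} → (∀ E → 𝟙 (𝓗 E) * w E ≈ w E) → ∀ X E → on (𝓗 [ X ]) w E ≈ restrict X w E
  on-restrict {𝓗} {w} supp X E = begin-equality
    𝟙 (𝓗 E ∧ ⌊ E ⊆? X ⌋) * w E                ≈⟨ *-congʳ (𝟙-∧ (𝓗 E) ⌊ E ⊆? X ⌋) ⟩
    𝟙 (𝓗 E) * 𝟙 ⌊ E ⊆? X ⌋ * w E              ≈⟨ *-congʳ (*-congˡ (reflexive (≡.cong 𝟙 (isYes≗does (E ⊆? X))))) ⟩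
    𝟙 (𝓗 E) * 𝟙? (E ⊆? X) * w E        ≈⟨ solve 3 (λ a b c → a :* b :* c := b :* (a :* c)) refl (𝟙 (𝓗 E)) (𝟙? (E ⊆? X)) (w E) ⟩
    𝟙? (E ⊆? X) * (𝟙 (𝓗 E) * w E)      ≈⟨ *-congˡ (supp E) ⟩
    𝟙? (E ⊆? X) * w E                  ∎

-- Random sets satisfying B span no Janson hypergraph, so heavy edges carry little weight.
module HeavyEdges {c ℓ₁ ℓ₂} (ℝ : Reals c ℓ₁ ℓ₂) (P Δ : OrderedField.Probability ℝ) where
  open OrderedField ℝ
  open FiniteSums ℝ
  open Survival ℝ P
  open Algorithm ℝ P Δ using (Heavy; δ̄≤1)
  open Probability P using () renaming (value to q)
  open Probability Δ using () renaming (complement to ᾱ; 0≤complement to 0≤ᾱ)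
  open ≤-Reasoning
  open Solver using (solve; _:=_; _:+_; _:*_; con)

  module _ {n : ℕ} (r : Carrier) (q*r≈1 : q * r ≈ 1#) (1≤r : 1# ≤ r) where
    open WeightedHypergraph ℝ {n}

    -- Since `r` is the inverse of `q`, this divides the weight of `E` by the probability that the
    -- random set together with `S` contains `E`. Before conditioning, the tilted weight inside the
    -- random set has expectation `∥ w ∥`.
    tilt : Subset n → Weight → Weight
    tilt S w E = w E * r ^ ∣ E ─ S ∣

    private
      0≤r : 0# ≤ r
      0≤r = ≤-trans 0≤1 1≤r

    module _ {B : Event n} (dec : Decreasing B) (S : Subset n) (0<Φ : 0# < Φ B S)
             (w : Weight) (0≤w : ∀ E → 0# ≤ w E) where

      private
        w′ : Weight
        w′ = tilt S w

        0≤w′ : ∀ E → 0# ≤ w′ E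
        0≤w′ E = *-nonNeg (0≤w E) (0≤^ 0≤r ∣ E ─ S ∣)

      -- Conditioning on `B` lowers the probability of containing a heavy edge by a factor of at
      -- least `ᾱ ^ ∣ E ─ S ∣`, hence at least `ᾱ ^ s`; the tilt cancels the rest.
      𝕄-∥restrict∥ : ∀ s → (∀ E → w E ≈ 0# ⊎ (∣ E ∣ ≡ s × Heavy B S E)) →
                     ᾱ ^ s * ∥ w ∥ * Φ B S ≤ 𝕄 B S (λ Y → ∥ restrict Y w′ ∥)
      𝕄-∥restrict∥ s heavy = begin
        ᾱ ^ s * ∥ w ∥ * Φ B S                              ≈⟨ solve 3 (λ a b c → a :* b :* c := a :* c :* b) refl (ᾱ ^ s) ∥ w ∥ (Φ B S) ⟩
        ᾱ ^ s * Φ B S * ∥ w ∥                              ≈⟨ *-distribˡ-∑ _ (subsets n) w ⟩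
        ∑ (subsets n) (λ E → ᾱ ^ s * Φ B S * w E)          ≤⟨ ∑-mono (subsets n) term ⟩
        ∑ (subsets n) (λ E → 𝕄 B S (λ Y → restrict Y w′ E)) ≈⟨ 𝕄-∑ B S (subsets n) (λ E Y → restrict Y w′ E) ⟨
        𝕄 B S (λ Y → ∥ restrict Y w′ ∥)                    ∎
        where
        bound : ∀ E → w E ≈ 0# ⊎ (∣ E ∣ ≡ s × Heavy B S E) → ᾱ ^ s * Φ B S * w E ≤ Φ B (S ∪ E) * w E
        bound E (inj₁ wE≈0) = ≤-reflexive (trans (trans (*-congˡ wE≈0) (zeroʳ _)) (sym (trans (*-congˡ wE≈0) (zeroʳ _))))
        bound E (inj₂ (≡.refl , heavyE)) = *-monoˡ-≤ (0≤w E) (≤-trans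
          (*-monoˡ-≤ (proj₁ 0<Φ) (^-antimonoʳ-≤ 0≤ᾱ δ̄≤1 (Subsetₚ.p⊆q⇒∣p∣≤∣q∣ (Subsetₚ.p─q⊆p E S)))) heavyE)
        term : ∀ E → ᾱ ^ s * Φ B S * w E ≤ 𝕄 B S (λ Y → restrict Y w′ E)
        term E = begin
          ᾱ ^ s * Φ B S * w E                           ≤⟨ bound E (heavy E) ⟩
          Φ B (S ∪ E) * w E                             ≈⟨ trans (*-congʳ (x*y≈1⇒x^n*y^n≈1 k q*r≈1)) (*-identityˡ _) ⟨
          q ^ k * r ^ k * (Φ B (S ∪ E) * w E)           ≈⟨ solve 4 (λ a b f w → a :* b :* (f :* w) := w :* b :* (a :* f)) refl (q ^ k) (r ^ k) (Φ B (S ∪ E)) (w E) ⟩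
          w′ E * (q ^ k * Φ B (S ∪ E))                  ≈⟨ *-congˡ (𝕄-𝟙⊆ B S E) ⟨
          w′ E * 𝕄 B S (λ Y → 𝟙? (E ⊆? Y))              ≈⟨ 𝕄-distribˡ-* B S (w′ E) _ ⟨
          𝕄 B S (λ Y → w′ E * 𝟙? (E ⊆? Y))              ≈⟨ 𝕄-cong B S (λ Y → *-comm _ _) ⟩
          𝕄 B S (λ Y → restrict Y w′ E)                 ∎
          where
          k : ℕ
          k = ∣ E ─ S ∣

      -- A pair with overlap `k` retains `r ^ k` after containment is averaged out, and its kernel
      -- is at most `(1 + u) ^ k = (q x) ^ k`. As `q r = 1`, only `x ^ k` is left, and the density
      -- `q` disappears.
      𝕄-energy : ∀ {u x} → 0# ≤ u → 0# ≤ x → 1# + u ≈ q * x →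
                 𝕄 B S (λ Y → energy u (restrict Y w′)) ≤ pairEnergy x w * Φ B S
      𝕄-energy {u} {x} 0≤u 0≤x 1+u≈qx = begin
        𝕄 B S (λ Y → energy u (restrict Y w′))
          ≈⟨ 𝕄-cong B S (λ Y → trans (energy≈ u (restrict Y w′)) (∑₂-cong (pair Y))) ⟩
        𝕄 B S (λ Y → ∑₂ λ E F → g E F * 𝟙? (E ∪ F ⊆? Y))
          ≈⟨ trans (𝕄-∑ B S (subsets n) _) (∑-cong (subsets n) λ E → 𝕄-∑ B S (subsets n) _) ⟩
        ∑₂ (λ E F → 𝕄 B S (λ Y → g E F * 𝟙? (E ∪ F ⊆? Y)))
          ≈⟨ ∑₂-cong (λ E F → 𝕄-distribˡ-* B S (g E F) _) ⟩
        ∑₂ (λ E F → g E F * 𝕄 B S (λ Y → 𝟙? (E ∪ F ⊆? Y)))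
          ≤⟨ ∑₂-mono term ⟩
        ∑₂ (λ E F → Φ B S * (w E * w F * (𝟙? (2 ℕₚ.≤? ∣ E ∩ F ∣) * x ^ ∣ E ∩ F ∣)))
          ≈⟨ *-distribˡ-∑₂ (Φ B S) _ ⟨
        Φ B S * pairEnergy x w
          ≈⟨ *-comm _ _ ⟩
        pairEnergy x w * Φ B S ∎
        where
        g : Subset n → Subset n → Carrier
        g E F = w′ E * w′ F * kernel u (E ∩ F)
        0≤kernel : ∀ K → 0# ≤ kernel u K
        0≤kernel K = ∑-nonNeg (subsets n) (0≤kernel-term 0≤u K)
        pair : ∀ Y E F → restrict Y w′ E * restrict Y w′ F * kernel u (E ∩ F) ≈ g E F * 𝟙? (E ∪ F ⊆? Y)
        pair Y E F = trans
          (solve 5 (λ a b e f k → a :* e :* (b :* f) :* k := e :* f :* k :* (a :* b)) refl (𝟙? (E ⊆? Y)) (𝟙? (F ⊆? Y)) (w′ E) (w′ F) (kernel u (E ∩ F)))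
          (*-congˡ (𝟙?-× (E ⊆? Y) (F ⊆? Y) (E ∪ F ⊆? Y)
            (λ ∪⊆ → (λ {v} v∈ → ∪⊆ (Subsetₚ.p⊆p∪q F v∈)) , (λ {v} v∈ → ∪⊆ (Subsetₚ.q⊆p∪q E F v∈)))
            (λ E⊆ F⊆ → ∪-lub E⊆ F⊆)))
        term : ∀ E F → g E F * 𝕄 B S (λ Y → 𝟙? (E ∪ F ⊆? Y)) ≤
                       Φ B S * (w E * w F * (𝟙? (2 ℕₚ.≤? ∣ E ∩ F ∣) * x ^ ∣ E ∩ F ∣))
        term E F = begin
          g E F * 𝕄 B S (λ Y → 𝟙? (E ∪ F ⊆? Y))
            ≤⟨ *-monoʳ-≤ (*-nonNeg (*-nonNeg (0≤w′ E) (0≤w′ F)) (0≤kernel (E ∩ F))) (𝕄-𝟙⊆-≤ B S dec (E ∪ F)) ⟩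
          w E * a * (w F * b) * κ * (c′ * φ)
            ≈⟨ solve 7 (λ e a f b κ c φ → e :* a :* (f :* b) :* κ :* (c :* φ) := φ :* (e :* f) :* (a :* b :* c) :* κ) refl (w E) a (w F) b κ c′ φ ⟩
          φ * (w E * w F) * (a * b * c′) * κ
            ≤⟨ *-mono-≤ (0≤kernel (E ∩ F)) (*-nonNeg 0≤φwwE (0≤^ 0≤r k)) (*-monoʳ-≤ 0≤φwwE (^-─-pair q*r≈1 1≤r S E F)) (kernel≤ 0≤u (E ∩ F)) ⟩
          φ * (w E * w F) * r ^ k * (i * (1# + u) ^ k)
            ≈⟨ *-congˡ (*-congˡ (trans (^-congˡ k 1+u≈qx) (*-distrib-^ q x k))) ⟩
          φ * (w E * w F) * r ^ k * (i * (q ^ k * x ^ k))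
            ≈⟨ solve 6 (λ φ w r i q x → φ :* w :* r :* (i :* (q :* x)) := φ :* (w :* (i :* x)) :* (q :* r)) refl φ (w E * w F) (r ^ k) i (q ^ k) (x ^ k) ⟩
          φ * (w E * w F * (i * x ^ k)) * (q ^ k * r ^ k)
            ≈⟨ trans (*-congˡ (x*y≈1⇒x^n*y^n≈1 k q*r≈1)) (*-identityʳ _) ⟩
          φ * (w E * w F * (i * x ^ k)) ∎
          where
          k : ℕ
          k = ∣ E ∩ F ∣
          a b c′ φ κ i : Carrier
          a  = r ^ ∣ E ─ S ∣
          b  = r ^ ∣ F ─ S ∣
          c′ = q ^ ∣ (E ∪ F) ─ S ∣
          φ  = Φ B S
          κ  = kernel u (E ∩ F)
          i  = 𝟙? (2 ℕₚ.≤? ∣ E ∩ F ∣)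
          0≤φwwE : 0# ≤ φ * (w E * w F)
          0≤φwwE = *-nonNeg (proj₁ 0<Φ) (*-nonNeg (0≤w E) (0≤w F))

      -- Since N² ≥ 2 c N - c², the second moment of N is bounded below through
      -- its first moment, without dividing by Φ.
      heavy-weight-bound : ∀ {s u x ζ} → 0# ≤ u → 0# ≤ x → 0# ≤ ζ → 1# + u ≈ q * x →
        (∀ E → w E ≈ 0# ⊎ (∣ E ∣ ≡ s × Heavy B S E)) →
        (∀ Y → T (B Y) → ∥ restrict Y w′ ∥ * ∥ restrict Y w′ ∥ ≤ ζ * energy u (restrict Y w′)) →
        ᾱ ^ s * ∥ w ∥ * (ᾱ ^ s * ∥ w ∥) ≤ ζ * pairEnergy x w
      heavy-weight-bound {s} {u} {x} {ζ} 0≤u 0≤x 0≤ζ 1+u≈qx heavy sparse =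
        *-cancelˡ-≤ 0<Φ (+-cancelʳ-≤ (Φ B S * (k * k)) (begin
          φ * (k * k) + φ * (k * k)
            ≈⟨ solve 2 (λ φ k → φ :* (k :* k) :+ φ :* (k :* k) := k :* (k :* φ) :+ k :* (k :* φ)) refl φ k ⟩
          k * (k * φ) + k * (k * φ)
            ≤⟨ +-mono-≤ k*kφ≤ k*kφ≤ ⟩
          k * 𝕄 B S N + k * 𝕄 B S N
            ≈⟨ trans (𝕄-distrib-+ B S _ _) (+-cong (𝕄-distribˡ-* B S k N) (𝕄-distribˡ-* B S k N)) ⟨
          𝕄 B S (λ Y → k * N Y + k * N Y)
            ≤⟨ 𝕄-mono B S (λ Y BY → ≤-trans (2xy≤x²+y² k (N Y)) (≤-trans (≤-reflexive (+-comm _ _)) (+-monoˡ-≤ (k * k) (sparse Y BY)))) ⟩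
          𝕄 B S (λ Y → ζ * energy u (restrict Y w′) + k * k)
            ≈⟨ trans (𝕄-distrib-+ B S _ _) (+-cong (𝕄-distribˡ-* B S ζ _) (𝕄-const B S (k * k))) ⟩
          ζ * 𝕄 B S (λ Y → energy u (restrict Y w′)) + k * k * φ
            ≤⟨ +-monoˡ-≤ _ (*-monoʳ-≤ 0≤ζ (𝕄-energy 0≤u 0≤x 1+u≈qx)) ⟩
          ζ * (pairEnergy x w * φ) + k * k * φ
            ≈⟨ solve 4 (λ z e φ k → z :* (e :* φ) :+ k :* k :* φ := φ :* (z :* e) :+ φ :* (k :* k)) refl ζ (pairEnergy x w) φ k ⟩
          φ * (ζ * pairEnergy x w) + φ * (k * k) ∎))
        where
        φ k : Carrier
        φ = Φ B S
        k = ᾱ ^ s * ∥ w ∥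
        N : Subset n → Carrier
        N Y = ∥ restrict Y w′ ∥
        k*kφ≤ : k * (k * φ) ≤ k * 𝕄 B S N
        k*kφ≤ = *-monoʳ-≤ (*-nonNeg (0≤^ 0≤ᾱ s) (∑-nonNeg (subsets n) 0≤w)) (𝕄-∥restrict∥ s heavy)

-- Each single vertex of the container can almost always be added to the random
-- set conditioned on B, but the vertices of an edge violating B never all can.
module RejectedEdges {c ℓ₁ ℓ₂} (ℝ : Reals c ℓ₁ ℓ₂) (P Δ : OrderedField.Probability ℝ) where
  open OrderedField ℝ
  open FiniteSums ℝ
  open Expectation ℝ P using (𝔼; 𝔼-cong; 𝔼-mono; 𝔼-const; 𝔼-distrib-+)
  open Survival ℝ P
  open Probability P using () renaming (value to p; 0≤value to 0≤p)
  open Probability Δ using () renaming (value to δ; complement to δ̄; sum≈1 to δ+δ̄≈1; 0≤value to 0≤δ)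
  open ≤-Reasoning
  open Solver using (solve; _:=_; _:+_; _:*_; con)

  module _ {n : ℕ} (r : Carrier) (p*r≈1 : p * r ≈ 1#) (1≤r : 1# ≤ r)
           {B : Event n} (dec : Decreasing B) (S : Subset n) (0<Φ : 0# < Φ B S) where
    open WeightedHypergraph ℝ {n}

    private
      0≤r : 0# ≤ r
      0≤r = ≤-trans 0≤1 1≤r
      φ : Carrier
      φ = Φ B S

    blocked : Fin n → Subset n → Carrier
    blocked v Y = 𝟙 (not (B (Y ∪ ⁅ v ⁆)))

    private
      𝟙-not : ∀ b → 𝟙 (not b) + 𝟙 b ≈ 1#
      𝟙-not true  = +-identityˡ 1#
      𝟙-not false = +-identityʳ 1#

    -- Complementary counting: heaviness of the vertex says that adding it succeeds with conditional
    -- probability at least `δ̄`.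
    𝕄-blocked-≤ : ∀ v → δ̄ * φ ≤ Φ B (S ∪ ⁅ v ⁆) → 𝕄 B S (blocked v) ≤ δ * φ
    𝕄-blocked-≤ v heavy = +-cancelʳ-≤ (δ̄ * φ) (begin
      𝕄 B S (blocked v) + δ̄ * φ                              ≤⟨ +-monoʳ-≤ _ (≤-trans heavy (Φ≤𝕄 B S dec ⁅ v ⁆)) ⟩
      𝕄 B S (blocked v) + 𝕄 B S (λ Y → 𝟙 (B (Y ∪ ⁅ v ⁆)))    ≈⟨ 𝕄-distrib-+ B S _ _ ⟨
      𝕄 B S (λ Y → blocked v Y + 𝟙 (B (Y ∪ ⁅ v ⁆)))          ≈⟨ 𝕄-cong B S (λ Y → 𝟙-not (B (Y ∪ ⁅ v ⁆))) ⟩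
      𝕄 B S (λ _ → 1#)                                       ≈⟨ 𝕄-1 B S ⟩
      φ                                                      ≈⟨ *-identityˡ φ ⟨
      1# * φ                                                 ≈⟨ *-congʳ δ+δ̄≈1 ⟨
      (δ + δ̄) * φ                                            ≈⟨ distribʳ _ _ _ ⟩
      δ * φ + δ̄ * φ                                          ∎)

    -- Since `B` is decreasing and fails at `E`, adding all of `E` brings `Φ` down to 0, so the
    -- losses along the way sum to at least `Φ B S`. The loss at `v` is the probability that `v` is
    -- blocked after `before v E` has been forced in; `𝕄-⊆` trades forcing for containment, at the
    -- price of a power of `r`.
    Φ≤∑-blocked : ∀ E → ¬ T (B E) →
      φ ≤ ∑ (allFin n) (λ v → 𝟙? (v Subsetₚ.∈? E) *
            (r ^ ∣ before v E ─ S ∣ * 𝕄 B S (λ Y → 𝟙? (before v E ⊆? Y) * blocked v Y)))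
    Φ≤∑-blocked E ¬BE = begin
      φ                       ≡⟨ ≡.cong (Φ B) (Subsetₚ.∪-identityʳ S) ⟨
      Φ B (S ∪ ∅)             ≤⟨ telescope (λ L → Φ B (S ∪ L)) loss step E ⟩
      Φ B (S ∪ E) + ∑ (allFin n) (λ v → 𝟙? (v Subsetₚ.∈? E) * loss v (before v E))
        ≈⟨ +-cong Φ≈0 (∑-cong (allFin n) λ v → *-congˡ (loss≈ v (before v E))) ⟩
      0# + _                  ≈⟨ +-identityˡ _ ⟩
      _                       ∎
      where
      loss : Fin n → Subset n → Carrier
      loss v L = 𝔼 (λ X → 𝟙 (B (X ∪ (S ∪ L))) * blocked v (X ∪ (S ∪ L)))
      loss≈ : ∀ v L → loss v L ≈ r ^ ∣ L ─ S ∣ * 𝕄 B S (λ Y → 𝟙? (L ⊆? Y) * blocked v Y)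
      loss≈ v L = begin-equality
        loss v L                                ≈⟨ trans (*-congʳ (x*y≈1⇒x^n*y^n≈1 k p*r≈1)) (*-identityˡ _) ⟨
        p ^ k * r ^ k * loss v L                ≈⟨ solve 3 (λ a b c → a :* b :* c := b :* (a :* c)) refl (p ^ k) (r ^ k) (loss v L) ⟩
        r ^ k * (p ^ k * loss v L)              ≈⟨ *-congˡ (𝕄-⊆ B S L (blocked v)) ⟨
        r ^ k * 𝕄 B S (λ Y → 𝟙? (L ⊆? Y) * blocked v Y) ∎
        where
        k : ℕ
        k = ∣ L ─ S ∣
      step : ∀ v L → Φ B (S ∪ L) ≤ Φ B (S ∪ (L ∪ ⁅ v ⁆)) + loss v L
      step v L = ≤-trans (𝔼-mono {n} λ X → pointwise X) (≤-reflexive (𝔼-distrib-+ {n} _ _))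
        where
        b≤ : ∀ a b → 𝟙 a ≤ 𝟙 b + 𝟙 a * 𝟙 (not b)
        b≤ a true  = ≤-trans (𝟙≤1 a) (x≤x+y (*-nonNeg (0≤𝟙 a) ≤-refl))
        b≤ a false = ≤-reflexive (sym (trans (+-identityˡ _) (*-identityʳ _)))
        assoc : ∀ X → X ∪ (S ∪ (L ∪ ⁅ v ⁆)) ≡ (X ∪ (S ∪ L)) ∪ ⁅ v ⁆
        assoc X = ≡.trans (≡.cong (X ∪_) (≡.sym (Subsetₚ.∪-assoc S L ⁅ v ⁆))) (≡.sym (Subsetₚ.∪-assoc X (S ∪ L) ⁅ v ⁆))
        pointwise : ∀ X → 𝟙 (B (X ∪ (S ∪ L))) ≤ 𝟙 (B (X ∪ (S ∪ (L ∪ ⁅ v ⁆)))) + 𝟙 (B (X ∪ (S ∪ L))) * blocked v (X ∪ (S ∪ L))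
        pointwise X rewrite assoc X = b≤ (B (X ∪ (S ∪ L))) (B ((X ∪ (S ∪ L)) ∪ ⁅ v ⁆))
      Φ≈0 : Φ B (S ∪ E) ≈ 0#
      Φ≈0 = trans (𝔼-cong {n} λ X → 𝟙-¬ (B (X ∪ (S ∪ E))) (¬BE ∘ dec (λ v∈ → Subsetₚ.q⊆p∪q X (S ∪ E) (Subsetₚ.q⊆p∪q S E v∈)))) (𝔼-const {n} 0#)
        where
        𝟙-¬ : ∀ b → ¬ T b → 𝟙 b ≈ 0#
        𝟙-¬ true  ¬b = ⊥-elim (¬b tt)
        𝟙-¬ false ¬b = refl

    module _ (w : Weight) (0≤w : ∀ E → 0# ≤ w E) where

      vertexDegree : Fin n → Carrier
      vertexDegree v = ∑ (subsets n) λ E → 𝟙? (v Subsetₚ.∈? E) * w E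

      vertexEnergy : Fin n → Carrier
      vertexEnergy v = ∑₂ λ E F → 𝟙? (v Subsetₚ.∈? E) * w E * (𝟙? (v Subsetₚ.∈? F) * w F) *
                                  (𝟙? (2 ℕₚ.≤? ∣ E ∩ F ∣) * r ^ ∣ E ∩ F ∣)

      private
        0≤vw : ∀ v E → 0# ≤ 𝟙? (v Subsetₚ.∈? E) * w E
        0≤vw v E = *-nonNeg (0≤𝟙 (does (v Subsetₚ.∈? E))) (0≤w E)

      0≤vertexDegree : ∀ v → 0# ≤ vertexDegree v
      0≤vertexDegree v = ∑-nonNeg (subsets n) (0≤vw v)

      0≤vertexEnergy : ∀ v → 0# ≤ vertexEnergy v
      0≤vertexEnergy v = ∑-nonNeg (subsets n) λ E → ∑-nonNeg (subsets n) λ F →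
        *-nonNeg (*-nonNeg (0≤vw v E) (0≤vw v F)) (0≤pairEnergy-term 0≤r (E ∩ F))

      -- The weight of the edges in which `v` is next in turn, all earlier vertices being in `Y`,
      -- each divided by the probability of that. On the event that `v` is blocked, this is the
      -- total loss charged to `v`.
      links : Fin n → Subset n → Carrier
      links v Y = ∑ (subsets n) λ E →
        𝟙? (v Subsetₚ.∈? E) * w E * r ^ ∣ before v E ─ S ∣ * 𝟙? (before v E ⊆? Y)

      Φ*∥w∥≤ : (∀ E → w E ≈ 0# ⊎ ¬ T (B E)) →
               φ * ∥ w ∥ ≤ ∑ (allFin n) (λ v → 𝕄 B S (λ Y → blocked v Y * links v Y))
      Φ*∥w∥≤ rejected = begin
        φ * ∥ w ∥
          ≈⟨ *-distribˡ-∑ φ (subsets n) w ⟩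
        ∑ (subsets n) (λ E → φ * w E)
          ≤⟨ ∑-mono (subsets n) (λ E → edge E (rejected E)) ⟩
        ∑ (subsets n) (λ E → ∑ (allFin n) (λ v → 𝕄 B S (λ Y → blocked v Y * t v E Y)))
          ≈⟨ ∑-comm (subsets n) (allFin n) _ ⟩
        ∑ (allFin n) (λ v → ∑ (subsets n) (λ E → 𝕄 B S (λ Y → blocked v Y * t v E Y)))
          ≈⟨ ∑-cong (allFin n) (λ v → 𝕄-∑ B S (subsets n) _) ⟨
        ∑ (allFin n) (λ v → 𝕄 B S (λ Y → ∑ (subsets n) (λ E → blocked v Y * t v E Y)))
          ≈⟨ ∑-cong (allFin n) (λ v → 𝕄-cong B S λ Y → *-distribˡ-∑ (blocked v Y) (subsets n) _) ⟨
        ∑ (allFin n) (λ v → 𝕄 B S (λ Y → blocked v Y * links v Y)) ∎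
        where
        t : Fin n → Subset n → Subset n → Carrier
        t v E Y = 𝟙? (v Subsetₚ.∈? E) * w E * r ^ ∣ before v E ─ S ∣ * 𝟙? (before v E ⊆? Y)
        m : Fin n → Subset n → Carrier
        m v E = 𝟙? (v Subsetₚ.∈? E) * (r ^ ∣ before v E ─ S ∣ * 𝕄 B S (λ Y → 𝟙? (before v E ⊆? Y) * blocked v Y))
        m≈ : ∀ E v → w E * m v E ≈ 𝕄 B S (λ Y → blocked v Y * t v E Y)
        m≈ E v = begin-equality
          w E * (i * (x * 𝕄 B S (λ Y → 𝟙? (before v E ⊆? Y) * blocked v Y)))
            ≈⟨ solve 4 (λ w i x m → w :* (i :* (x :* m)) := i :* w :* x :* m) refl (w E) i x _ ⟩
          i * w E * x * 𝕄 B S (λ Y → 𝟙? (before v E ⊆? Y) * blocked v Y)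
            ≈⟨ 𝕄-distribˡ-* B S (i * w E * x) _ ⟨
          𝕄 B S (λ Y → i * w E * x * (𝟙? (before v E ⊆? Y) * blocked v Y))
            ≈⟨ 𝕄-cong B S (λ Y → solve 3 (λ k a b → k :* (a :* b) := b :* (k :* a)) refl (i * w E * x) (𝟙? (before v E ⊆? Y)) (blocked v Y)) ⟩
          𝕄 B S (λ Y → blocked v Y * t v E Y) ∎
          where
          i x : Carrier
          i = 𝟙? (v Subsetₚ.∈? E)
          x = r ^ ∣ before v E ─ S ∣
        0≤𝕄 : ∀ {f} → (∀ Y → 0# ≤ f Y) → 0# ≤ 𝕄 B S f
        0≤𝕄 0≤f = ≤-trans (≤-reflexive (sym (trans (𝕄-const B S 0#) (zeroˡ _)))) (𝕄-mono B S λ Y _ → 0≤f Y)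
        edge : ∀ E → w E ≈ 0# ⊎ ¬ T (B E) → φ * w E ≤ ∑ (allFin n) (λ v → 𝕄 B S (λ Y → blocked v Y * t v E Y))
        edge E (inj₁ wE≈0) = ≤-trans (≤-reflexive (trans (*-congˡ wE≈0) (zeroʳ φ)))
          (∑-nonNeg (allFin n) λ v → 0≤𝕄 λ Y → *-nonNeg (0≤𝟙 (not (B (Y ∪ ⁅ v ⁆))))
            (*-nonNeg (*-nonNeg (0≤vw v E) (0≤^ 0≤r ∣ before v E ─ S ∣)) (0≤𝟙 (does (before v E ⊆? Y)))))
        edge E (inj₂ ¬BE) = begin
          φ * w E                              ≈⟨ *-comm φ (w E) ⟩
          w E * φ                              ≤⟨ *-monoʳ-≤ (0≤w E) (Φ≤∑-blocked E ¬BE) ⟩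
          w E * ∑ (allFin n) (λ v → m v E)     ≈⟨ *-distribˡ-∑ (w E) (allFin n) _ ⟩
          ∑ (allFin n) (λ v → w E * m v E)     ≈⟨ ∑-cong (allFin n) (m≈ E) ⟩
          ∑ (allFin n) (λ v → 𝕄 B S (λ Y → blocked v Y * t v E Y)) ∎

      private
        -- If `E` and `F` share only `v`, their initial parts are disjoint and the power is 1.
        -- Otherwise the missing `v` saves one factor `r`, that is, gains a factor `p`.
        before-power : ∀ {v} {E F : Subset n} → v ∈ E → v ∈ F →
                       r ^ ∣ before v E ∩ before v F ∣ ≤ 1# + p * (𝟙? (2 ℕₚ.≤? ∣ E ∩ F ∣) * r ^ ∣ E ∩ F ∣)
        before-power {v} {E} {F} v∈E v∈F with ∣ E ∩ F ∣ | before-∩-< v∈E v∈F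
        ... | suc zero    | s≤s j≤0 = begin
          r ^ ∣ before v E ∩ before v F ∣   ≤⟨ ^-monoʳ-≤ 1≤r j≤0 ⟩
          1#                                ≤⟨ x≤x+y (*-nonNeg 0≤p (*-nonNeg ≤-refl (0≤^ 0≤r 1))) ⟩
          1# + p * (0# * r ^ 1)             ∎
        ... | suc (suc k) | s≤s j≤k = begin
          r ^ ∣ before v E ∩ before v F ∣   ≤⟨ ^-monoʳ-≤ 1≤r j≤k ⟩
          r ^ suc k                         ≈⟨ trans (*-congʳ p*r≈1) (*-identityˡ _) ⟨
          p * r * r ^ suc k                 ≈⟨ solve 3 (λ p r x → p :* r :* x := p :* (con 1 :* (r :* x))) refl p r (r ^ suc k) ⟩
          p * (1# * r ^ suc (suc k))        ≤⟨ x≤y+x 0≤1 ⟩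
          1# + p * (1# * r ^ suc (suc k))   ∎

      𝕄-links² : ∀ v → 𝕄 B S (λ Y → links v Y * links v Y) ≤
                       φ * (vertexDegree v * vertexDegree v + p * vertexEnergy v)
      𝕄-links² v = begin
        𝕄 B S (λ Y → links v Y * links v Y)
          ≈⟨ 𝕄-cong B S (λ Y → trans (∑*∑ (subsets n) (subsets n) _ _) (∑₂-cong (pair Y))) ⟩
        𝕄 B S (λ Y → ∑₂ λ E F → g E F * 𝟙? (before v E ∪ before v F ⊆? Y))
          ≈⟨ trans (𝕄-∑ B S (subsets n) _) (∑-cong (subsets n) λ E → 𝕄-∑ B S (subsets n) _) ⟩
        ∑₂ (λ E F → 𝕄 B S (λ Y → g E F * 𝟙? (before v E ∪ before v F ⊆? Y)))
          ≈⟨ ∑₂-cong (λ E F → 𝕄-distribˡ-* B S (g E F) _) ⟩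
        ∑₂ (λ E F → g E F * 𝕄 B S (λ Y → 𝟙? (before v E ∪ before v F ⊆? Y)))
          ≤⟨ ∑₂-mono term ⟩
        ∑₂ (λ E F → φ * (u E * u F + p * (u E * u F * c′ E F)))
          ≈⟨ *-distribˡ-∑₂ φ _ ⟨
        φ * ∑₂ (λ E F → u E * u F + p * (u E * u F * c′ E F))
          ≈⟨ *-congˡ (trans (∑-cong (subsets n) λ E → ∑-distrib-+ (subsets n) _ _) (∑-distrib-+ (subsets n) _ _)) ⟩
        φ * (∑₂ (λ E F → u E * u F) + ∑₂ (λ E F → p * (u E * u F * c′ E F)))
          ≈⟨ *-congˡ (+-cong (∑*∑ (subsets n) (subsets n) u u) (*-distribˡ-∑₂ p _)) ⟨
        φ * (vertexDegree v * vertexDegree v + p * vertexEnergy v) ∎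
        where
        u : Subset n → Carrier
        u E = 𝟙? (v Subsetₚ.∈? E) * w E
        x : Subset n → Carrier
        x E = r ^ ∣ before v E ─ S ∣
        g c′ : Subset n → Subset n → Carrier
        g E F  = u E * u F * (x E * x F)
        c′ E F = 𝟙? (2 ℕₚ.≤? ∣ E ∩ F ∣) * r ^ ∣ E ∩ F ∣
        pair : ∀ Y E F → u E * x E * 𝟙? (before v E ⊆? Y) * (u F * x F * 𝟙? (before v F ⊆? Y)) ≈
                         g E F * 𝟙? (before v E ∪ before v F ⊆? Y)
        pair Y E F = trans
          (solve 6 (λ a b e f i j → a :* e :* i :* (b :* f :* j) := a :* b :* (e :* f) :* (i :* j)) refl (u E) (u F) (x E) (x F) (𝟙? (before v E ⊆? Y)) (𝟙? (before v F ⊆? Y)))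
          (*-congˡ (𝟙?-× (before v E ⊆? Y) (before v F ⊆? Y) (before v E ∪ before v F ⊆? Y)
            (λ ∪⊆ → (λ {y} y∈ → ∪⊆ (Subsetₚ.p⊆p∪q (before v F) y∈)) , (λ {y} y∈ → ∪⊆ (Subsetₚ.q⊆p∪q (before v E) (before v F) y∈)))
            (λ E⊆ F⊆ → ∪-lub E⊆ F⊆)))
        power : ∀ E F → u E * u F * r ^ ∣ before v E ∩ before v F ∣ ≤ u E * u F * (1# + p * c′ E F)
        power E F with v Subsetₚ.∈? E | v Subsetₚ.∈? F
        ... | yes v∈E | yes v∈F = *-monoʳ-≤ (*-nonNeg (*-nonNeg 0≤1 (0≤w E)) (*-nonNeg 0≤1 (0≤w F))) (before-power v∈E v∈F)
        ... | no _    | _       = ≤-reflexive (trans (vanish _) (sym (vanish _)))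
          where
          vanish : ∀ {b} z → 0# * w E * (b * w F) * z ≈ 0#
          vanish {b} z = solve 4 (λ e b f z → con 0 :* e :* (b :* f) :* z := con 0) refl (w E) b (w F) z
        ... | yes _   | no _    = ≤-reflexive (trans (vanish _) (sym (vanish _)))
          where
          vanish : ∀ z → 1# * w E * (0# * w F) * z ≈ 0#
          vanish z = solve 3 (λ e f z → con 1 :* e :* (con 0 :* f) :* z := con 0) refl (w E) (w F) z
        term : ∀ E F → g E F * 𝕄 B S (λ Y → 𝟙? (before v E ∪ before v F ⊆? Y)) ≤ φ * (u E * u F + p * (u E * u F * c′ E F))
        term E F = begin
          g E F * 𝕄 B S (λ Y → 𝟙? (before v E ∪ before v F ⊆? Y))
            ≤⟨ *-monoʳ-≤ (*-nonNeg 0≤uu (*-nonNeg (0≤^ 0≤r ∣ before v E ─ S ∣) (0≤^ 0≤r ∣ before v F ─ S ∣))) (𝕄-𝟙⊆-≤ B S dec (before v E ∪ before v F)) ⟩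
          g E F * (y * φ)
            ≈⟨ solve 5 (λ a e f y φ → a :* (e :* f) :* (y :* φ) := φ :* (a :* (e :* f :* y))) refl (u E * u F) (x E) (x F) y φ ⟩
          φ * (u E * u F * (x E * x F * y))
            ≤⟨ *-monoʳ-≤ (proj₁ 0<Φ) (*-monoʳ-≤ 0≤uu (^-─-pair p*r≈1 1≤r S (before v E) (before v F))) ⟩
          φ * (u E * u F * r ^ ∣ before v E ∩ before v F ∣)
            ≤⟨ *-monoʳ-≤ (proj₁ 0<Φ) (power E F) ⟩
          φ * (u E * u F * (1# + p * c′ E F))
            ≈⟨ *-congˡ (solve 3 (λ a p c → a :* (con 1 :+ p :* c) := a :+ p :* (a :* c)) refl (u E * u F) p (c′ E F)) ⟩
          φ * (u E * u F + p * (u E * u F * c′ E F)) ∎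
          where
          y : Carrier
          y = p ^ ∣ (before v E ∪ before v F) ─ S ∣
          0≤uu : 0# ≤ u E * u F
          0≤uu = *-nonNeg (0≤vw v E) (0≤vw v F)

      -- AM-GM in the form 2 b D ≤ l b + l⁻¹ D² for b ∈ {0, 1}.
      𝕄-blocked*links : ∀ v {l l⁻} → l * l⁻ ≈ 1# → 0# ≤ l⁻ → 𝕄 B S (blocked v) ≤ δ * φ → 0# ≤ l →
        𝕄 B S (λ Y → blocked v Y * links v Y) + 𝕄 B S (λ Y → blocked v Y * links v Y) ≤
        φ * (δ * l + l⁻ * (vertexDegree v * vertexDegree v + p * vertexEnergy v))
      𝕄-blocked*links v {l} {l⁻} ll⁻≈1 0≤l⁻ blocked≤ 0≤l = begin
        𝕄 B S (λ Y → b Y * D Y) + 𝕄 B S (λ Y → b Y * D Y)      ≈⟨ 𝕄-distrib-+ B S _ _ ⟨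
        𝕄 B S (λ Y → b Y * D Y + b Y * D Y)                    ≤⟨ 𝕄-mono B S (λ Y _ → pointwise Y) ⟩
        𝕄 B S (λ Y → l * b Y + l⁻ * (D Y * D Y))               ≈⟨ trans (𝕄-distrib-+ B S _ _) (+-cong (𝕄-distribˡ-* B S l _) (𝕄-distribˡ-* B S l⁻ _)) ⟩
        l * 𝕄 B S b + l⁻ * 𝕄 B S (λ Y → D Y * D Y)             ≤⟨ +-mono-≤ (*-monoʳ-≤ 0≤l blocked≤) (*-monoʳ-≤ 0≤l⁻ (𝕄-links² v)) ⟩
        l * (δ * φ) + l⁻ * (φ * K)                             ≈⟨ solve 5 (λ l δ φ i k → l :* (δ :* φ) :+ i :* (φ :* k) := φ :* (δ :* l :+ i :* k)) refl l δ φ l⁻ K ⟩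
        φ * (δ * l + l⁻ * K)                                   ∎
        where
        b D : Subset n → Carrier
        b = blocked v
        D = links v
        K : Carrier
        K = vertexDegree v * vertexDegree v + p * vertexEnergy v
        pointwise : ∀ Y → b Y * D Y + b Y * D Y ≤ l * b Y + l⁻ * (D Y * D Y)
        pointwise Y = begin
          b Y * D Y + b Y * D Y
            ≈⟨ trans (*-congʳ ll⁻≈1) (*-identityˡ _) ⟨
          l * l⁻ * (b Y * D Y + b Y * D Y)
            ≈⟨ solve 4 (λ l i b d → l :* i :* (b :* d :+ b :* d) := i :* (l :* b :* d :+ l :* b :* d)) refl l l⁻ (b Y) (D Y) ⟩
          l⁻ * (l * b Y * D Y + l * b Y * D Y)
            ≤⟨ *-monoʳ-≤ 0≤l⁻ (2xy≤x²+y² (l * b Y) (D Y)) ⟩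
          l⁻ * (l * b Y * (l * b Y) + D Y * D Y)
            ≈⟨ solve 4 (λ l i b d → i :* (l :* b :* (l :* b) :+ d :* d) := l :* i :* (l :* (b :* b)) :+ i :* (d :* d)) refl l l⁻ (b Y) (D Y) ⟩
          l * l⁻ * (l * (b Y * b Y)) + l⁻ * (D Y * D Y)
            ≈⟨ +-congʳ (trans (*-congʳ ll⁻≈1) (trans (*-identityˡ _) (*-congˡ (𝟙-idem (not (B (Y ∪ ⁅ v ⁆))))))) ⟩
          l * b Y + l⁻ * (D Y * D Y) ∎

      module _ {s : ℕ} (uniform : ∀ E → w E ≈ 0# ⊎ ∣ E ∣ ≡ s) where

        ∑-vertexDegree : ∑ (allFin n) vertexDegree ≈ fromℕ s * ∥ w ∥
        ∑-vertexDegree = begin-equality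
          ∑ (allFin n) vertexDegree
            ≈⟨ ∑-comm (allFin n) (subsets n) _ ⟩
          ∑ (subsets n) (λ E → ∑ (allFin n) (λ v → 𝟙? (v Subsetₚ.∈? E) * w E))
            ≈⟨ ∑-cong (subsets n) (λ E → *-distribʳ-∑ (w E) (allFin n) _) ⟨
          ∑ (subsets n) (λ E → ∑ (allFin n) (λ v → 𝟙? (v Subsetₚ.∈? E)) * w E)
            ≈⟨ ∑-cong (subsets n) (λ E → trans (*-congʳ (∑-∈ E)) (size E (uniform E))) ⟩
          ∑ (subsets n) (λ E → fromℕ s * w E)
            ≈⟨ *-distribˡ-∑ (fromℕ s) (subsets n) w ⟨
          fromℕ s * ∥ w ∥ ∎
          where
          size : ∀ E → w E ≈ 0# ⊎ ∣ E ∣ ≡ s → fromℕ ∣ E ∣ * w E ≈ fromℕ s * w E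
          size E (inj₁ wE≈0)   = trans (trans (*-congˡ wE≈0) (zeroʳ _)) (sym (trans (*-congˡ wE≈0) (zeroʳ _)))
          size E (inj₂ ≡.refl) = refl

        -- Double counting: a pair is seen from each of its common vertices, of which there are at
        -- most `s`.
        ∑-vertexEnergy : ∑ (allFin n) vertexEnergy ≤ fromℕ s * pairEnergy r w
        ∑-vertexEnergy = begin
          ∑ (allFin n) vertexEnergy
            ≈⟨ ∑-∑₂-comm (allFin n) _ ⟩
          ∑₂ (λ E F → ∑ (allFin n) (λ v → 𝟙? (v Subsetₚ.∈? E) * w E * (𝟙? (v Subsetₚ.∈? F) * w F) * c′ E F))
            ≈⟨ ∑₂-cong (λ E F → trans (∑-cong (allFin n) (rearrange E F)) (sym (*-distribʳ-∑ _ (allFin n) _))) ⟩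
          ∑₂ (λ E F → ∑ (allFin n) (λ v → 𝟙? (v Subsetₚ.∈? E ∩ F)) * (w E * w F * c′ E F))
            ≤⟨ ∑₂-mono (λ E F → ≤-trans (≤-reflexive (*-congʳ (∑-∈ (E ∩ F)))) (size E F (uniform E))) ⟩
          ∑₂ (λ E F → fromℕ s * (w E * w F * c′ E F))
            ≈⟨ *-distribˡ-∑₂ (fromℕ s) _ ⟨
          fromℕ s * pairEnergy r w ∎
          where
          c′ : Subset n → Subset n → Carrier
          c′ E F = 𝟙? (2 ℕₚ.≤? ∣ E ∩ F ∣) * r ^ ∣ E ∩ F ∣
          rearrange : ∀ E F v → 𝟙? (v Subsetₚ.∈? E) * w E * (𝟙? (v Subsetₚ.∈? F) * w F) * c′ E F ≈
                                𝟙? (v Subsetₚ.∈? E ∩ F) * (w E * w F * c′ E F)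
          rearrange E F v = trans
            (solve 5 (λ a b e f c → a :* e :* (b :* f) :* c := a :* b :* (e :* f :* c)) refl (𝟙? (v Subsetₚ.∈? E)) (𝟙? (v Subsetₚ.∈? F)) (w E) (w F) (c′ E F))
            (*-congʳ (𝟙?-× (v Subsetₚ.∈? E) (v Subsetₚ.∈? F) (v Subsetₚ.∈? E ∩ F) (Subsetₚ.x∈p∩q⁻ E F) (λ v∈E v∈F → Subsetₚ.x∈p∩q⁺ (v∈E , v∈F))))
          size : ∀ E F → w E ≈ 0# ⊎ ∣ E ∣ ≡ s → fromℕ ∣ E ∩ F ∣ * (w E * w F * c′ E F) ≤ fromℕ s * (w E * w F * c′ E F)
          size E F (inj₁ wE≈0)   = ≤-reflexive (trans (vanish _) (sym (vanish _)))
            where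
            vanish : ∀ k → k * (w E * w F * c′ E F) ≈ 0#
            vanish k = trans (*-congˡ (trans (*-congʳ (trans (*-congʳ wE≈0) (zeroˡ _))) (zeroˡ _))) (zeroʳ k)
          size E F (inj₂ ≡.refl) = *-monoˡ-≤ (*-nonNeg (*-nonNeg (0≤w E) (0≤w F)) (0≤pairEnergy-term 0≤r (E ∩ F)))
            (fromℕ-mono-≤ (Subsetₚ.∣p∩q∣≤∣p∣ E F))

      ∑-const : ∀ m y → ∑ (allFin m) (λ _ → y) ≈ fromℕ m * y
      ∑-const zero    y = sym (zeroˡ y)
      ∑-const (suc m) y = begin-equality
        ∑ (allFin (suc m)) (λ _ → y)     ≈⟨ ∑-allFin-suc m (λ _ → y) ⟩
        y + ∑ (allFin m) (λ _ → y)       ≈⟨ +-cong (sym (*-identityˡ y)) (∑-const m y) ⟩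
        1# * y + fromℕ m * y             ≈⟨ distribʳ _ _ _ ⟨
        fromℕ (suc m) * y                ∎

      -- The AM-GM parameter at v is t (d(v) + m), where m = s ∥w∥ / n is the
      -- average degree: this balances high-degree vertices against the
      -- crude bound on the energy at low-degree ones.
      rejected-weight-bound : ∀ {s} (C : Subset n) (t κ : Carrier) → 1 ℕ.≤ s → 1 ℕ.≤ n →
        (∀ E → w E ≈ 0# ⊎ (¬ T (B E) × ∣ E ∣ ≡ s × E ⊆ C)) →
        (∀ v → v ∈ C → δ̄ * φ ≤ Φ B (S ∪ ⁅ v ⁆)) →
        0# < t → (δ * (t * fromℕ s) + δ * (t * fromℕ s)) + (δ * (t * fromℕ s) + δ * (t * fromℕ s)) ≈ 1# →
        fromℕ s + fromℕ s ≤ t → κ + κ ≤ t →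
        p * fromℕ n * pairEnergy r w ≤ κ * (∥ w ∥ * ∥ w ∥) →
        ¬ (0# < ∥ w ∥)
      rejected-weight-bound {s} C t κ 1≤s 1≤n edge heavy 0<t δtσ 2σ≤t 2κ≤t Γ≤ 0<W = <⇒≱ (*-pos 0<t 0<W) tW≤0
        where
        W N σ Γ m : Carrier
        W = ∥ w ∥
        N = fromℕ n
        σ = fromℕ s
        Γ = pairEnergy r w
        m = σ * W / N
        0<N : 0# < N
        0<N = fromℕ-pos 1≤n
        0<σ : 0# < σ
        0<σ = fromℕ-pos 1≤s
        0<m : 0# < m
        0<m = *-pos (*-pos 0<σ 0<W) (0<⁻¹ 0<N)
        Nm≈σW : N * m ≈ σ * W
        Nm≈σW = begin-equality
          N * (σ * W * N ⁻¹)  ≈⟨ solve 3 (λ n x i → n :* (x :* i) := n :* i :* x) refl N (σ * W) (N ⁻¹) ⟩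
          N * N ⁻¹ * (σ * W)  ≈⟨ trans (*-congʳ (x*x⁻¹≈1 0<N)) (*-identityˡ _) ⟩
          σ * W               ∎
        uniform : ∀ E → w E ≈ 0# ⊎ ∣ E ∣ ≡ s
        uniform E = [ inj₁ , (λ (_ , ∣E∣≡s , _) → inj₂ ∣E∣≡s) ]′ (edge E)
        d l l⁻ G : Fin n → Carrier
        d = vertexDegree
        l v = t * (d v + m)
        l⁻ v = l v ⁻¹
        G = vertexEnergy
        0<l : ∀ v → 0# < l v
        0<l v = *-pos 0<t (<-≤-trans 0<m (x≤y+x (0≤vertexDegree v)))
        0≤l⁻ : ∀ v → 0# ≤ l⁻ v
        0≤l⁻ v = proj₁ (0<⁻¹ (0<l v))
        ll⁻≈1 : ∀ v → l v * l⁻ v ≈ 1#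
        ll⁻≈1 v = x*x⁻¹≈1 (0<l v)
        M : Fin n → Carrier
        M v = 𝕄 B S (λ Y → blocked v Y * links v Y)
        bound : Fin n → Carrier
        bound v = δ * l v + l⁻ v * (d v * d v + p * G v)
        vertex : ∀ v → M v + M v ≤ φ * bound v
        vertex v with v Subsetₚ.∈? C
        ... | yes v∈C = 𝕄-blocked*links v (ll⁻≈1 v) (0≤l⁻ v) (𝕄-blocked-≤ v (heavy v v∈C)) (proj₁ (0<l v))
        -- Every edge of positive weight lies in `C`, so there are no links at `v` and heaviness of
        -- `v` is not called for.
        ... | no  v∉C = ≤-trans (≤-reflexive (trans (+-cong M≈0 M≈0) (+-identityˡ 0#)))
          (*-nonNeg (proj₁ 0<Φ) (0≤x+y (*-nonNeg 0≤δ (proj₁ (0<l v))) (*-nonNeg (0≤l⁻ v)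
            (0≤x+y (*-nonNeg (0≤vertexDegree v) (0≤vertexDegree v)) (*-nonNeg 0≤p (0≤vertexEnergy v))))))
          where
          edge≈0 : ∀ E → w E ≈ 0# ⊎ (¬ T (B E) × ∣ E ∣ ≡ s × E ⊆ C) → 𝟙? (v Subsetₚ.∈? E) * w E ≈ 0#
          edge≈0 E (inj₁ wE≈0) = trans (*-congˡ wE≈0) (zeroʳ _)
          edge≈0 E (inj₂ (_ , _ , E⊆C)) = trans (*-congʳ (𝟙?-false (v Subsetₚ.∈? E) (v∉C ∘ E⊆C))) (zeroˡ _)
          links≈0 : ∀ Y → links v Y ≈ 0#
          links≈0 Y = trans (∑-cong (subsets n) λ E → trans (*-congʳ (trans (*-congʳ (edge≈0 E (edge E))) (zeroˡ _))) (zeroˡ _)) (∑-zero (subsets n))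
          M≈0 : M v ≈ 0#
          M≈0 = trans (𝕄-cong B S λ Y → trans (*-congˡ (links≈0 Y)) (zeroʳ _)) (trans (𝕄-const B S 0#) (zeroˡ _))
        A Q : Carrier
        A = ∑ (allFin n) (λ v → l⁻ v * (d v * d v))
        Q = ∑ (allFin n) (λ v → l⁻ v * G v)
        ∑l≈ : ∑ (allFin n) l ≈ t * (σ * W + σ * W)
        ∑l≈ = begin-equality
          ∑ (allFin n) l                                      ≈⟨ *-distribˡ-∑ t (allFin n) _ ⟨
          t * ∑ (allFin n) (λ v → d v + m)                    ≈⟨ *-congˡ (∑-distrib-+ (allFin n) d _) ⟩
          t * (∑ (allFin n) d + ∑ (allFin n) (λ _ → m))       ≈⟨ *-congˡ (+-cong (∑-vertexDegree uniform) (trans (∑-const n m) Nm≈σW)) ⟩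
          t * (σ * W + σ * W)                                 ∎
        2W≤ : W + W ≤ δ * (t * (σ * W + σ * W)) + (A + p * Q)
        2W≤ = *-cancelˡ-≤ 0<Φ (begin
          φ * (W + W)                                   ≈⟨ distribˡ φ W W ⟩
          φ * W + φ * W                                 ≤⟨ +-mono-≤ φW≤ φW≤ ⟩
          ∑ (allFin n) M + ∑ (allFin n) M               ≈⟨ ∑-distrib-+ (allFin n) M M ⟨
          ∑ (allFin n) (λ v → M v + M v)                ≤⟨ ∑-mono (allFin n) vertex ⟩
          ∑ (allFin n) (λ v → φ * bound v)              ≈⟨ *-distribˡ-∑ φ (allFin n) bound ⟨
          φ * ∑ (allFin n) bound                        ≈⟨ *-congˡ (∑-distrib-+ (allFin n) _ _) ⟩
          φ * (∑ (allFin n) (λ v → δ * l v) + ∑ (allFin n) (λ v → l⁻ v * (d v * d v + p * G v)))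
            ≈⟨ *-congˡ (+-cong (trans (sym (*-distribˡ-∑ δ (allFin n) l)) (*-congˡ ∑l≈)) (trans
                 (∑-cong (allFin n) λ v → solve 4 (λ i d p g → i :* (d :+ p :* g) := i :* d :+ p :* (i :* g)) refl (l⁻ v) (d v * d v) p (G v))
                 (trans (∑-distrib-+ (allFin n) _ _) (+-congˡ (sym (*-distribˡ-∑ p (allFin n) _)))))) ⟩
          φ * (δ * (t * (σ * W + σ * W)) + (A + p * Q)) ∎)
          where
          φW≤ : φ * W ≤ ∑ (allFin n) M
          φW≤ = Φ*∥w∥≤ λ E → [ inj₁ , (λ (¬BE , _) → inj₂ ¬BE) ]′ (edge E)
        -- The two summands of `l v` serve one purpose each: `t d(v) ≤ l v` bounds `A`, and
        -- `t m ≤ l v` bounds `Q`.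
        tA≤ : t * A ≤ σ * W
        tA≤ = begin
          t * A                                                 ≈⟨ *-distribˡ-∑ t (allFin n) _ ⟩
          ∑ (allFin n) (λ v → t * (l⁻ v * (d v * d v)))         ≤⟨ ∑-mono (allFin n) term ⟩
          ∑ (allFin n) d                                        ≈⟨ ∑-vertexDegree uniform ⟩
          σ * W                                                 ∎
          where
          term : ∀ v → t * (l⁻ v * (d v * d v)) ≤ d v
          term v = begin
            t * (l⁻ v * (d v * d v))   ≈⟨ solve 3 (λ t i d → t :* (i :* (d :* d)) := t :* d :* (i :* d)) refl t (l⁻ v) (d v) ⟩
            t * d v * (l⁻ v * d v)     ≤⟨ *-monoˡ-≤ (*-nonNeg (0≤l⁻ v) (0≤vertexDegree v)) (*-monoʳ-≤ (proj₁ 0<t) (x≤x+y (proj₁ 0<m))) ⟩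
            l v * (l⁻ v * d v)         ≈⟨ *-assoc _ _ _ ⟨
            l v * l⁻ v * d v           ≈⟨ trans (*-congʳ (ll⁻≈1 v)) (*-identityˡ _) ⟩
            d v                        ∎
        tmQ≤ : t * m * Q ≤ σ * Γ
        tmQ≤ = begin
          t * m * Q                                             ≈⟨ *-distribˡ-∑ (t * m) (allFin n) _ ⟩
          ∑ (allFin n) (λ v → t * m * (l⁻ v * G v))             ≤⟨ ∑-mono (allFin n) term ⟩
          ∑ (allFin n) G                                        ≤⟨ ∑-vertexEnergy uniform ⟩
          σ * Γ                                                 ∎
          where
          term : ∀ v → t * m * (l⁻ v * G v) ≤ G v
          term v = begin
            t * m * (l⁻ v * G v)       ≤⟨ *-monoˡ-≤ (*-nonNeg (0≤l⁻ v) (0≤vertexEnergy v)) (*-monoʳ-≤ (proj₁ 0<t) (x≤y+x (0≤vertexDegree v))) ⟩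
            l v * (l⁻ v * G v)         ≈⟨ *-assoc _ _ _ ⟨
            l v * l⁻ v * G v           ≈⟨ trans (*-congʳ (ll⁻≈1 v)) (*-identityˡ _) ⟩
            G v                        ∎
        -- Multiplying by `N m = σ W` supplies the factor `N` that the hypothesis on `Γ` asks for.
        tpQ≤ : t * (p * Q) ≤ κ * W
        tpQ≤ = *-cancelˡ-≤ (*-pos 0<σ 0<W) (begin
          σ * W * (t * (p * Q))        ≈⟨ *-congʳ Nm≈σW ⟨
          N * m * (t * (p * Q))        ≈⟨ solve 5 (λ n m t p q → n :* m :* (t :* (p :* q)) := p :* n :* (t :* m :* q)) refl N m t p Q ⟩
          p * N * (t * m * Q)          ≤⟨ *-monoʳ-≤ (*-nonNeg 0≤p (proj₁ 0<N)) tmQ≤ ⟩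
          p * N * (σ * Γ)              ≈⟨ solve 3 (λ a s g → a :* (s :* g) := s :* (a :* g)) refl (p * N) σ Γ ⟩
          σ * (p * N * Γ)              ≤⟨ *-monoʳ-≤ (proj₁ 0<σ) Γ≤ ⟩
          σ * (κ * (W * W))            ≈⟨ solve 3 (λ s k w → s :* (k :* (w :* w)) := s :* w :* (k :* w)) refl σ κ W ⟩
          σ * W * (κ * W)              ∎)
        y z : Carrier
        y = δ * (t * σ)
        z = t * W
        2z≤ : z + z ≤ (y + y) * z + (σ * W + κ * W)
        2z≤ = begin
          z + z                                                     ≈⟨ distribˡ t W W ⟨
          t * (W + W)                                               ≤⟨ *-monoʳ-≤ (proj₁ 0<t) 2W≤ ⟩
          t * (δ * (t * (σ * W + σ * W)) + (A + p * Q))             ≈⟨ solve 7 (λ t δ σ w a p q → t :* (δ :* (t :* (σ :* w :+ σ :* w)) :+ (a :+ p :* q)) :=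
                                                                        (δ :* (t :* σ) :+ δ :* (t :* σ)) :* (t :* w) :+ (t :* a :+ t :* (p :* q))) refl t δ σ W A p Q ⟩
          (y + y) * z + (t * A + t * (p * Q))                       ≤⟨ +-monoʳ-≤ _ (+-mono-≤ tA≤ tpQ≤) ⟩
          (y + y) * z + (σ * W + κ * W)                             ∎
        -- Doubling `2z≤` gives `4 z ≤ 3 z`: one `z` comes from `4 δ t σ = 1`, one from `2 σ ≤ t`
        -- and one from `2 κ ≤ t`.
        tW≤0 : z ≤ 0#
        tW≤0 = +-cancelʳ-≤ (z + z + z) (begin
          z + (z + z + z)                                                               ≈⟨ solve 1 (λ z → z :+ (z :+ z :+ z) := (z :+ z) :+ (z :+ z)) refl z ⟩
          (z + z) + (z + z)                                                             ≤⟨ +-mono-≤ 2z≤ 2z≤ ⟩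
          ((y + y) * z + (σ * W + κ * W)) + ((y + y) * z + (σ * W + κ * W))             ≈⟨ solve 5 (λ y z σ κ w → ((y :+ y) :* z :+ (σ :* w :+ κ :* w)) :+ ((y :+ y) :* z :+ (σ :* w :+ κ :* w)) :=
                                                                                            ((y :+ y) :+ (y :+ y)) :* z :+ ((σ :+ σ) :* w :+ (κ :+ κ) :* w)) refl y z σ κ W ⟩
          ((y + y) + (y + y)) * z + ((σ + σ) * W + (κ + κ) * W)                         ≤⟨ +-mono-≤ (≤-reflexive (trans (*-congʳ δtσ) (*-identityˡ z))) (+-mono-≤ (*-monoˡ-≤ (proj₁ 0<W) 2σ≤t) (*-monoˡ-≤ (proj₁ 0<W) 2κ≤t)) ⟩
          z + (z + z)                                                                   ≈⟨ solve 1 (λ z → z :+ (z :+ z) := con 0 :+ (z :+ z :+ z)) refl z ⟩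
          0# + (z + z + z)                                                              ∎)

-- Reading off the container, and the final assembly.

∈-subsets : ∀ {n} (L : Subset n) → L ∈ₗ subsets n
∈-subsets []            = here ≡.refl
∈-subsets (outside ∷ L) = ∈-++⁺ˡ (∈-map⁺ (outside ∷_) (∈-subsets L))
∈-subsets (inside  ∷ L) = ∈-++⁺ʳ _ (∈-map⁺ (inside ∷_) (∈-subsets L))

singletons : ∀ n → List (Subset n)
singletons n = map ⁅_⁆ (allFin n)

-- Rejecting a vertex excludes its singleton, so the container depends on the final event alone.
container : ∀ {n} → Event n → Subset n
container B = Vec.tabulate (λ v → B ⁅ v ⁆)

∈-container⁻ : ∀ {n} {B : Event n} {v} → v ∈ container B → T (B ⁅ v ⁆)
∈-container⁻ {B = B} {v} v∈ = Boolₚ.T-≡ .Equivalence.from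
  (≡.trans (≡.sym (Vecₚ.lookup∘tabulate (λ v → B ⁅ v ⁆) v)) (Vecₚ.[]=⇒lookup v∈))

∈-container⁺ : ∀ {n} {B : Event n} {v} → T (B ⁅ v ⁆) → v ∈ container B
∈-container⁺ {B = B} {v} Bv = Vecₚ.lookup⇒[]= v _
  (≡.trans (Vecₚ.lookup∘tabulate (λ v → B ⁅ v ⁆) v) (Boolₚ.T-≡ .Equivalence.to Bv))

⊆container : ∀ {n} {B : Event n} {I} → Decreasing B → T (B I) → I ⊆ container B
⊆container {B = B} {I} dec BI {v} v∈I = ∈-container⁺ {B = B}
  (dec (λ x∈ → ≡.subst (_∈ I) (≡.sym (Subsetₚ.x∈⁅y⁆⇒x≡y v x∈)) v∈I) BI)

T-not : ∀ {b} → T (not b) → ¬ T b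
T-not {false} _ ()

does⇒ : ∀ {a} {A : Set a} (A? : Dec A) → T (does A?) → A
does⇒ (yes a) _ = a

module Containers {c ℓ₁ ℓ₂} (em : ExcludedMiddle (c ⊔ ℓ₁ ⊔ ℓ₂)) (ℝ : Reals c ℓ₁ ℓ₂) where
  open OrderedField ℝ
  open FiniteSums ℝ
  open ≤-Reasoning
  open Solver using (solve; _:=_; _:+_; _:*_; con)

  -- As `x < y` is `x ≤ y` together with `¬ (x ≈ y)`, the case `x ≤ y` yields only a doubly negated
  -- equality, which excluded middle resolves.
  ≮⇒≥ : ∀ {x y} → ¬ (x < y) → y ≤ x
  ≮⇒≥ {x} {y} x≮y with total x y
  ... | inj₂ y≤x = y≤x
  ... | inj₁ x≤y with em {Lift (c ⊔ ℓ₂) (x ≈ y)}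
  ...   | yes x≈y = ≤-reflexive (sym (lower x≈y))
  ...   | no  x≉y = contradiction (x≤y , λ x≈y → x≉y (lift x≈y)) x≮y

  x<y⇒0<y-x : ∀ {x y} → x < y → 0# < y - x
  x<y⇒0<y-x {x} {y} x<y = ≰⇒> λ y-x≤0 → <⇒≱ x<y (begin
    y            ≈⟨ x+[y-x]≈y x y ⟨
    x + (y - x)  ≤⟨ +-monoʳ-≤ x y-x≤0 ⟩
    x + 0#       ≈⟨ +-identityʳ x ⟩
    x            ∎)

  probability : ∀ x → 0# ≤ x → x ≤ 1# → Probability
  probability x 0≤x x≤1 = record
    { value = x ; complement = 1# - x ; sum≈1 = x+[y-x]≈y x 1#
    ; 0≤value = 0≤x ; 0≤complement = x≤y⇒0≤y-x x≤1 }

  1≤⁻¹ : ∀ {x} → 0# < x → x ≤ 1# → 1# ≤ x ⁻¹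
  1≤⁻¹ {x} 0<x x≤1 = begin
    1#         ≈⟨ x*x⁻¹≈1 0<x ⟨
    x * x ⁻¹   ≤⟨ *-monoˡ-≤ (proj₁ (0<⁻¹ 0<x)) x≤1 ⟩
    1# * x ⁻¹  ≈⟨ *-identityˡ _ ⟩
    x ⁻¹       ∎

  two : Carrier
  two = fromℕ 2

  two*x≈x+x : ∀ x → two * x ≈ x + x
  two*x≈x+x = solve 1 (λ x → (con 1 :+ (con 1 :+ con 0)) :* x := x :+ x) refl

  1≤two : 1# ≤ two
  1≤two = x≤x+y (0≤x+y 0≤1 ≤-refl)

  0<two : 0# < two
  0<two = <-≤-trans 0<1 1≤two

  module Construction
    (s n : ℕ) (1≤s : 1 ℕ.≤ s) (s≤n : s ℕ.≤ n) (p q R α η : Carrier)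
    (0<p : 0# < p) (0<q : 0# < q) (0<R : 0# < R) (0<α : 0# < α) (0<η : 0# < η)
    (p≤ : p ≤ 1# / (fromℕ 2 ^ 11 * fromℕ s ^ 2))
    (2p≤q : fromℕ 2 * p ≤ q) (q≤α : q ≤ α) (α<1 : α < 1#)
    (≤R : (fromℕ 2 ^ 6) ⁻¹ * p * fromℕ n ≤ R)
    (η≤ : η ≤ (1# - α) ^ (2 ℕ.* s) / fromℕ 4)
    (𝓗 : Hypergraph n) (uniform : Uniform s 𝓗) where
    open WeightedHypergraph ℝ {n}
    open Janson ℝ {n}

    -- `δ` is the hypothesised upper bound on `p`, as the fingerprint bound requires `p ≤ δ`. `t` is
    -- set so that `δ t σ = 1/4`. `x` and `u` are the inverse densities belonging to `p` and
    -- `p / (q - p)`.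
    σ N K δ t x u : Carrier
    σ = fromℕ s
    N = fromℕ n
    K = two ^ 11 * σ ^ 2
    δ = K ⁻¹
    t = two ^ 9 * σ
    x = p ⁻¹
    u = (q - p) * x

    0<σ : 0# < σ
    0<σ = fromℕ-pos 1≤s

    1≤σ : 1# ≤ σ
    1≤σ = ≤-trans (≤-reflexive (sym (+-identityʳ 1#))) (fromℕ-mono-≤ 1≤s)

    0<K : 0# < K
    0<K = *-pos (^-pos 0<two 11) (^-pos 0<σ 2)

    Kδ≈1 : K * δ ≈ 1#
    Kδ≈1 = x*x⁻¹≈1 0<K

    0<δ : 0# < δ
    0<δ = 0<⁻¹ 0<K

    p≤δ : p ≤ δ
    p≤δ = ≤-trans p≤ (≤-reflexive (*-identityˡ δ))

    two≤K : two ≤ K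
    two≤K = begin
      two                  ≈⟨ *-identityʳ two ⟨
      two ^ 1              ≤⟨ ^-monoʳ-≤ {two} 1≤two {1} {11} (s≤s z≤n) ⟩
      two ^ 11             ≈⟨ *-identityʳ _ ⟨
      two ^ 11 * 1#        ≤⟨ *-monoʳ-≤ (0≤^ (proj₁ 0<two) 11) (1≤^ 1≤σ 2) ⟩
      two ^ 11 * σ ^ 2     ∎

    δ<1 : δ < 1#
    δ<1 = ≰⇒> λ 1≤δ → <⇒≱ 0<1 (+-cancelˡ-≤ 1# (begin
      1# + 1#     ≈⟨ two*x≈x+x 1# ⟨
      two * 1#    ≤⟨ *-mono-≤ 0≤1 (proj₁ 0<K) two≤K 1≤δ ⟩
      K * δ       ≈⟨ Kδ≈1 ⟩
      1#          ≈⟨ +-identityʳ 1# ⟨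
      1# + 0#     ∎))

    p<1 : p < 1#
    p<1 = ≤-<-trans p≤δ δ<1

    q<1 : q < 1#
    q<1 = ≤-<-trans q≤α α<1

    p<q : p < q
    p<q = ≰⇒> λ q≤p → <⇒≱ 0<p (+-cancelˡ-≤ p (begin
      p + p      ≈⟨ two*x≈x+x p ⟨
      two * p    ≤⟨ 2p≤q ⟩
      q          ≤⟨ q≤p ⟩
      p          ≈⟨ +-identityʳ p ⟨
      p + 0#     ∎))

    0<q-p : 0# < q - p
    0<q-p = x<y⇒0<y-x p<q

    Pq Pα Pp Pδ : Probability
    Pq = probability q (proj₁ 0<q) (proj₁ q<1)
    Pα = probability α (proj₁ 0<α) (proj₁ α<1)
    Pp = probability p (proj₁ 0<p) (proj₁ p<1)
    Pδ = probability δ (proj₁ 0<δ) (proj₁ δ<1)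

    px≈1 : p * x ≈ 1#
    px≈1 = x*x⁻¹≈1 0<p

    0≤x : 0# ≤ x
    0≤x = proj₁ (0<⁻¹ 0<p)

    0≤u : 0# ≤ u
    0≤u = *-nonNeg (proj₁ 0<q-p) 0≤x

    1+u≈qx : 1# + u ≈ q * x
    1+u≈qx = begin-equality
      1# + (q - p) * x       ≈⟨ +-congʳ px≈1 ⟨
      p * x + (q - p) * x    ≈⟨ distribʳ x p (q - p) ⟨
      (p + (q - p)) * x      ≈⟨ *-congʳ (x+[y-x]≈y p q) ⟩
      q * x                  ∎

    p′u≈1 : p / (q - p) * u ≈ 1#
    p′u≈1 = begin-equality
      p * (q - p) ⁻¹ * ((q - p) * x)    ≈⟨ solve 4 (λ p i y x → p :* i :* (y :* x) := p :* x :* (y :* i)) refl p ((q - p) ⁻¹) (q - p) x ⟩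
      p * x * ((q - p) * (q - p) ⁻¹)    ≈⟨ *-cong px≈1 (x*x⁻¹≈1 0<q-p) ⟩
      1# * 1#                           ≈⟨ *-identityˡ 1# ⟩
      1#                                ∎

    pN≤ : p * N ≤ two ^ 6 * R
    pN≤ = begin
      p * N                              ≈⟨ trans (*-congʳ (x*x⁻¹≈1 0<64)) (*-identityˡ _) ⟨
      two ^ 6 * (two ^ 6) ⁻¹ * (p * N)   ≈⟨ solve 4 (λ a i p n → a :* i :* (p :* n) := a :* (i :* p :* n)) refl (two ^ 6) ((two ^ 6) ⁻¹) p N ⟩
      two ^ 6 * ((two ^ 6) ⁻¹ * p * N)   ≤⟨ *-monoʳ-≤ (proj₁ 0<64) ≤R ⟩
      two ^ 6 * R                        ∎
      where
      0<64 : 0# < two ^ 6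
      0<64 = ^-pos 0<two 6

    𝓙 : Pred (Subset n) (c ⊔ ℓ₁ ⊔ ℓ₂)
    𝓙 L = IsJanson (p / (q - p)) (η * R) (𝓗 [ L ])

    -- Excluded middle makes independence Boolean, so that it can start the algorithm as an event.
    B₀ : Event n
    B₀ I = does (em {Independent 𝓙 I})

    B₀⁺ : ∀ {I} → Independent 𝓙 I → T (B₀ I)
    B₀⁺ {I} ind = Boolₚ.T-≡ .Equivalence.from (dec-true (em {Independent 𝓙 I}) ind)

    B₀⁻ : ∀ {I} → T (B₀ I) → Independent 𝓙 I
    B₀⁻ {I} = does⇒ (em {Independent 𝓙 I})

    B₀-decreasing : Decreasing B₀
    B₀-decreasing {X} {Y} X⊆Y B₀Y = B₀⁺ {X} λ E JE E⊆X → B₀⁻ {Y} B₀Y E JE (X⊆Y ∘ E⊆X)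

    module First  = Algorithm ℝ Pq Pα
    module Second = Algorithm ℝ Pp Pδ

    first : Subset n → Subset n × Event n
    first = First.result (subsets n) B₀

    second : Event n → Subset n → Subset n × Event n
    second = Second.result (singletons n)

    g : Subset n → Subset n × Subset n
    g I = proj₁ (second (proj₂ (first I)) I) , proj₁ (first I)

    -- Both runs are replayed with a fingerprint in the role of `I`: `T` recovers the event of the
    -- first run, then `S` that of the second.
    f : Subset n × Subset n → Subset n
    f (S , T) = container (proj₂ (second (proj₂ (first T)) S))

    -- Everything up to `notJanson` uses only the invariants of the two leaves, not the runs that
    -- led to them.
    module Leaves {I T₁ S₂ : Subset n} {B₁ B₂ : Event n}
                  (leaf₁ : First.Leaf (subsets n) B₀ I (T₁ , B₁))
                  (leaf₂ : Second.Leaf (singletons n) B₁ I (S₂ , B₂)) where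
      module Leaf₁ = First.Leaf leaf₁
      module Leaf₂ = Second.Leaf leaf₂

      C : Subset n
      C = container B₂

      S∪T⊆I : S₂ ∪ T₁ ⊆ I
      S∪T⊆I = ∪-lub Leaf₂.fingerprint⊆ Leaf₁.fingerprint⊆

      I⊆C : I ⊆ C
      I⊆C = ⊆container Leaf₂.decreasing Leaf₂.event

      ∣S∣≤ : fromℕ ∣ S₂ ∣ ≤ two ^ 11 * p * σ ^ 2 * N
      ∣S∣≤ = begin
        fromℕ ∣ S₂ ∣               ≈⟨ trans (*-congʳ Kδ≈1) (*-identityˡ _) ⟨
        K * δ * fromℕ ∣ S₂ ∣       ≈⟨ *-assoc _ _ _ ⟩
        K * (δ * fromℕ ∣ S₂ ∣)     ≤⟨ *-monoʳ-≤ (proj₁ 0<K) (Second.fingerprint-size p≤δ (x<y⇒0<y-x δ<1) leaf₂) ⟩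
        K * (p * N)                ≈⟨ solve 4 (λ a b p n → a :* b :* (p :* n) := a :* p :* b :* n) refl (two ^ 11) (σ ^ 2) p N ⟩
        two ^ 11 * p * σ ^ 2 * N   ∎

      ∣T∣≤ : fromℕ ∣ T₁ ∣ ≤ q * N / α
      ∣T∣≤ = *≤⇒≤/ 0<α (First.fingerprint-size q≤α (x<y⇒0<y-x α<1) leaf₁)

      module NotJanson (ν : Weight) (0≤ν : NonNegativeOn (𝓗 [ C ]) ν)
                       (Λ< : Λ p (𝓗 [ C ]) ν < e (𝓗 [ C ]) ν ^ 2 / R) where

        w w₁ w₂ : Weight
        w    = on (𝓗 [ C ]) ν
        w₁ E = 𝟙 (B₁ E) * w E
        w₂ E = 𝟙 (not (B₁ E)) * w E

        0≤w : ∀ E → 0# ≤ w E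
        0≤w E = 0≤𝟙* ((𝓗 [ C ]) E) (0≤ν E)

        0≤w₁ : ∀ E → 0# ≤ w₁ E
        0≤w₁ E = *-nonNeg (0≤𝟙 (B₁ E)) (0≤w E)

        0≤w₂ : ∀ E → 0# ≤ w₂ E
        0≤w₂ E = *-nonNeg (0≤𝟙 (not (B₁ E))) (0≤w E)

        𝟙*≤ : ∀ b E → 𝟙 b * w E ≤ w E
        𝟙*≤ b E = ≤-trans (*-monoˡ-≤ (0≤w E) (𝟙≤1 b)) (≤-reflexive (*-identityˡ _))

        w-support : ∀ E → w E ≈ 0# ⊎ (T (𝓗 E) × E ⊆ C)
        w-support E = Sum.map₂
          (λ h → let 𝓗E , h′ = Boolₚ.T-∧ .Equivalence.to h in 𝓗E , toWitness {a? = E ⊆? C} h′)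
          (𝟙*-support ((𝓗 [ C ]) E) (ν E))

        W W₁ W₂ Γ : Carrier
        W  = ∥ w ∥
        W₁ = ∥ w₁ ∥
        W₂ = ∥ w₂ ∥
        Γ  = pairEnergy x w

        W₁+W₂≈W : W₁ + W₂ ≈ W
        W₁+W₂≈W = trans (sym (∑-distrib-+ (subsets n) w₁ w₂)) (∑-cong (subsets n) λ E → split (B₁ E) (w E))
          where
          split : ∀ b y → 𝟙 b * y + 𝟙 (not b) * y ≈ y
          split true  = solve 1 (λ y → con 1 :* y :+ con 0 :* y := y) refl
          split false = solve 1 (λ y → con 0 :* y :+ con 1 :* y := y) refl

        -- For each pair of edges only the term `L = E ∩ F` of `Λ` is kept.
        RΓ<W² : R * Γ < W * W
        RΓ<W² = ≤-<-trans (*-monoʳ-≤ (proj₁ 0<R) Γ≤Λ) (<-≤-trans (</⇒*< 0<R Λ<) (≤-reflexive e²≈W²))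
          where
          Γ≤Λ : Γ ≤ Λ p (𝓗 [ C ]) ν
          Γ≤Λ = ≤-trans (pairEnergy≤energy 0≤x 0≤w) (≤-reflexive (sym (Λ≈energy px≈1 (𝓗 [ C ]) ν)))
          e²≈W² : e (𝓗 [ C ]) ν ^ 2 ≈ W * W
          e²≈W² = trans (x^2≈x*x _) (*-cong (e≈∥∥ (𝓗 [ C ]) ν) (e≈∥∥ (𝓗 [ C ]) ν))

        0≤Γ : 0# ≤ Γ
        0≤Γ = ∑-nonNeg (subsets n) λ E → ∑-nonNeg (subsets n) λ F →
          *-nonNeg (*-nonNeg (0≤w E) (0≤w F)) (0≤pairEnergy-term 0≤x (E ∩ F))

        0<W : 0# < W
        0<W = x²<y²⇒x<y (∑-nonNeg (subsets n) 0≤w)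
          (≤-<-trans (≤-trans (≤-reflexive (zeroˡ 0#)) (*-nonNeg (proj₁ 0<R) 0≤Γ)) RΓ<W²)

        module HE = HeavyEdges ℝ Pq Pα

        2W₁<W : W₁ + W₁ < W
        2W₁<W = x²<y²⇒x<y (proj₁ 0<W) (≤-<-trans 4W₁²≤RΓ RΓ<W²)
          where
          k ζ : Carrier
          k = (1# - α) ^ s
          ζ = η * R
          0<ζ : 0# < ζ
          0<ζ = *-pos 0<η 0<R
          0<k : 0# < k
          0<k = ^-pos (x<y⇒0<y-x α<1) s
          1≤q⁻¹ : 1# ≤ q ⁻¹
          1≤q⁻¹ = 1≤⁻¹ 0<q (proj₁ q<1)
          qq⁻¹≈1 : q * q ⁻¹ ≈ 1#
          qq⁻¹≈1 = x*x⁻¹≈1 0<q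
          0<Φ : 0# < Survival.Φ ℝ Pq B₁ T₁
          0<Φ = <-≤-trans (^-pos (x<y⇒0<y-x q<1) n)
            (Survival.p̄^n≤Φ ℝ Pq Leaf₁.decreasing (Leaf₁.decreasing Leaf₁.fingerprint⊆ Leaf₁.event))
          w′ : Weight
          w′ = HE.tilt (q ⁻¹) qq⁻¹≈1 1≤q⁻¹ T₁ w₁
          0≤w′ : ∀ E → 0# ≤ w′ E
          0≤w′ E = *-nonNeg (0≤w₁ E) (0≤^ (≤-trans 0≤1 1≤q⁻¹) ∣ E ─ T₁ ∣)
          w′-support : ∀ E → 𝟙 (𝓗 E) * w′ E ≈ w′ E
          w′-support E = [ (λ wE≈0 → let w′E≈0 = vanish E wE≈0 in trans (trans (*-congˡ w′E≈0) (zeroʳ _)) (sym w′E≈0)) ,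
                           (λ (𝓗E , _) → trans (*-congʳ (𝟙-T 𝓗E)) (*-identityˡ _)) ]′ (w-support E)
            where
            vanish : ∀ E → w E ≈ 0# → w′ E ≈ 0#
            vanish E wE≈0 = trans (*-congʳ (trans (*-congˡ wE≈0) (zeroʳ _))) (zeroˡ _)
          heavy : ∀ E → w₁ E ≈ 0# ⊎ (∣ E ∣ ≡ s × First.Heavy B₁ T₁ E)
          heavy E = [ (λ wE≈0 → inj₁ (trans (*-congˡ wE≈0) (zeroʳ _))) ,
                      (λ (𝓗E , _) → Sum.map₂ (λ B₁E → uniform E 𝓗E , Leaf₁.resolved (∈-subsets E) B₁E) (𝟙*-support (B₁ E) (w E))) ]′ (w-support E)
          sparse : ∀ Y → T (B₁ Y) → ∥ restrict Y w′ ∥ * ∥ restrict Y w′ ∥ ≤ ζ * energy u (restrict Y w′)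
          sparse Y B₁Y = begin
            ∥ restrict Y w′ ∥ * ∥ restrict Y w′ ∥   ≈⟨ *-cong e≈ e≈ ⟨
            e 𝓖 w′ * e 𝓖 w′                         ≈⟨ x^2≈x*x _ ⟨
            -- Otherwise `w′` would put `Y` itself into `𝓙`, although `Y` is independent and
            -- contains `Y`.
            e 𝓖 w′ ^ 2                              ≤⟨ ≤/⇒*≤′ (≮⇒≥ λ Λ<e² → B₀⁻ {Y} (Leaf₁.stronger B₁Y) Y (w′ , (λ E _ → 0≤w′ E) , Λ<e²) id) ⟩
            ζ * Λ (p / (q - p)) 𝓖 w′                ≈⟨ *-congˡ (trans (Λ≈energy p′u≈1 𝓖 w′) (energy-cong u (on-restrict {𝓗 = 𝓗} w′-support Y))) ⟩
            ζ * energy u (restrict Y w′)            ∎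
            where
            𝓖 : Hypergraph n
            𝓖 = 𝓗 [ Y ]
            e≈ : e 𝓖 w′ ≈ ∥ restrict Y w′ ∥
            e≈ = trans (e≈∥∥ 𝓖 w′) (∑-cong (subsets n) (on-restrict {𝓗 = 𝓗} w′-support Y))
            ≤/⇒*≤′ : ∀ {a b} → a / ζ ≤ b → a ≤ ζ * b
            ≤/⇒*≤′ {a} {b} a/ζ≤b = begin
              a                ≈⟨ trans (*-congʳ (x*x⁻¹≈1 0<ζ)) (*-identityˡ a) ⟨
              ζ * ζ ⁻¹ * a     ≈⟨ solve 3 (λ z i a → z :* i :* a := z :* (a :* i)) refl ζ (ζ ⁻¹) a ⟩
              ζ * (a / ζ)      ≤⟨ *-monoʳ-≤ (proj₁ 0<ζ) a/ζ≤b ⟩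
              ζ * b            ∎
          bound : k * W₁ * (k * W₁) ≤ ζ * Γ
          bound = ≤-trans
            (HE.heavy-weight-bound (q ⁻¹) qq⁻¹≈1 1≤q⁻¹ Leaf₁.decreasing T₁ 0<Φ w₁ 0≤w₁ 0≤u 0≤x (proj₁ 0<ζ) 1+u≈qx heavy sparse)
            (*-monoʳ-≤ (proj₁ 0<ζ) (pairEnergy-mono 0≤x 0≤w₁ λ E → 𝟙*≤ (B₁ E) E))
          4η≤k² : fromℕ 4 * η ≤ k * k
          4η≤k² = ≤-trans (≤/⇒*≤ (fromℕ-pos {4} (s≤s z≤n)) η≤) (≤-reflexive
            (trans (^-homo-* (1# - α) s (s ℕ.+ 0)) (*-congˡ (^-congʳ (1# - α) (ℕₚ.+-identityʳ s)))))
          4W₁²≤RΓ : (W₁ + W₁) * (W₁ + W₁) ≤ R * Γ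
          4W₁²≤RΓ = *-cancelˡ-≤ (*-pos 0<k 0<k) (begin
            k * k * ((W₁ + W₁) * (W₁ + W₁))   ≈⟨ solve 2 (λ k w → k :* k :* ((w :+ w) :* (w :+ w)) := (con 1 :+ (con 1 :+ (con 1 :+ (con 1 :+ con 0)))) :* (k :* w :* (k :* w))) refl k W₁ ⟩
            fromℕ 4 * (k * W₁ * (k * W₁))     ≤⟨ *-monoʳ-≤ (0≤fromℕ 4) bound ⟩
            fromℕ 4 * (η * R * Γ)             ≈⟨ solve 4 (λ a η r g → a :* (η :* r :* g) := a :* η :* (r :* g)) refl (fromℕ 4) η R Γ ⟩
            fromℕ 4 * η * (R * Γ)             ≤⟨ *-monoˡ-≤ (*-nonNeg (proj₁ 0<R) 0≤Γ) 4η≤k² ⟩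
            k * k * (R * Γ)                   ∎)

        2W₂<W : W₂ + W₂ < W
        2W₂<W = ≰⇒> λ W≤2W₂ → RejectedEdges.rejected-weight-bound ℝ Pp Pδ x px≈1 (1≤⁻¹ 0<p (proj₁ p<1)) Leaf₂.decreasing S₂ 0<Φ w₂ 0≤w₂
          C t κ 1≤s (ℕₚ.≤-trans 1≤s s≤n) edge heavy (*-pos (^-pos 0<two 9) 0<σ) 4y≈1 2σ≤t 2κ≤t (Γ₂≤ W≤2W₂) (0<W₂ W≤2W₂)
          where
          κ y : Carrier
          -- This is `4 · 2^6`: the `2^6` comes from `pN≤`, and the 4 from squaring the assumption
          -- `W ≤ 2 W₂`.
          κ = two ^ 8
          y = δ * (t * σ)
          0<Φ : 0# < Survival.Φ ℝ Pp B₂ S₂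
          0<Φ = <-≤-trans (^-pos (x<y⇒0<y-x p<1) n)
            (Survival.p̄^n≤Φ ℝ Pp Leaf₂.decreasing (Leaf₂.decreasing Leaf₂.fingerprint⊆ Leaf₂.event))
          edge : ∀ E → w₂ E ≈ 0# ⊎ (¬ T (B₂ E) × ∣ E ∣ ≡ s × E ⊆ C)
          edge E = [ (λ wE≈0 → inj₁ (trans (*-congˡ wE≈0) (zeroʳ _))) ,
                     (λ h → Sum.map₂ (λ ¬B₁E → T-not ¬B₁E ∘ Leaf₂.stronger , uniform E (proj₁ h) , proj₂ h) (𝟙*-support (not (B₁ E)) (w E))) ]′ (w-support E)
          heavy : ∀ v → v ∈ C → (1# - δ) * Survival.Φ ℝ Pp B₂ S₂ ≤ Survival.Φ ℝ Pp B₂ (S₂ ∪ ⁅ v ⁆)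
          -- The exponent `∣ ⁅ v ⁆ ─ S₂ ∣` is 0 if `v` is already in `S₂`, so it is only bounded by
          -- 1.
          heavy v v∈C = ≤-trans
            (*-monoˡ-≤ (proj₁ 0<Φ) (≤-trans (≤-reflexive (sym (*-identityʳ _)))
              (^-antimonoʳ-≤ (proj₁ (x<y⇒0<y-x δ<1)) Second.δ̄≤1 {n = 1}
                (ℕₚ.≤-trans (Subsetₚ.p⊆q⇒∣p∣≤∣q∣ (Subsetₚ.p─q⊆p ⁅ v ⁆ S₂)) (ℕₚ.≤-reflexive (Subsetₚ.∣⁅x⁆∣≡1 v))))))
            (Leaf₂.resolved (∈-map⁺ ⁅_⁆ (∈-allFin v)) (∈-container⁻ {B = B₂} v∈C))
          4y≈1 : (y + y) + (y + y) ≈ 1#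
          4y≈1 = begin-equality
            (y + y) + (y + y)                        ≈⟨ solve 3 (λ d a s → (d :* (a :* s :* s) :+ d :* (a :* s :* s)) :+ (d :* (a :* s :* s) :+ d :* (a :* s :* s)) :=
                                                          (con 1 :+ (con 1 :+ con 0)) :* ((con 1 :+ (con 1 :+ con 0)) :* a) :* (s :* (s :* con 1)) :* d) refl δ (two ^ 9) σ ⟩
            two * (two * two ^ 9) * σ ^ 2 * δ        ≈⟨ Kδ≈1 ⟩
            1#                                       ∎
          2κ≤t : κ + κ ≤ t
          2κ≤t = begin
            κ + κ           ≈⟨ two*x≈x+x κ ⟨
            two ^ 9         ≈⟨ *-identityʳ _ ⟨
            two ^ 9 * 1#    ≤⟨ *-monoʳ-≤ (0≤^ (proj₁ 0<two) 9) 1≤σ ⟩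
            t               ∎
          2σ≤t : σ + σ ≤ t
          2σ≤t = begin
            σ + σ           ≈⟨ two*x≈x+x σ ⟨
            two * σ         ≤⟨ *-monoˡ-≤ (proj₁ 0<σ) (≤-trans (≤-reflexive (sym (*-identityʳ two))) (^-monoʳ-≤ {two} 1≤two {1} {9} (s≤s z≤n))) ⟩
            t               ∎
          Γ₂≤ : W ≤ W₂ + W₂ → p * N * pairEnergy x w₂ ≤ κ * (W₂ * W₂)
          Γ₂≤ W≤2W₂ = begin
            p * N * pairEnergy x w₂                   ≤⟨ *-mono-≤ 0≤Γ₂ (*-nonNeg (0≤^ (proj₁ 0<two) 6) (proj₁ 0<R)) pN≤ (pairEnergy-mono 0≤x 0≤w₂ λ E → 𝟙*≤ (not (B₁ E)) E) ⟩
            two ^ 6 * R * Γ                           ≈⟨ *-assoc _ _ _ ⟩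
            two ^ 6 * (R * Γ)                         ≤⟨ *-monoʳ-≤ (0≤^ (proj₁ 0<two) 6) (≤-trans (proj₁ RΓ<W²) (*-mono-≤ (proj₁ 0<W) (≤-trans (proj₁ 0<W) W≤2W₂) W≤2W₂ W≤2W₂)) ⟩
            two ^ 6 * ((W₂ + W₂) * (W₂ + W₂))         ≈⟨ solve 2 (λ a w → a :* ((w :+ w) :* (w :+ w)) := (con 1 :+ (con 1 :+ con 0)) :* ((con 1 :+ (con 1 :+ con 0)) :* a) :* (w :* w)) refl (two ^ 6) W₂ ⟩
            κ * (W₂ * W₂)                             ∎
            where
            0≤Γ₂ : 0# ≤ pairEnergy x w₂
            0≤Γ₂ = ∑-nonNeg (subsets n) λ E → ∑-nonNeg (subsets n) λ F →
              *-nonNeg (*-nonNeg (0≤w₂ E) (0≤w₂ F)) (0≤pairEnergy-term 0≤x (E ∩ F))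
          0<W₂ : W ≤ W₂ + W₂ → 0# < W₂
          0<W₂ W≤2W₂ = ≰⇒> λ W₂≤0 → <⇒≱ 0<W (≤-trans W≤2W₂ (≤-trans (+-mono-≤ W₂≤0 W₂≤0) (≤-reflexive (+-identityˡ 0#))))

        absurd : ⊥
        absurd = <⇒≱ 2W₁<W (+-cancelʳ-≤ W (begin
          W + W                       ≈⟨ +-cong W₁+W₂≈W W₁+W₂≈W ⟨
          (W₁ + W₂) + (W₁ + W₂)       ≈⟨ solve 2 (λ a b → (a :+ b) :+ (a :+ b) := (a :+ a) :+ (b :+ b)) refl W₁ W₂ ⟩
          (W₁ + W₁) + (W₂ + W₂)       ≤⟨ +-monoʳ-≤ _ (proj₁ 2W₂<W) ⟩
          (W₁ + W₁) + W               ∎))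

      notJanson : ¬ IsJanson p R (𝓗 [ C ])
      notJanson (ν , 0≤ν , Λ<) = NotJanson.absurd ν 0≤ν Λ<

    module At (I : Subset n) (B₀I : T (B₀ I)) where

      leaf₁ : First.Leaf (subsets n) B₀ I (first I)
      leaf₁ = First.result-leaf (subsets n) B₀I B₀-decreasing

      leaf₂ : Second.Leaf (singletons n) (proj₂ (first I)) I (second (proj₂ (first I)) I)
      leaf₂ = Second.result-leaf (singletons n) (First.Leaf.event leaf₁) (First.Leaf.decreasing leaf₁)

      open Leaves leaf₁ leaf₂ public

      f-g≡C : f (g I) ≡ C
      f-g≡C = ≡.trans
        (≡.cong (λ st → container (proj₂ (second (proj₂ st) (proj₁ (g I))))) (First.result-replay (subsets n) B₀ I Leaf₁.fingerprint⊆))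
        (≡.cong (container ∘ proj₂) (Second.result-replay (singletons n) (proj₂ (first I)) I Leaf₂.fingerprint⊆))

    -- The image of `g` on the independent sets, phrased through the Boolean `B₀` so as to stay at
    -- level `0ℓ`. A member carries the `I` it comes from, from which its size bounds and its
    -- container are derived.
    𝓨 : Pred (Subset n × Subset n) 0ℓ
    𝓨 Y = Σ[ I ∈ Subset n ] T (B₀ I) × g I ≡ Y

theorem4p6 : ∀ {c ℓ₁ ℓ₂} → ExcludedMiddle (c ⊔ ℓ₁ ⊔ ℓ₂) → (ℝ : Reals c ℓ₁ ℓ₂) →
    let open Reals ℝ
        open Janson ℝ
    in
    (s n : ℕ) → 1 ℕ.≤ s → s ℕ.≤ n →
    (p q R α η : Carrier) → 0# < p → 0# < q → 0# < R → 0# < α → 0# < η →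
    p ≤ 1# / (fromℕ 2 ^ 11 * fromℕ s ^ 2) →
    fromℕ 2 * p ≤ q → q ≤ α → α < 1# →
    (fromℕ 2 ^ 6) ⁻¹ * p * fromℕ n ≤ R →
    η ≤ (1# - α) ^ (2 ℕ.* s) / fromℕ 4 →
    (𝓗 : Hypergraph n) → Uniform s 𝓗 →
    let 𝓙 : Pred (Subset n) (c ⊔ ℓ₁ ⊔ ℓ₂)
        𝓙 L = IsJanson (p / (q - p)) (η * R) (𝓗 [ L ])
    in
    Σ[ 𝓨 ∈ Pred (Subset n × Subset n) 0ℓ ]
    Σ[ g ∈ (Subset n → Subset n × Subset n) ]
    Σ[ f ∈ (Subset n × Subset n → Subset n) ]
      (∀ I → Independent 𝓙 I → 𝓨 (g I)) ×
      (∀ I → Independent 𝓙 I → ∀ S T → g I ≡ (S , T) → (S ∪ T) ⊆ I × I ⊆ f (S , T)) ×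
      (∀ S T → 𝓨 (S , T) →
        fromℕ ∣ S ∣ ≤ fromℕ 2 ^ 11 * p * fromℕ s ^ 2 * fromℕ n ×
        fromℕ ∣ T ∣ ≤ q * fromℕ n / α) ×
      (∀ Y → 𝓨 Y → ¬ IsJanson p R (𝓗 [ f Y ]))
theorem4p6 em ℝ s n 1≤s s≤n p q R α η 0<p 0<q 0<R 0<α 0<η p≤ 2p≤q q≤α α<1 ≤R η≤ 𝓗 uniform =
  𝓨 , g , f ,
  (λ I ind → I , B₀⁺ ind , ≡.refl) ,
  (λ { I ind _ _ ≡.refl → At.S∪T⊆I I (B₀⁺ ind) ,
       ≡.subst (I ⊆_) (≡.sym (At.f-g≡C I (B₀⁺ ind))) (At.I⊆C I (B₀⁺ ind)) }) ,
  (λ { _ _ (I , B₀I , ≡.refl) → At.∣S∣≤ I B₀I , At.∣T∣≤ I B₀I }) ,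
  (λ { _ (I , B₀I , ≡.refl) → ≡.subst (λ C → ¬ Janson.IsJanson ℝ p R (𝓗 [ C ])) (≡.sym (At.f-g≡C I B₀I)) (At.notJanson I B₀I) })
  where
  open Containers.Construction em ℝ s n 1≤s s≤n p q R α η 0<p 0<q 0<R 0<α 0<η p≤ 2p≤q q≤α α<1 ≤R η≤ 𝓗 uniform
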